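{- For $m\ge 4$, call $\mathbf{x}=(x_1,\ldots,x_m)\in\mathbb{R}^m$ generic if the $\binom{m}{2}$ midpoints $(x_i+x_j)/2$, $1\le i<j\le m$, are pairwise distinct, and define its ranking pattern $$\mathrm{RP}^{\mathrm{UF}}(\mathbf{x})=\{(i_1\cdots i_m)\in\mathbb{P}_m:\ |y-x_{i_1}|<\cdots<|y-x_{i_m}|\text{ for some }y\in\mathbb{R}\},$$ where $\mathbb{P}_m$ is the set of permutations $(i_1\cdots i_m)$ of $\{1,\ldots,m\}$. Let $r_0(m)$ be the number of distinct ranking patterns $\mathrm{RP}^{\mathrm{UF}}(\mathbf{x})$ with $\mathbf{x}$ generic and $x_1<x_2<\cdots<x_m$. Then for all $m\ge 4$, $$2\left(\frac{3}{4}\right)^{m-4}\bigl\{(m-3)!\bigr\}^2\ \le\ r_0(m)\ <\ \frac{2}{m!}\left\{\frac{e\,m(m-1)^2}{8}\right\}^{m-2}.$$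
   Context: Here $e$ is Euler's number. -}

module Defs where

open import Level using (0ℓ)
open import Data.Nat.Base as ℕ using (ℕ; zero; suc; _!)
import Data.Nat.Properties as ℕ
import Data.Nat.Tactic.RingSolver as ℕ-Ring
open import Data.Integer.Base as ℤ using (ℤ; +_)
import Data.Integer.Properties as ℤ
open import Data.Rational.Base as ℚ using (ℚ; mkℚ; 0ℚ; 1ℚ; ½; _/_)
import Data.Rational.Properties as ℚ
open import Data.Rational.Solver using (module +-*-Solver)
open import Data.Rational.Unnormalised.Base as ℚᵘ using (mkℚᵘ; *≡*; *≤*; *<*)
import Data.Rational.Unnormalised.Properties as ℚᵘ
open import Data.Fin.Base as Fin using (Fin)
open import Data.Fin.Permutation using (Permutation′; _⟨$⟩ʳ_)
open import Data.Product using (∃-syntax; _×_; _,_; proj₁; proj₂)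
open import Data.Sum.Base using (_⊎_; inj₁; inj₂)
open import Data.Vec.Functional using (Vector)
open import Function.Bundles using (Bijection)
open import Relation.Binary.Bundles using (Setoid)
import Relation.Binary.Construct.On as On
open import Relation.Binary.PropositionalEquality as ≡
  using (_≡_; _≢_; refl; sym; trans; cong; cong₂; subst; subst₂)
open import Relation.Unary using (Pred)
open import Relation.Unary.Relation.Binary.Equality using (≐-setoid)

------------------------------------------------------------------------
-- Cauchy real numbers

IsCauchy : (ℕ → ℚ) → Set
IsCauchy s = ∀ ε → 0ℚ ℚ.< ε →
  ∃[ N ] (∀ i j → N ℕ.≤ i → N ℕ.≤ j → ℚ.∣ s i ℚ.- s j ∣ ℚ.< ε)

record ℝ : Set where
  constructor mkℝ
  field
    seq    : ℕ → ℚ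
    cauchy : IsCauchy seq

open ℝ public

private

  ∣-∣≤ : ∀ {p q} → p ℚ.≤ q → ℚ.- p ℚ.≤ q → ℚ.∣ p ∣ ℚ.≤ q
  ∣-∣≤ {p} p≤q -p≤q with ℚ.∣p∣≡p∨∣p∣≡-p p
  ... | inj₁ eq = subst (ℚ._≤ _) (sym eq) p≤q
  ... | inj₂ eq = subst (ℚ._≤ _) (sym eq) -p≤q

  ½-pos : ∀ {ε} → 0ℚ ℚ.< ε → 0ℚ ℚ.< ½ ℚ.* ε
  ½-pos {ε} 0<ε =
    ℚ.positive⁻¹ _ {{ℚ.pos*pos⇒pos ½ ε {{ℚ.positive 0<ε}}}}

  halves : ∀ ε → ½ ℚ.* ε ℚ.+ ½ ℚ.* ε ≡ ε
  halves ε = trans (sym (ℚ.*-distribʳ-+ ε ½ ½)) (ℚ.*-identityˡ ε)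

  const-cauchy : ∀ q → IsCauchy (λ _ → q)
  const-cauchy q ε 0<ε =
    0 , λ _ _ _ _ → subst (λ z → ℚ.∣ z ∣ ℚ.< ε) (sym (ℚ.+-inverseʳ q)) 0<ε

  +-cauchy : ∀ s t → IsCauchy s → IsCauchy t → IsCauchy (λ n → s n ℚ.+ t n)
  +-cauchy s t cs ct ε 0<ε
    with cs (½ ℚ.* ε) (½-pos 0<ε) | ct (½ ℚ.* ε) (½-pos 0<ε)
  ... | M , p | N , q = M ℕ.⊔ N , λ i j i≥ j≥ → begin-strict
    ℚ.∣ (s i ℚ.+ t i) ℚ.- (s j ℚ.+ t j) ∣
      ≡⟨ cong ℚ.∣_∣ (rearrange (s i) (t i) (s j) (t j)) ⟩
    ℚ.∣ (s i ℚ.- s j) ℚ.+ (t i ℚ.- t j) ∣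
      ≤⟨ ℚ.∣p+q∣≤∣p∣+∣q∣ (s i ℚ.- s j) (t i ℚ.- t j) ⟩
    ℚ.∣ s i ℚ.- s j ∣ ℚ.+ ℚ.∣ t i ℚ.- t j ∣
      <⟨ ℚ.+-mono-< (p i j (ℕ.m⊔n≤o⇒m≤o M N i≥) (ℕ.m⊔n≤o⇒m≤o M N j≥))
                    (q i j (ℕ.m⊔n≤o⇒n≤o M N i≥) (ℕ.m⊔n≤o⇒n≤o M N j≥)) ⟩
    ½ ℚ.* ε ℚ.+ ½ ℚ.* ε
      ≡⟨ halves ε ⟩
    ε ∎
    where
    open ℚ.≤-Reasoning
    rearrange : ∀ a b c d →
      (a ℚ.+ b) ℚ.- (c ℚ.+ d) ≡ (a ℚ.- c) ℚ.+ (b ℚ.- d)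
    rearrange = solve 4 (λ a b c d →
      (a :+ b) :- (c :+ d) := (a :- c) :+ (b :- d)) refl
      where open +-*-Solver

  neg-cauchy : ∀ s → IsCauchy s → IsCauchy (λ n → ℚ.- s n)
  neg-cauchy s cs ε 0<ε with cs ε 0<ε
  ... | N , p = N , λ i j i≥ j≥ → subst (ℚ._< ε)
    (trans (sym (ℚ.∣-p∣≡∣p∣ (s i ℚ.- s j)))
           (cong ℚ.∣_∣ (ℚ.neg-distrib-+ (s i) (ℚ.- s j))))
    (p i j i≥ j≥)

  ∣∣-lipschitz : ∀ a b → ℚ.∣ ℚ.∣ a ∣ ℚ.- ℚ.∣ b ∣ ∣ ℚ.≤ ℚ.∣ a ℚ.- b ∣
  ∣∣-lipschitz a b = ∣-∣≤ (half a b) (begin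
    ℚ.- (ℚ.∣ a ∣ ℚ.- ℚ.∣ b ∣)  ≡⟨ flip ℚ.∣ a ∣ ℚ.∣ b ∣ ⟩
    ℚ.∣ b ∣ ℚ.- ℚ.∣ a ∣        ≤⟨ half b a ⟩
    ℚ.∣ b ℚ.- a ∣              ≡⟨ cong ℚ.∣_∣ (flip a b) ⟨
    ℚ.∣ ℚ.- (a ℚ.- b) ∣        ≡⟨ ℚ.∣-p∣≡∣p∣ (a ℚ.- b) ⟩
    ℚ.∣ a ℚ.- b ∣              ∎)
    where
    open ℚ.≤-Reasoning
    open +-*-Solver
    flip : ∀ p q → ℚ.- (p ℚ.- q) ≡ q ℚ.- p
    flip = solve 2 (λ p q → :- (p :- q) := q :- p) refl
    cancel : ∀ p q → (p ℚ.- q) ℚ.+ q ≡ p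
    cancel = solve 2 (λ p q → (p :- q) :+ q := p) refl
    cancel′ : ∀ p q → (p ℚ.+ q) ℚ.- q ≡ p
    cancel′ = solve 2 (λ p q → (p :+ q) :- q := p) refl
    half : ∀ p q → ℚ.∣ p ∣ ℚ.- ℚ.∣ q ∣ ℚ.≤ ℚ.∣ p ℚ.- q ∣
    half p q = begin
      ℚ.∣ p ∣ ℚ.- ℚ.∣ q ∣
        ≡⟨ cong (λ z → ℚ.∣ z ∣ ℚ.- ℚ.∣ q ∣) (cancel p q) ⟨
      ℚ.∣ (p ℚ.- q) ℚ.+ q ∣ ℚ.- ℚ.∣ q ∣
        ≤⟨ ℚ.+-monoˡ-≤ (ℚ.- ℚ.∣ q ∣) (ℚ.∣p+q∣≤∣p∣+∣q∣ (p ℚ.- q) q) ⟩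
      (ℚ.∣ p ℚ.- q ∣ ℚ.+ ℚ.∣ q ∣) ℚ.- ℚ.∣ q ∣
        ≡⟨ cancel′ ℚ.∣ p ℚ.- q ∣ ℚ.∣ q ∣ ⟩
      ℚ.∣ p ℚ.- q ∣ ∎

  ∣∣-cauchy : ∀ s → IsCauchy s → IsCauchy (λ n → ℚ.∣ s n ∣)
  ∣∣-cauchy s cs ε 0<ε with cs ε 0<ε
  ... | N , p = N , λ i j i≥ j≥ →
    ℚ.≤-<-trans (∣∣-lipschitz (s i) (s j)) (p i j i≥ j≥)

  bounded : ∀ s → IsCauchy s →
    ∃[ B ] (0ℚ ℚ.< B × ∃[ N ] (∀ i → N ℕ.≤ i → ℚ.∣ s i ∣ ℚ.≤ B))
  bounded s cs with cs 1ℚ (ℚ.positive⁻¹ 1ℚ)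
  ... | N , p = 1ℚ ℚ.+ ℚ.∣ s N ∣
    , ℚ.<-≤-trans (ℚ.positive⁻¹ 1ℚ)
        (subst (ℚ._≤ 1ℚ ℚ.+ ℚ.∣ s N ∣) (ℚ.+-identityʳ 1ℚ)
          (ℚ.+-monoʳ-≤ 1ℚ (ℚ.0≤∣p∣ (s N))))
    , N , λ i i≥ → begin
      ℚ.∣ s i ∣
        ≡⟨ cong ℚ.∣_∣ (cancel (s i) (s N)) ⟨
      ℚ.∣ (s i ℚ.- s N) ℚ.+ s N ∣
        ≤⟨ ℚ.∣p+q∣≤∣p∣+∣q∣ (s i ℚ.- s N) (s N) ⟩
      ℚ.∣ s i ℚ.- s N ∣ ℚ.+ ℚ.∣ s N ∣
        ≤⟨ ℚ.+-monoˡ-≤ ℚ.∣ s N ∣ (ℚ.<⇒≤ (p i N i≥ ℕ.≤-refl)) ⟩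
      1ℚ ℚ.+ ℚ.∣ s N ∣ ∎
    where
    open ℚ.≤-Reasoning
    cancel : ∀ p q → (p ℚ.- q) ℚ.+ q ≡ p
    cancel = solve 2 (λ p q → (p :- q) :+ q := p) refl
      where open +-*-Solver

  *-cauchy : ∀ s t → IsCauchy s → IsCauchy t → IsCauchy (λ n → s n ℚ.* t n)
  *-cauchy s t cs ct ε 0<ε = N , bound
    where
    A = proj₁ (bounded s cs)
    B = proj₁ (bounded t ct)
    0<A = proj₁ (proj₂ (bounded s cs))
    0<B = proj₁ (proj₂ (bounded t ct))
    N₁ = proj₁ (proj₂ (proj₂ (bounded s cs)))
    N₂ = proj₁ (proj₂ (proj₂ (bounded t ct)))
    ∣s∣≤A = proj₂ (proj₂ (proj₂ (bounded s cs)))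
    ∣t∣≤B = proj₂ (proj₂ (proj₂ (bounded t ct)))

    instance
      A-pos = ℚ.positive 0<A
      B-pos = ℚ.positive 0<B
      ε-pos = ℚ.positive 0<ε
      C-pos = ℚ.pos+pos⇒pos A B
      C≢0   = ℚ.pos⇒nonZero (A ℚ.+ B)
      1/C-pos = ℚ.1/pos⇒pos (A ℚ.+ B)

    δ = (ℚ.1/ (A ℚ.+ B)) ℚ.* ε

    0<δ : 0ℚ ℚ.< δ
    0<δ = ℚ.positive⁻¹ δ {{ℚ.pos*pos⇒pos (ℚ.1/ (A ℚ.+ B)) ε}}

    total : A ℚ.* δ ℚ.+ B ℚ.* δ ≡ ε
    total = begin
      A ℚ.* δ ℚ.+ B ℚ.* δ                         ≡⟨ ℚ.*-distribʳ-+ δ A B ⟨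
      (A ℚ.+ B) ℚ.* δ                             ≡⟨ ℚ.*-assoc (A ℚ.+ B) _ ε ⟨
      ((A ℚ.+ B) ℚ.* (ℚ.1/ (A ℚ.+ B))) ℚ.* ε      ≡⟨ cong (ℚ._* ε) (ℚ.*-inverseʳ (A ℚ.+ B)) ⟩
      1ℚ ℚ.* ε                                    ≡⟨ ℚ.*-identityˡ ε ⟩
      ε                                           ∎
      where open ≡.≡-Reasoning

    M₁ = proj₁ (cs δ 0<δ)
    M₂ = proj₁ (ct δ 0<δ)
    N = (N₁ ℕ.⊔ N₂) ℕ.⊔ (M₁ ℕ.⊔ M₂)

    module _ {i} (N≤i : N ℕ.≤ i) where
      private
        l = ℕ.m⊔n≤o⇒m≤o (N₁ ℕ.⊔ N₂) (M₁ ℕ.⊔ M₂) N≤i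
        r = ℕ.m⊔n≤o⇒n≤o (N₁ ℕ.⊔ N₂) (M₁ ℕ.⊔ M₂) N≤i
      ≥N₁ = ℕ.m⊔n≤o⇒m≤o N₁ N₂ l
      ≥N₂ = ℕ.m⊔n≤o⇒n≤o N₁ N₂ l
      ≥M₁ = ℕ.m⊔n≤o⇒m≤o M₁ M₂ r
      ≥M₂ = ℕ.m⊔n≤o⇒n≤o M₁ M₂ r

    ∣∣*∣∣≤ : ∀ p q {P} → 0ℚ ℚ.< P → ℚ.∣ p ∣ ℚ.≤ P → ℚ.∣ q ∣ ℚ.< δ →
      ℚ.∣ p ℚ.* q ∣ ℚ.< P ℚ.* δ
    ∣∣*∣∣≤ p q {P} 0<P ∣p∣≤P ∣q∣<δ = begin-strict
      ℚ.∣ p ℚ.* q ∣         ≡⟨ ℚ.∣p*q∣≡∣p∣*∣q∣ p q ⟩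
      ℚ.∣ p ∣ ℚ.* ℚ.∣ q ∣   ≤⟨ ℚ.*-monoʳ-≤-nonNeg ℚ.∣ q ∣ {{ℚ.∣-∣-nonNeg q}} ∣p∣≤P ⟩
      P ℚ.* ℚ.∣ q ∣         <⟨ ℚ.*-monoʳ-<-pos P {{ℚ.positive 0<P}} ∣q∣<δ ⟩
      P ℚ.* δ               ∎
      where open ℚ.≤-Reasoning

    split : ∀ a b c d → a ℚ.* b ℚ.- c ℚ.* d ≡ a ℚ.* (b ℚ.- d) ℚ.+ d ℚ.* (a ℚ.- c)
    split = solve 4 (λ a b c d →
      a :* b :- c :* d := a :* (b :- d) :+ d :* (a :- c)) refl
      where open +-*-Solver

    bound : ∀ i j → N ℕ.≤ i → N ℕ.≤ j → ℚ.∣ s i ℚ.* t i ℚ.- s j ℚ.* t j ∣ ℚ.< ε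
    bound i j i≥ j≥ = begin-strict
      ℚ.∣ s i ℚ.* t i ℚ.- s j ℚ.* t j ∣
        ≡⟨ cong ℚ.∣_∣ (split (s i) (t i) (s j) (t j)) ⟩
      ℚ.∣ s i ℚ.* (t i ℚ.- t j) ℚ.+ t j ℚ.* (s i ℚ.- s j) ∣
        ≤⟨ ℚ.∣p+q∣≤∣p∣+∣q∣ (s i ℚ.* (t i ℚ.- t j)) (t j ℚ.* (s i ℚ.- s j)) ⟩
      ℚ.∣ s i ℚ.* (t i ℚ.- t j) ∣ ℚ.+ ℚ.∣ t j ℚ.* (s i ℚ.- s j) ∣
        <⟨ ℚ.+-mono-<
             (∣∣*∣∣≤ (s i) (t i ℚ.- t j) 0<A (∣s∣≤A i (≥N₁ i≥))
               (proj₂ (ct δ 0<δ) i j (≥M₂ i≥) (≥M₂ j≥)))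
             (∣∣*∣∣≤ (t j) (s i ℚ.- s j) 0<B (∣t∣≤B j (≥N₂ j≥))
               (proj₂ (cs δ 0<δ) i j (≥M₁ i≥) (≥M₁ j≥))) ⟩
      A ℚ.* δ ℚ.+ B ℚ.* δ
        ≡⟨ total ⟩
      ε ∎
      where open ℚ.≤-Reasoning

infix  4 _<_ _#_
infixl 6 _+_ _-_
infixl 7 _*_
infix  8 -_
infixr 8 _^_

fromℚ : ℚ → ℝ
fromℚ q = mkℝ (λ _ → q) (const-cauchy q)

fromℕ : ℕ → ℝ
fromℕ n = fromℚ (+ n / 1)

_+_ : ℝ → ℝ → ℝ
x + y = mkℝ (λ n → seq x n ℚ.+ seq y n) (+-cauchy (seq x) (seq y) (cauchy x) (cauchy y))

-_ : ℝ → ℝ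
- x = mkℝ (λ n → ℚ.- seq x n) (neg-cauchy (seq x) (cauchy x))

_-_ : ℝ → ℝ → ℝ
x - y = x + - y

_*_ : ℝ → ℝ → ℝ
x * y = mkℝ (λ n → seq x n ℚ.* seq y n) (*-cauchy (seq x) (seq y) (cauchy x) (cauchy y))

_^_ : ℝ → ℕ → ℝ
x ^ zero  = fromℚ 1ℚ
x ^ suc n = x * x ^ n

∣_∣ : ℝ → ℝ
∣ x ∣ = mkℝ (λ n → ℚ.∣ seq x n ∣) (∣∣-cauchy (seq x) (cauchy x))

_<_ : ℝ → ℝ → Set
x < y = ∃[ ε ] (0ℚ ℚ.< ε × ∃[ N ] (∀ n → N ℕ.≤ n → seq x n ℚ.+ ε ℚ.≤ seq y n))

-- Apartness, the positive form of "distinct" for real numbers; classically it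
-- is the negation of equality.
_#_ : ℝ → ℝ → Set
x # y = x < y ⊎ y < x

------------------------------------------------------------------------
-- Euler's number

1/_! : ℕ → ℚ
1/ n ! = (+ 1 / (n !)) {{n ℕ.!≢0}}

-- expSum n is the sum of 1/k! over 0 ≤ k ≤ n.
expSum : ℕ → ℚ
expSum zero    = 1/ 0 !
expSum (suc n) = expSum n ℚ.+ 1/ suc n !

private

  toℚᵘ-/ : ∀ i d .{{_ : ℕ.NonZero d}} → ℚ.toℚᵘ (i / d) ℚᵘ.≃ (i ℚᵘ./ d)
  toℚᵘ-/ i (suc d) = ℚ.toℚᵘ-fromℚᵘ (mkℚᵘ i d)

  /-≤ : ∀ a b c d .{{_ : ℕ.NonZero b}} .{{_ : ℕ.NonZero d}} →
    a ℕ.* d ℕ.≤ c ℕ.* b → (+ a / b) ℚ.≤ (+ c / d)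
  /-≤ a (suc b) c (suc d) le = ℚ.toℚᵘ-cancel-≤
    (ℚᵘ.≤-respˡ-≃ (ℚᵘ.≃-sym (toℚᵘ-/ (+ a) (suc b)))
    (ℚᵘ.≤-respʳ-≃ (ℚᵘ.≃-sym (toℚᵘ-/ (+ c) (suc d)))
      (*≤* (subst₂ ℤ._≤_ (ℤ.pos-* a (suc d)) (ℤ.pos-* c (suc b)) (ℤ.+≤+ le)))))

  double : ∀ d .{{_ : ℕ.NonZero d}} → (+ 1 / d) ℚ.+ (+ 1 / d) ≡ + 2 / d
  double (suc d) = ℚ.toℚᵘ-injective
    (ℚᵘ.≃-trans (ℚ.toℚᵘ-homo-+ (+ 1 / suc d) (+ 1 / suc d))
    (ℚᵘ.≃-trans (ℚᵘ.+-cong (toℚᵘ-/ (+ 1) (suc d)) (toℚᵘ-/ (+ 1) (suc d)))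
    (ℚᵘ.≃-trans (*≡* (cong +_ (lemma (suc d))))
                (ℚᵘ.≃-sym (toℚᵘ-/ (+ 2) (suc d))))))
    where
    lemma : ∀ k → (1 ℕ.* k ℕ.+ 1 ℕ.* k) ℕ.* k ≡ 2 ℕ.* (k ℕ.* k)
    lemma = ℕ-Ring.solve-∀

  tail : ℕ → ℚ
  tail n = (+ 2 / (suc n !)) {{suc n ℕ.!≢0}}

  1/!≥0 : ∀ n → 0ℚ ℚ.≤ 1/ n !
  1/!≥0 n = /-≤ 0 1 1 (n !) {{_}} {{n ℕ.!≢0}} ℕ.z≤n

  tail-step : ∀ n → tail (suc n) ℚ.≤ 1/ suc n !
  tail-step n = /-≤ 2 (suc (suc n) !) 1 (suc n !)
    {{suc (suc n) ℕ.!≢0}} {{suc n ℕ.!≢0}}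
    (ℕ.≤-trans (ℕ.*-monoˡ-≤ (suc n !) (ℕ.s≤s (ℕ.s≤s (ℕ.z≤n {n}))))
               (ℕ.≤-reflexive (sym (ℕ.*-identityˡ (suc (suc n) !)))))

  expSum+tail : ∀ n → expSum (suc n) ℚ.+ tail (suc n) ℚ.≤ expSum n ℚ.+ tail n
  expSum+tail n = begin
    (expSum n ℚ.+ 1/ suc n !) ℚ.+ tail (suc n)
      ≡⟨ ℚ.+-assoc (expSum n) (1/ suc n !) (tail (suc n)) ⟩
    expSum n ℚ.+ (1/ suc n ! ℚ.+ tail (suc n))
      ≤⟨ ℚ.+-monoʳ-≤ (expSum n) (ℚ.+-monoʳ-≤ (1/ suc n !) (tail-step n)) ⟩
    expSum n ℚ.+ (1/ suc n ! ℚ.+ 1/ suc n !)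
      ≡⟨ cong (expSum n ℚ.+_) (double (suc n !) {{suc n ℕ.!≢0}}) ⟩
    expSum n ℚ.+ tail n ∎
    where open ℚ.≤-Reasoning

  p≤p+q : ∀ p {q} → 0ℚ ℚ.≤ q → p ℚ.≤ p ℚ.+ q
  p≤p+q p {q} 0≤q =
    subst (ℚ._≤ p ℚ.+ q) (ℚ.+-identityʳ p) (ℚ.+-monoʳ-≤ p 0≤q)

  expSum-mono : ∀ {m n} → m ℕ.≤′ n → expSum m ℚ.≤ expSum n
  expSum-mono ℕ.≤′-refl = ℚ.≤-refl
  expSum-mono {n = suc n} (ℕ.≤′-step m≤n) =
    ℚ.≤-trans (expSum-mono m≤n) (p≤p+q (expSum n) (1/!≥0 (suc n)))

  expSum+tail-anti : ∀ {m n} → m ℕ.≤′ n →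
    expSum n ℚ.+ tail n ℚ.≤ expSum m ℚ.+ tail m
  expSum+tail-anti ℕ.≤′-refl = ℚ.≤-refl
  expSum+tail-anti {n = suc n} (ℕ.≤′-step m≤n) =
    ℚ.≤-trans (expSum+tail n) (expSum+tail-anti m≤n)

  expSum-upper : ∀ {m n} → m ℕ.≤ n → expSum n ℚ.≤ expSum m ℚ.+ tail m
  expSum-upper {n = n} m≤n = ℚ.≤-trans
    (p≤p+q (expSum n)
      (/-≤ 0 1 2 (suc n !) {{_}} {{suc n ℕ.!≢0}} ℕ.z≤n))
    (expSum+tail-anti (ℕ.≤⇒≤′ m≤n))

  tail-small : ∀ ε → 0ℚ ℚ.< ε → ∃[ N ] tail N ℚ.< ε
  tail-small ε@(mkℚ (+ suc a) d _) 0<ε = N , (begin-strict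
    tail N
      ≤⟨ /-≤ 2 (suc N !) 1 (suc (suc d)) {{suc N ℕ.!≢0}}
           (ℕ.≤-trans (ℕ.n≤1+n N) (ℕ.≤-trans N<N!
             (ℕ.≤-reflexive (sym (ℕ.*-identityˡ (suc N !)))))) ⟩
    + 1 / suc (suc d)
      <⟨ ℚ.toℚᵘ-cancel-<
           (ℚᵘ.<-respˡ-≃ (ℚᵘ.≃-sym (toℚᵘ-/ (+ 1) (suc (suc d))))
             (*<* (ℤ.+<+ (ℕ.≤-trans
               (ℕ.s≤s (ℕ.≤-reflexive (ℕ.*-identityˡ (suc d))))
               (ℕ.m≤n*m (suc (suc d)) (suc a)))))) ⟩
    ε ∎)
    where
    open ℚ.≤-Reasoning
    N = 2 ℕ.* suc (suc d)
    N<N! : suc N ℕ.≤ suc N !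
    N<N! = ℕ.m≤m*n (suc N) (N !) {{N ℕ.!≢0}}
  tail-small (mkℚ (+ 0) d _) (ℚ.*<* (ℤ.+<+ ()))
  tail-small (mkℚ (ℤ.-[1+ a ]) d _) (ℚ.*<* ())

  expSum-cauchy : IsCauchy expSum
  expSum-cauchy ε 0<ε with tail-small ε 0<ε
  ... | N , tail<ε = N , λ i j i≥ j≥ →
    ℚ.≤-<-trans (∣-∣≤ (close i j i≥ j≥)
      (subst (ℚ._≤ tail N) (sym (flip (expSum i) (expSum j))) (close j i j≥ i≥)))
      tail<ε
    where
    open +-*-Solver
    flip : ∀ p q → ℚ.- (p ℚ.- q) ≡ q ℚ.- p
    flip = solve 2 (λ p q → :- (p :- q) := q :- p) refl
    cancel : ∀ p q → (p ℚ.+ q) ℚ.- p ≡ q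
    cancel = solve 2 (λ p q → (p :+ q) :- p := q) refl
    close : ∀ i j → N ℕ.≤ i → N ℕ.≤ j → expSum i ℚ.- expSum j ℚ.≤ tail N
    close i j i≥ j≥ = subst (expSum i ℚ.- expSum j ℚ.≤_)
      (cancel (expSum N) (tail N))
      (ℚ.+-mono-≤ (expSum-upper i≥)
        (ℚ.neg-antimono-≤ (expSum-mono (ℕ.≤⇒≤′ j≥))))

e : ℝ
e = mkℝ expSum expSum-cauchy

------------------------------------------------------------------------
-- Ranking patterns

Increasing : ∀ {m} → Vector ℝ m → Set
Increasing x = ∀ i j → i Fin.< j → x i < x j

midpoint : ∀ {m} → Vector ℝ m → Fin m → Fin m → ℝ
midpoint x i j = fromℚ ½ * (x i + x j)

Generic : ∀ {m} → Vector ℝ m → Set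
Generic x = ∀ i j k l → i Fin.< j → k Fin.< l → (i , j) ≢ (k , l) →
  midpoint x i j # midpoint x k l

-- The ranking (i₁ ⋯ iₘ) is the permutation σ with σ ⟨$⟩ʳ k equal to the k-th
-- entry of the ranking.
RP : ∀ {m} → Vector ℝ m → Pred (Permutation′ m) 0ℓ
RP x σ = ∃[ y ] Increasing (λ k → ∣ y - x (σ ⟨$⟩ʳ k) ∣)

record OrderedGeneric (m : ℕ) : Set where
  field
    point      : Vector ℝ m
    generic    : Generic point
    increasing : Increasing point

open OrderedGeneric public

-- Ranking patterns are represented by points realising them, identified when
-- the patterns are equal as sets of permutations.
RankingPatterns : ℕ → Setoid 0ℓ 0ℓ
RankingPatterns m =
  On.setoid {B = OrderedGeneric m} (≐-setoid (Permutation′ m) 0ℓ) (λ p → RP (point p))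

IsNumberOfRankingPatterns : ℕ → ℕ → Set
IsNumberOfRankingPatterns m r = Bijection (≡.setoid (Fin r)) (RankingPatterns m)

{-# OPTIONS --safe #-}

-- Translating a point and sweeping the ideal point from left to right shows that
-- a ranking pattern is the same thing as the order of the midpoints, so by
-- density it suffices to count chambers of the arrangement of the hyperplanes
-- x i = x j and x i + x j = x k + x l in rational space.
--
-- Upper bound.  By deletion and restriction, n central hyperplanes in dimension
-- d = m - 1 have at most 2 (C (n - 1) 0 + ... + C (n - 1) (d - 1)) chambers, which
-- is at most 2 (1 + t)^(n - 1) / t^(d - 1) for 0 < t ≤ 1; the choice
-- t = (d - 1) / (n - 1) gives powers of e.  The symmetric group permutes the
-- chambers freely, and every orbit meets the cone x 1 < ... < x m once.
--
-- Lower bound.  Move a new coordinate to the left from x 1.  The order changes at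
-- every value x i + x j - x k < x 1 with i < j < k, and these values are distinct
-- after a perturbation of x.  All triples with i = 1 occur.  For a pair i < j of
-- inner indices, (i , j , m) occurs either for x or for its mirror image.  Hence
-- 2 r(m + 1) ≥ r(m) (2 + 2 C (m - 1) 2 + C (m - 2) 2).
module Submission where

open import Data.Nat.Base as ℕ using (ℕ; zero; suc; _∸_; _!)
open import Data.Nat.Properties using (_!≢0)
import Data.Nat.Properties as ℕ
import Data.Nat.Tactic.RingSolver as ℕ-Ring
open import Data.Rational.Base as ℚ using (ℚ; 0ℚ; 1ℚ; ½; _/_)
open import Data.Rational.Properties using (+-*-rawSemiring)
import Data.Rational.Properties as ℚ
open import Data.Rational.Solver using (module +-*-Solver)
open import Data.Product using (∃-syntax; _×_; _,_; proj₁; proj₂; uncurry)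
open import Data.Product.Properties using (≡-dec; ,-injectiveˡ; ,-injectiveʳ)
open import Data.Sum.Base using (_⊎_; inj₁; inj₂; [_,_]′)
open import Data.Fin.Base as Fin
  using (Fin; zero; suc; punchIn; remQuot; combine; opposite; inject₁)
import Data.Fin.Properties as Fin
open import Data.Fin.Permutation
  using (Permutation′; _⟨$⟩ʳ_; _⟨$⟩ˡ_; inverseˡ; inverseʳ; insert; insert-punchIn) renaming (id to idₚ)
open import Data.List.Base as List
  using (List; []; _∷_; length; lookup; _++_; allFin; cartesianProduct; cartesianProductWith)
import Data.List.Properties as List
open import Data.List.Relation.Unary.All as All using (All; []; _∷_; all?)
import Data.List.Relation.Unary.All.Properties as All
open import Data.List.Relation.Unary.Any as Any using (Any; here; there; index; any?)
import Data.List.Relation.Unary.Any.Properties as Any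
open import Data.List.Relation.Unary.AllPairs as AllPairs using (AllPairs; []; _∷_)
import Data.List.Relation.Unary.AllPairs.Properties as AllPairs
open import Data.List.Relation.Unary.Unique.Propositional using (Unique)
import Data.List.Relation.Unary.Unique.Propositional.Properties as Unique
open import Data.List.Membership.Propositional using (_∈_; lose; find)
open import Data.List.Membership.Propositional.Properties
  using ( ∈-map⁺; ∈-map⁻; ∈-++⁺ˡ; ∈-++⁺ʳ; ∈-allFin; ∈-filter⁺; ∈-filter⁻; ∈-concat⁺′; ∈-lookup
        ; ∈-cartesianProduct⁺; ∈-cartesianProductWith⁺)
open import Data.Vec.Functional as Vector using (Vector)
open import Function.Base using (_∘_; id)
open import Relation.Binary.Definitions using (Symmetric; Transitive; tri<; tri≈; tri>)
open import Relation.Binary.PropositionalEquality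
open import Relation.Nullary using (¬_; ¬?; Dec; yes; no; contradiction)
open import Relation.Nullary.Decidable using (_×-dec_; _⊎-dec_; _→-dec_)
open import Relation.Unary using (Decidable; _≐_)
open import Relation.Unary.Properties using (≐-refl; ≐-sym; ≐-trans)
open +-*-Solver using (solve; con; :-_; _:+_; _:-_; _:*_; _:=_)

-- Enumerating chambers needs case distinctions on signs, but the order of Cauchy reals is not
-- decidable; the counting is therefore done over the rationals. A generic real configuration
-- involves finitely many strict comparisons, and all of them hold for the n-th terms once n is
-- large. The ideal point of a ranking can likewise be chosen rational. Comparing midpoints that
-- share an index only repeats x i = x j, so there are n = C m 2 + 3 C m 4 hyperplanes. From m = 4
-- on, 8 n ≤ (m - 2) m (m - 1)^2, which yields the base of the power. The upper bound is strict
-- because a finite partial sum of e already suffices. In the lower bound, whether x i + x j - x k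
-- lies left of x 1 depends on the chamber in general. Reflection is decisive for (i , j , m): it
-- turns x i + x j < x 1 + x m into the reverse inequality for the reflected pair. Bounding 2 + 2 C
-- (m - 1) 2 + C (m - 2) 2 from below by (3/2) (m - 2)^2 gives the factor 3/4, and r(4) ≥ 2 follows
-- from the same recurrence started at two points.

-- Signs of rational numbers

module Signs where

  open import Data.Rational.Base
  open import Data.Rational.Properties

  private variable
    a b c s t : ℚ

  -- An inequality is reduced to naming the difference c: the ring solver checks the identity, and
  -- only the sign of c needs an argument.
  <-by : 0ℚ < c → b ≡ a + c → a < b
  <-by {c} {b} {a} 0<c refl = subst (_< a + c) (+-identityʳ a) (+-monoʳ-< a 0<c)

  ≤-by : 0ℚ ≤ c → b ≡ a + c → a ≤ b
  ≤-by {c} {b} {a} 0≤c refl = subst (_≤ a + c) (+-identityʳ a) (+-monoʳ-≤ a 0≤c)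

  p<q⇒0<q-p : a < b → 0ℚ < b - a
  p<q⇒0<q-p {a} {b} a<b = subst (_< b - a) (+-inverseʳ a) (+-monoˡ-< (- a) a<b)

  p≤q⇒0≤q-p : a ≤ b → 0ℚ ≤ b - a
  p≤q⇒0≤q-p {a} {b} a≤b = subst (_≤ b - a) (+-inverseʳ a) (+-monoˡ-≤ (- a) a≤b)

  0<p-q⇒q<p : 0ℚ < b - a → a < b
  0<p-q⇒q<p {b} {a} 0<b-a =
    <-by 0<b-a (solve 2 (λ a b → b := a :+ (b :- a)) refl a b)

  p-q<0⇒p<q : a - b < 0ℚ → a < b
  p-q<0⇒p<q {a} {b} a-b<0 =
    0<p-q⇒q<p (subst (0ℚ <_) (solve 2 (λ a b → :- (a :- b) := b :- a) refl a b)
      (neg-antimono-< a-b<0))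

  p<q⇒p-q<0 : a < b → a - b < 0ℚ
  p<q⇒p-q<0 {a} {b} a<b = subst (a - b <_) (+-inverseʳ b) (+-monoˡ-< (- b) a<b)

  0<p+q : 0ℚ < a → 0ℚ < b → 0ℚ < a + b
  0<p+q = +-mono-<

  0<p*q : 0ℚ < a → 0ℚ < b → 0ℚ < a * b
  0<p*q {a} {b} 0<a 0<b =
    positive⁻¹ (a * b) {{pos*pos⇒pos a {{positive 0<a}} b {{positive 0<b}}}}

  0≤p*q : 0ℚ ≤ a → 0ℚ ≤ b → 0ℚ ≤ a * b
  0≤p*q {a} {b} 0≤a 0≤b =
    nonNegative⁻¹ (a * b) {{nonNeg*nonNeg⇒nonNeg a {{nonNegative 0≤a}} b {{nonNegative 0≤b}}}}

  *-mono-≤ : 0ℚ ≤ a → a ≤ b → 0ℚ ≤ s → s ≤ t → a * s ≤ b * t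
  *-mono-≤ {a} {b} {s} {t} 0≤a a≤b 0≤s s≤t = ≤-trans
    (*-monoʳ-≤-nonNeg s {{nonNegative 0≤s}} a≤b)
    (*-monoˡ-≤-nonNeg b {{nonNegative (≤-trans 0≤a a≤b)}} s≤t)

  neg⁺ : a < 0ℚ → 0ℚ < - a
  neg⁺ = neg-antimono-<

  neg⁻ : 0ℚ < - a → a < 0ℚ
  neg⁻ {a} 0<-a = subst (_< 0ℚ) (solve 1 (λ a → :- (:- a) := a) refl a) (neg-antimono-< 0<-a)

  p≤∣p∣ : ∀ p → p ≤ ∣ p ∣
  p≤∣p∣ p with ≤-total 0ℚ p
  ... | inj₁ 0≤p = ≤-reflexive (sym (0≤p⇒∣p∣≡p 0≤p))
  ... | inj₂ p≤0 = ≤-trans p≤0 (0≤∣p∣ p)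

  -p≤∣p∣ : ∀ p → - p ≤ ∣ p ∣
  -p≤∣p∣ p = subst (- p ≤_) (∣-p∣≡∣p∣ p) (p≤∣p∣ (- p))

  -- Zero is related to nothing, not even to itself. This is a partial equivalence relation, and
  -- `SameSign a a` expresses that a is nonzero.
  SameSign : ℚ → ℚ → Set
  SameSign a b = (0ℚ < a × 0ℚ < b) ⊎ (a < 0ℚ × b < 0ℚ)

  sameSign? : ∀ a b → Dec (SameSign a b)
  sameSign? a b = (0ℚ <? a ×-dec 0ℚ <? b) ⊎-dec (a <? 0ℚ ×-dec b <? 0ℚ)

  ss-sym : SameSign a b → SameSign b a
  ss-sym (inj₁ (p , q)) = inj₁ (q , p)
  ss-sym (inj₂ (p , q)) = inj₂ (q , p)

  ss-trans : SameSign a b → SameSign b c → SameSign a c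
  ss-trans (inj₁ (p , _)) (inj₁ (_ , q)) = inj₁ (p , q)
  ss-trans (inj₁ (_ , p)) (inj₂ (q , _)) = contradiction q (<-asym p)
  ss-trans (inj₂ (_ , p)) (inj₁ (q , _)) = contradiction q (<-asym p)
  ss-trans (inj₂ (p , _)) (inj₂ (_ , q)) = inj₂ (p , q)

  ss-reflˡ : SameSign a b → SameSign a a
  ss-reflˡ p = ss-trans p (ss-sym p)

  ss-neg : SameSign a b → SameSign (- a) (- b)
  ss-neg (inj₁ (p , q)) = inj₂ (neg-antimono-< p , neg-antimono-< q)
  ss-neg (inj₂ (p , q)) = inj₁ (neg-antimono-< p , neg-antimono-< q)

  ss⇒≢0 : SameSign a b → a ≢ 0ℚ
  ss⇒≢0 (inj₁ (p , _)) refl = <-irrefl refl p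
  ss⇒≢0 (inj₂ (p , _)) refl = <-irrefl refl p

  ≢0⇒ss : a ≢ 0ℚ → SameSign a a
  ≢0⇒ss {a} a≢0 with <-cmp a 0ℚ
  ... | tri< a<0 _ _ = inj₂ (a<0 , a<0)
  ... | tri≈ _ a≡0 _ = contradiction a≡0 a≢0
  ... | tri> _ _ 0<a = inj₁ (0<a , 0<a)

  ¬ss-neg : ¬ SameSign a (- a)
  ¬ss-neg (inj₁ (p , q)) = <-asym p (neg⁻ q)
  ¬ss-neg {a} (inj₂ (p , q)) = <-asym (neg⁺ p) q

  -- Half-lines are closed under positive combinations; this is the convexity of chambers used in
  -- `crossing`.
  ss-+ : SameSign a b → 0ℚ < s → 0ℚ < t → SameSign a (s * a + t * b)
  ss-+ (inj₁ (0<a , 0<b)) 0<s 0<t = inj₁ (0<a , 0<p+q (0<p*q 0<s 0<a) (0<p*q 0<t 0<b))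
  ss-+ {a} {b} {s} {t} (inj₂ (a<0 , b<0)) 0<s 0<t = inj₂ (a<0 , neg⁻
    (subst (0ℚ <_) (solve 4 (λ a b s t → s :* (:- a) :+ t :* (:- b) := :- (s :* a :+ t :* b)) refl
        a b s t)
      (0<p+q (0<p*q 0<s (neg⁺ a<0)) (0<p*q 0<t (neg⁺ b<0)))))

  private
    ss-scale⁺ : 0ℚ < c → SameSign a b → SameSign (c * a) b
    ss-scale⁺ 0<c (inj₁ (0<a , 0<b)) = inj₁ (0<p*q 0<c 0<a , 0<b)
    ss-scale⁺ {c} {a} 0<c (inj₂ (a<0 , b<0)) = inj₂ (neg⁻ (subst (0ℚ <_)
      (solve 2 (λ c a → c :* (:- a) := :- (c :* a)) refl c a)
      (0<p*q 0<c (neg⁺ a<0))) , b<0)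

    ss-square : c ≢ 0ℚ → 0ℚ < c * c
    ss-square {c} c≢0 with ≢0⇒ss c≢0
    ... | inj₁ (0<c , _) = 0<p*q 0<c 0<c
    ... | inj₂ (c<0 , _) = subst (0ℚ <_) (solve 1 (λ c → (:- c) :* (:- c) := c :* c) refl c)
                             (0<p*q (neg⁺ c<0) (neg⁺ c<0))

  ss-scale : c ≢ 0ℚ → SameSign a b → SameSign (c * a) (c * b)
  ss-scale {c} {a} {b} c≢0 p with ≢0⇒ss c≢0
  ... | inj₁ (0<c , _) = ss-sym (ss-scale⁺ 0<c (ss-sym (ss-scale⁺ 0<c p)))
  ... | inj₂ (c<0 , _) = subst₂ SameSign (eq a) (eq b)
        (ss-sym (ss-scale⁺ (neg⁺ c<0) (ss-sym (ss-scale⁺ (neg⁺ c<0) (ss-neg p)))))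
    where
    eq : ∀ x → - c * - x ≡ c * x
    eq = solve 2 (λ c x → (:- c) :* (:- x) := c :* x) refl c

  -- Scaling by c leaves c * c in front of a, and a nonzero square is positive; so a factor of
  -- unknown sign can change sides.
  ss-transfer : c ≢ 0ℚ → SameSign (c * a) b → SameSign a (c * b)
  ss-transfer {c} {a} {b} c≢0 p =
    ss-trans (ss-sym (ss-scale⁺ (ss-square c≢0) (≢0⇒ss (λ { refl → ss⇒≢0 p (*-zeroʳ c) }))))
      (subst (λ z → SameSign z (c * b)) (sym (*-assoc c c a)) (ss-scale c≢0 p))

  opposite-signs : a ≢ 0ℚ → b ≢ 0ℚ → ¬ SameSign a b →
    (0ℚ < a × b < 0ℚ) ⊎ (a < 0ℚ × 0ℚ < b)
  opposite-signs a≢0 b≢0 ¬ss with ≢0⇒ss a≢0 | ≢0⇒ss b≢0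
  ... | inj₁ (0<a , _) | inj₁ (0<b , _) = contradiction (inj₁ (0<a , 0<b)) ¬ss
  ... | inj₁ (0<a , _) | inj₂ (b<0 , _) = inj₁ (0<a , b<0)
  ... | inj₂ (a<0 , _) | inj₁ (0<b , _) = inj₂ (a<0 , 0<b)
  ... | inj₂ (a<0 , _) | inj₂ (b<0 , _) = contradiction (inj₂ (a<0 , b<0)) ¬ss

  ss-neg-or : a ≢ 0ℚ → b ≢ 0ℚ → ¬ SameSign a b → SameSign a (- b)
  ss-neg-or a≢0 b≢0 ¬ss with opposite-signs a≢0 b≢0 ¬ss
  ... | inj₁ (0<a , b<0) = inj₁ (0<a , neg⁺ b<0)
  ... | inj₂ (a<0 , 0<b) = inj₂ (a<0 , neg-antimono-< 0<b)

  -- K is chosen with K a = ∣ b ∣ + a.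
  private
    dominate⁺ : 0ℚ < a → ∃[ K ] (∀ K′ → K ≤ K′ → 0ℚ < K′ * a + b)
    dominate⁺ {a} {b} 0<a = K , bound
      where
      instance
        a-pos = positive 0<a
        a≢0 = pos⇒nonZero a
      K = (∣ b ∣ + a) * 1/ a
      open ≤-Reasoning
      bound : ∀ K′ → K ≤ K′ → 0ℚ < K′ * a + b
      bound K′ K≤K′ = begin-strict
        0ℚ                  <⟨ 0<a ⟩
        a                   ≡⟨ solve 2 (λ a b → a := (:- b :+ a) :+ b) refl a b ⟩
        (- b + a) + b       ≤⟨ +-monoˡ-≤ b (+-monoˡ-≤ a (-p≤∣p∣ b)) ⟩
        (∣ b ∣ + a) + b     ≡⟨ cong (_+ b) (*-identityʳ (∣ b ∣ + a)) ⟨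
        (∣ b ∣ + a) * 1ℚ + b ≡⟨ cong (λ z → (∣ b ∣ + a) * z + b) (*-inverseˡ a) ⟨
        (∣ b ∣ + a) * (1/ a * a) + b ≡⟨ cong (_+ b) (*-assoc (∣ b ∣ + a) (1/ a) a) ⟨
        K * a + b           ≤⟨ +-monoˡ-≤ b (*-monoʳ-≤-nonNeg a {{pos⇒nonNeg a}} K≤K′) ⟩
        K′ * a + b          ∎

  -- K is produced before the hypothesis that a is nonzero, with an arbitrary value at a = 0. The
  -- points built with `perturb` thereby become total functions of their data.
  dominate : ∀ a b → ∃[ K ] (a ≢ 0ℚ → ∀ K′ → K ≤ K′ → SameSign a (K′ * a + b))
  dominate a b with <-cmp a 0ℚ
  ... | tri≈ _ a≡0 _ = 0ℚ , λ a≢0 → contradiction a≡0 a≢0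
  ... | tri> _ _ 0<a = let K , d = dominate⁺ 0<a in K , λ _ K′ K≤K′ → inj₁ (0<a , d K′ K≤K′)
  ... | tri< a<0 _ _ = let K , d = dominate⁺ {b = - b} (neg⁺ a<0) in
    K , λ _ K′ K≤K′ → inj₂ (a<0 , neg⁻ (subst (0ℚ <_)
      (solve 3 (λ K a b → K :* (:- a) :+ (:- b) := :- (K :* a :+ b)) refl K′ a b) (d K′ K≤K′)))

  ss-cancel : c ≢ 0ℚ → SameSign (c * a) (c * b) → SameSign a b
  ss-cancel c≢0 p = ss-trans (ss-transfer c≢0 p)
    (ss-sym (ss-transfer c≢0 (ss-reflˡ (ss-sym p))))

-- Chambers of central arrangements by deletion and restriction

module Arrangements where

  open import Data.Rational.Base
  open import Data.Rational.Properties
  open import Data.Vec.Functional using (insertAt; removeAt)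
  open import Data.Vec.Functional.Properties using (insertAt-lookup; insertAt-punchIn)
  open import Algebra.Properties.CommutativeMonoid.Sum +-0-commutativeMonoid
    using (sum; sum-remove; sum-cong-≗)
  open Signs

  opaque

    dot : ∀ {d} → Vector ℚ d → Vector ℚ d → ℚ
    dot f z = sum (λ i → f i * z i)

  unit : ∀ {d} → Fin d → Vector ℚ d
  unit zero    zero    = 1ℚ
  unit zero    (suc j) = 0ℚ
  unit (suc i) zero    = 0ℚ
  unit (suc i) (suc j) = unit i j

  opaque
    unfolding dot

    dot-linear : ∀ {d} (f : Vector ℚ d) s z t w →
      dot f (λ i → s * z i + t * w i) ≡ s * dot f z + t * dot f w
    dot-linear {zero}  f s z t w = solve 2 (λ s t → con 0ℚ := s :* con 0ℚ :+ t :* con 0ℚ) refl s t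
    dot-linear {suc d} f s z t w = trans
      (cong (f zero * (s * z zero + t * w zero) +_)
        (dot-linear (f ∘ suc) s (z ∘ suc) t (w ∘ suc)))
      (solve 7 (λ f s z t w A B → f :* (s :* z :+ t :* w) :+ (s :* A :+ t :* B)
          := s :* (f :* z :+ A) :+ t :* (f :* w :+ B)) refl
        (f zero) s (z zero) t (w zero) (dot (f ∘ suc) (z ∘ suc)) (dot (f ∘ suc) (w ∘ suc)))

    dot-linearˡ : ∀ {d} s (f : Vector ℚ d) t g z →
      dot (λ i → s * f i + t * g i) z ≡ s * dot f z + t * dot g z
    dot-linearˡ {zero}  s f t g z = solve 2 (λ s t → con 0ℚ := s :* con 0ℚ :+ t :* con 0ℚ) refl s t
    dot-linearˡ {suc d} s f t g z = trans
      (cong ((s * f zero + t * g zero) * z zero +_)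
        (dot-linearˡ s (f ∘ suc) t (g ∘ suc) (z ∘ suc)))
      (solve 7 (λ f s z t g A B → (s :* f :+ t :* g) :* z :+ (s :* A :+ t :* B)
          := s :* (f :* z :+ A) :+ t :* (g :* z :+ B)) refl
        (f zero) s (z zero) t (g zero) (dot (f ∘ suc) (z ∘ suc)) (dot (g ∘ suc) (z ∘ suc)))

    dot-zeroˡ : ∀ {d} {f : Vector ℚ d} → (∀ i → f i ≡ 0ℚ) → ∀ z → dot f z ≡ 0ℚ
    dot-zeroˡ {zero}  f≡0 z = refl
    dot-zeroˡ {suc d} {f} f≡0 z = trans
      (cong₂ _+_ (cong (_* z zero) (f≡0 zero)) (dot-zeroˡ (f≡0 ∘ suc) (z ∘ suc)))
      (trans (+-identityʳ _) (*-zeroˡ (z zero)))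

    dot-zeroʳ : ∀ {d} (f : Vector ℚ d) → dot f (λ _ → 0ℚ) ≡ 0ℚ
    dot-zeroʳ {zero}  f = refl
    dot-zeroʳ {suc d} f = cong₂ _+_ (*-zeroʳ (f zero)) (dot-zeroʳ (f ∘ suc))

    dot-comm : ∀ {d} (f z : Vector ℚ d) → dot f z ≡ dot z f
    dot-comm f z = sum-cong-≗ (λ i → *-comm (f i) (z i))

    dot-unitʳ : ∀ {d} (f : Vector ℚ d) i → dot f (unit i) ≡ f i
    dot-unitʳ f zero = trans (cong₂ _+_ (*-identityʳ (f zero)) (dot-zeroʳ (f ∘ suc))) (+-identityʳ _)
    dot-unitʳ f (suc i) = trans (cong₂ _+_ (*-zeroʳ (f zero)) (dot-unitʳ (f ∘ suc) i)) (+-identityˡ _)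

    dot-split : ∀ {d} (l z : Vector ℚ (suc d)) i →
      dot l z ≡ l i * z i + dot (removeAt l i) (removeAt z i)
    dot-split l z i = sum-remove {i = i} (λ j → l j * z j)

    dot-cong : ∀ {d} (l : Vector ℚ d) {z w} → (∀ i → z i ≡ w i) → dot l z ≡ dot l w
    dot-cong l z≗w = sum-cong-≗ (λ j → cong (l j *_) (z≗w j))

    dot-∷ : ∀ {d} (l z : Vector ℚ (suc d)) → dot l z ≡ l zero * z zero + dot (l ∘ suc) (z ∘ suc)
    dot-∷ l z = refl

  dot-unitˡ : ∀ {d} (z : Vector ℚ d) i → dot (unit i) z ≡ z i
  dot-unitˡ z i = trans (dot-comm (unit i) z) (dot-unitʳ z i)

  zero-form? : ∀ {d} (f : Vector ℚ d) → (∀ i → f i ≡ 0ℚ) ⊎ ∃[ i ] f i ≢ 0ℚ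
  zero-form? f with Fin.all? (λ i → f i ≟ 0ℚ)
  ... | yes f≡0 = inj₁ f≡0
  ... | no  f≢0 = inj₂ (Fin.¬∀⟶∃¬ _ _ (λ i → f i ≟ 0ℚ) f≢0)

  Generic : ∀ {d} → List (Vector ℚ d) → Vector ℚ d → Set
  Generic L z = All (λ f → dot f z ≢ 0ℚ) L

  infix 4 _⊢_≈_
  -- The forms in L define hyperplanes through the origin, and related points lie in the same open
  -- chamber of the complement.
  _⊢_≈_ : ∀ {d} → List (Vector ℚ d) → Vector ℚ d → Vector ℚ d → Set
  L ⊢ z ≈ w = All (λ f → SameSign (dot f z) (dot f w)) L

  ≈-sym : ∀ {d} {L : List (Vector ℚ d)} {z w} → L ⊢ z ≈ w → L ⊢ w ≈ z
  ≈-sym = All.map ss-sym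

  ≈-trans : ∀ {d} {L : List (Vector ℚ d)} {z w v} → L ⊢ z ≈ w → L ⊢ w ≈ v → L ⊢ z ≈ v
  ≈-trans p q = All.zipWith (λ (a , b) → ss-trans a b) (p , q)

  ≈-generic : ∀ {d} {L : List (Vector ℚ d)} {z w} → L ⊢ z ≈ w → Generic L z
  ≈-generic = All.map ss⇒≢0

  ≈-refl : ∀ {d} {L : List (Vector ℚ d)} {z} → Generic L z → L ⊢ z ≈ z
  ≈-refl = All.map ≢0⇒ss

  ≈? : ∀ {d} (L : List (Vector ℚ d)) z w → Dec (L ⊢ z ≈ w)
  ≈? L z w = all? (λ f → sameSign? (dot f z) (dot f w)) L

  -- Chambers are cones, so instead of adding a small multiple of v to z, z is multiplied by a large
  -- K. The maximum of the bounds for the single forms serves all of L.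
  perturb : ∀ {d} (L : List (Vector ℚ d)) z (v : Vector ℚ d) →
    ∃[ K ] (Generic L z → ∀ K′ → K ≤ K′ → L ⊢ z ≈ (λ i → K′ * z i + 1ℚ * v i))
  perturb []      z v = 0ℚ , λ _ _ _ → []
  perturb (f ∷ L) z v with dominate (dot f z) (dot f v) | perturb L z v
  ... | K₁ , p₁ | K₂ , p₂ = K₁ ⊔ K₂ , λ { (f≢0 ∷ gen) K′ K≤K′ →
    subst (SameSign (dot f z))
      (sym (trans (dot-linear f K′ z 1ℚ v) (cong (K′ * dot f z +_) (*-identityˡ _))))
      (p₁ f≢0 K′ (≤-trans (p≤p⊔q K₁ K₂) K≤K′))
    ∷ p₂ gen K′ (≤-trans (p≤q⊔p K₁ K₂) K≤K′) }

  -- Up to a positive factor, the segment from z to p meets the hyperplane of f at the combination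
  -- with weights - f(p) and f(z). Both are positive here, so w stays in the common chamber by
  -- convexity.
  crossing : ∀ {d} (f : Vector ℚ d) (L : List (Vector ℚ d)) {z p} →
    0ℚ < dot f z → dot f p < 0ℚ → L ⊢ z ≈ p →
    ∃[ w ] (dot f w ≡ 0ℚ × L ⊢ z ≈ w)
  crossing f L {z} {p} 0<fz fp<0 z≈p =
    w , trans (dot-linear f (- dot f p) z (dot f z) p)
          (solve 2 (λ a b → (:- b) :* a :+ a :* b := con 0ℚ) refl (dot f z) (dot f p))
      , All.map (λ {l} l≈ → subst (SameSign (dot l z)) (sym (dot-linear l (- dot f p) z (dot f z) p))
          (ss-+ l≈ (neg⁺ fp<0) 0<fz)) z≈p
    where w = λ i → - dot f p * z i + dot f z * p i

  -- The list is a transversal of the chambers. Their exact number depends on the position of the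
  -- hyperplanes, so the recursion carries an upper bound b.
  record Chambers {d} (L : List (Vector ℚ d)) (b : ℕ) : Set where
    field
      reps     : List (Vector ℚ d)
      generic  : All (Generic L) reps
      distinct : AllPairs (λ z w → ¬ L ⊢ z ≈ w) reps
      complete : ∀ z → Generic L z → Any (L ⊢ z ≈_) reps
      bounded  : length reps ℕ.≤ b

  open Chambers

  module Restriction {d} (f : Vector ℚ (suc d)) (i : Fin (suc d)) (fᵢ≢0 : f i ≢ 0ℚ) where

    -- The form f i · l - l i · f has no i-th coefficient, so it is a form in the other coordinates,
    -- and on the hyperplane of f it agrees with f i · l. Multiplying by the pivot avoids a
    -- division.
    restrict : Vector ℚ (suc d) → Vector ℚ d
    restrict l j = f i * removeAt l i j + - l i * removeAt f i j

    -- Scaling the other coordinates by f i lets the equation f = 0 be solved for the i-th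
    -- coordinate without division.
    lift : Vector ℚ d → Vector ℚ (suc d)
    lift u = insertAt (λ j → f i * u j) i (- dot (removeAt f i) u)

    dot-restrict : ∀ l z → dot (restrict l) (removeAt z i) ≡ f i * dot l z + - l i * dot f z
    dot-restrict l z = trans
      (dot-linearˡ (f i) (removeAt l i) (- l i) (removeAt f i) (removeAt z i))
      (trans (solve 5 (λ f l z F L → f :* L :+ (:- l) :* F
                  := f :* (l :* z :+ L) :+ (:- l) :* (f :* z :+ F)) refl
                (f i) (l i) (z i) (dot (removeAt f i) (removeAt z i))
                    (dot (removeAt l i) (removeAt z i)))
        (sym (cong₂ (λ a b → f i * a + - l i * b) (dot-split l z i) (dot-split f z i))))

    dot-lift : ∀ l u → dot l (lift u) ≡ dot (restrict l) u
    dot-lift l u = begin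
      dot l (lift u)
        ≡⟨ dot-split l (lift u) i ⟩
      l i * lift u i + dot l′ (removeAt (lift u) i)
        ≡⟨ cong₂ (λ a b → l i * a + b) (insertAt-lookup _ i _)
             (dot-cong l′ (λ j → trans (insertAt-punchIn _ i _ j)
               (sym (trans (cong (f i * u j +_) (*-zeroˡ (u j))) (+-identityʳ (f i * u j)))))) ⟩
      l i * - dot f′ u + dot l′ (λ j → f i * u j + 0ℚ * u j)
        ≡⟨ cong (l i * - dot f′ u +_) (dot-linear l′ (f i) u 0ℚ u) ⟩
      l i * - dot f′ u + (f i * dot l′ u + 0ℚ * dot l′ u)
        ≡⟨ solve 4 (λ l F f L → l :* (:- F) :+ (f :* L :+ con 0ℚ :* L) := f :* L :+ (:- l) :* F) refl
             (l i) (dot f′ u) (f i) (dot l′ u) ⟩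
      f i * dot l′ u + - l i * dot f′ u
        ≡⟨ dot-linearˡ (f i) l′ (- l i) f′ u ⟨
      dot (restrict l) u ∎
      where
      open ≡-Reasoning
      l′ = removeAt l i
      f′ = removeAt f i

    dot-f-lift : ∀ u → dot f (lift u) ≡ 0ℚ
    dot-f-lift u = trans (dot-lift f u) (trans
      (dot-linearˡ (f i) (removeAt f i) (- f i) (removeAt f i) u)
      (solve 2 (λ a b → a :* b :+ (:- a) :* b := con 0ℚ) refl (f i) (dot (removeAt f i) u)))

    -- Lifting a restricted point multiplies it by f i, whose sign is unknown;
    -- the second factor f i makes the signs agree.
    lift² : Vector ℚ d → Vector ℚ (suc d)
    lift² u j = f i * lift u j + 0ℚ * lift u j

    dot-lift² : ∀ l u → dot l (lift² u) ≡ f i * dot (restrict l) u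
    dot-lift² l u = trans (dot-linear l (f i) (lift u) 0ℚ (lift u))
      (trans (solve 2 (λ a b → a :* b :+ con 0ℚ :* b := a :* b) refl (f i) (dot l (lift u)))
             (cong (f i *_) (dot-lift l u)))

    dot-f-lift² : ∀ u → dot f (lift² u) ≡ 0ℚ
    dot-f-lift² u = trans (dot-linear f (f i) (lift u) 0ℚ (lift u))
      (trans (cong (λ z → f i * z + 0ℚ * z) (dot-f-lift u))
        (solve 1 (λ a → a :* con 0ℚ :+ con 0ℚ :* con 0ℚ := con 0ℚ) refl (f i)))

    -- The chambers of the restricted arrangement, with representatives in the ambient space, where
    -- they can be compared with the chambers of L.
    record HyperplaneChambers (L : List (Vector ℚ (suc d))) (b : ℕ) : Set where
      field
        reps     : List (Vector ℚ (suc d))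
        onPlane  : All (λ z → dot f z ≡ 0ℚ) reps
        generic  : All (Generic L) reps
        distinct : AllPairs (λ z w → ¬ L ⊢ z ≈ w) reps
        complete : ∀ z → dot f z ≡ 0ℚ → Generic L z → Any (L ⊢ z ≈_) reps
        bounded  : length reps ℕ.≤ b

    hyperplaneChambers : ∀ L {b} → Chambers (List.map restrict L) b → HyperplaneChambers L b
    hyperplaneChambers L C = record
      { reps     = List.map lift² (reps C)
      ; onPlane  = All.map⁺ (All.universal dot-f-lift² (reps C))
      ; generic  = All.map⁺ (All.map (λ {u} gen → All.map (λ {l} r≢0 → ss⇒≢0
                     (subst (λ z → SameSign z z) (sym (dot-lift² l u))
                       (ss-scale fᵢ≢0 (≢0⇒ss r≢0)))) (All.map⁻ gen)) (generic C))
      ; distinct = AllPairs.map⁺ (AllPairs.map (λ {u} {v} u≉v u≈v → u≉v (All.map⁺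
                     (All.map (λ {l} → drop u v l) u≈v))) (distinct C))
      ; complete = comp
      ; bounded  = subst (ℕ._≤ _) (sym (List.length-map lift² (reps C))) (bounded C)
      }
      where
      drop : ∀ u v l → SameSign (dot l (lift² u)) (dot l (lift² v)) →
             SameSign (dot (restrict l) u) (dot (restrict l) v)
      drop u v l p = ss-cancel fᵢ≢0 (subst₂ SameSign (dot-lift² l u) (dot-lift² l v) p)

      comp : ∀ z → dot f z ≡ 0ℚ → Generic L z → Any (L ⊢ z ≈_) (List.map lift² (reps C))
      comp z fz≡0 gen = Any.map⁺ (Any.map step (complete C (removeAt z i) (All.map⁺
        (All.map (λ {l} l≢0 → subst (_≢ 0ℚ) (sym (eq l)) (ss⇒≢0 (ss-scale fᵢ≢0 (≢0⇒ss l≢0)))) gen))))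
        where
        eq : ∀ l → dot (restrict l) (removeAt z i) ≡ f i * dot l z
        eq l = trans (dot-restrict l z) (trans (cong (λ t → f i * dot l z + - l i * t) fz≡0)
          (solve 2 (λ a l → a :+ (:- l) :* con 0ℚ := a) refl (f i * dot l z) (l i)))
        step : ∀ {u} → List.map restrict L ⊢ removeAt z i ≈ u → L ⊢ z ≈ lift² u
        step {u} p = All.map (λ {l} s → subst (SameSign (dot l z)) (sym (dot-lift² l u))
          (ss-transfer fᵢ≢0 (subst (λ t → SameSign t (dot (restrict l) u)) (eq l) s))) (All.map⁻ p)

    module _ {L : List (Vector ℚ (suc d))} {a b}
             (C : Chambers L a) (H : HyperplaneChambers L b) where
      private
        module H = HyperplaneChambers H
        P = reps C
        Q = H.reps

        push : ℚ → Vector ℚ (suc d) → Vector ℚ (suc d)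
        push s q j = proj₁ (perturb L q (λ j → s * unit i j + 0ℚ * unit i j)) * q j
                     + 1ℚ * (s * unit i j + 0ℚ * unit i j)

        push-near : ∀ s {q} → Generic L q → L ⊢ q ≈ push s q
        push-near s {q} gen = proj₂ (perturb L q (λ j → s * unit i j + 0ℚ * unit i j)) gen _ ≤-refl

        dot-push : ∀ s {q} → dot f q ≡ 0ℚ → dot f (push s q) ≡ s * f i
        dot-push s {q} fq≡0 = begin
          dot f (λ j → K * q j + 1ℚ * (s * unit i j + 0ℚ * unit i j))
            ≡⟨ dot-linear f K q 1ℚ (λ j → s * unit i j + 0ℚ * unit i j) ⟩
          K * dot f q + 1ℚ * dot f (λ j → s * unit i j + 0ℚ * unit i j)
            ≡⟨ cong₂ (λ x y → K * x + 1ℚ * y) fq≡0 (dot-linear f s (unit i) 0ℚ (unit i)) ⟩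
          K * 0ℚ + 1ℚ * (s * dot f (unit i) + 0ℚ * dot f (unit i))
            ≡⟨ cong (λ x → K * 0ℚ + 1ℚ * (s * x + 0ℚ * x)) (dot-unitʳ f i) ⟩
          K * 0ℚ + 1ℚ * (s * f i + 0ℚ * f i)
            ≡⟨ solve 3 (λ K s f → K :* con 0ℚ :+ con 1ℚ :* (s :* f :+ con 0ℚ :* f) := s :* f) refl
                K s (f i) ⟩
          s * f i ∎
          where
          open ≡-Reasoning
          K = proj₁ (perturb L q (λ j → s * unit i j + 0ℚ * unit i j))

        abstract
          -- The point q is pushed off the hyperplane along the i-th axis, to the side chosen by s.
          -- Afterwards it matters only that it stays in its chamber and that f takes the value s f
          -- i there; hence the abstract block.
          near : ∀ s q → ∃[ w ] (Generic L q → dot f q ≡ 0ℚ → L ⊢ q ≈ w × dot f w ≡ s * f i)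
          near s q = push s q , λ gen fq≡0 → push-near s gen , dot-push s fq≡0

        plus minus : Vector ℚ (suc d) → Vector ℚ (suc d)
        plus  q = proj₁ (near 1ℚ q)
        minus q = proj₁ (near (- 1ℚ) q)

        plus-near : ∀ {q} → q ∈ Q → L ⊢ q ≈ plus q
        plus-near q∈Q = proj₁ (proj₂ (near 1ℚ _) (All.lookup H.generic q∈Q) (All.lookup H.onPlane q∈Q))

        minus-near : ∀ {q} → q ∈ Q → L ⊢ q ≈ minus q
        minus-near q∈Q = proj₁ (proj₂ (near (- 1ℚ) _) (All.lookup H.generic q∈Q)
            (All.lookup H.onPlane q∈Q))

        dot-plus : ∀ {q} → q ∈ Q → dot f (plus q) ≡ f i
        dot-plus q∈Q = trans
          (proj₂ (proj₂ (near 1ℚ _) (All.lookup H.generic q∈Q) (All.lookup H.onPlane q∈Q)))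
          (*-identityˡ (f i))

        dot-minus : ∀ {q} → q ∈ Q → dot f (minus q) ≡ - f i
        dot-minus q∈Q = trans
          (proj₂ (proj₂ (near (- 1ℚ) _) (All.lookup H.generic q∈Q) (All.lookup H.onPlane q∈Q)))
          (solve 1 (λ x → (:- con 1ℚ) :* x := :- x) refl (f i))

        -fᵢ≢0 : - f i ≢ 0ℚ
        -fᵢ≢0 = ss⇒≢0 (ss-neg (≢0⇒ss fᵢ≢0))

        -- A representative whose chamber is cut by the hyperplane is moved to
        -- the side where f i has its sign; the other side is covered by minus.
        move : Vector ℚ (suc d) → Vector ℚ (suc d)
        move p with any? (≈? L p) Q
        ... | yes p≈Q = plus (proj₁ (find p≈Q))
        ... | no  _   = p

        move-near : ∀ {p} → Generic L p → L ⊢ p ≈ move p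
        move-near {p} gen with any? (≈? L p) Q
        ... | yes p≈Q = ≈-trans (proj₂ (proj₂ (find p≈Q))) (plus-near (proj₁ (proj₂ (find p≈Q))))
        ... | no  _   = ≈-refl gen

        move-cut : ∀ {p} → Any (L ⊢ p ≈_) Q → dot f (move p) ≡ f i
        move-cut {p} p≈Q with any? (≈? L p) Q
        ... | yes p≈Q′ = dot-plus (proj₁ (proj₂ (find p≈Q′)))
        ... | no  p≉Q  = contradiction p≈Q p≉Q

        -- A chamber of L that contains any point of the hyperplane counts as cut: completeness of
        -- the restriction relates that point to a member of Q.
        on-plane : ∀ {z w p} → dot f w ≡ 0ℚ → L ⊢ z ≈ w → L ⊢ z ≈ p → Any (L ⊢ p ≈_) Q
        on-plane {w = w} fw≡0 z≈w z≈p =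
          Any.map (≈-trans (≈-trans (≈-sym z≈p) z≈w)) (H.complete w fw≡0 (≈-generic (≈-sym z≈w)))

        move-offPlane : ∀ {p} → Generic L p → dot f (move p) ≢ 0ℚ
        move-offPlane {p} gen with any? (≈? L p) Q
        ... | yes p≈Q = λ eq → fᵢ≢0 (trans (sym (dot-plus (proj₁ (proj₂ (find p≈Q))))) eq)
        ... | no  p≉Q = λ fp≡0 → p≉Q (on-plane fp≡0 (≈-refl gen) (≈-refl gen))

        -- Opposite signs of f would make the segment between z and p cross the hyperplane inside
        -- their chamber, which would then be cut.
        side : ∀ {z p} → dot f z ≢ 0ℚ → dot f p ≢ 0ℚ → L ⊢ z ≈ p → ¬ Any (L ⊢ p ≈_) Q →
          SameSign (dot f z) (dot f p)
        side {z} {p} fz≢0 fp≢0 z≈p p≉Q with sameSign? (dot f z) (dot f p)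
        ... | yes ss = ss
        ... | no ¬ss with opposite-signs fz≢0 fp≢0 ¬ss
        ...   | inj₁ (0<fz , fp<0) = let w , fw≡0 , z≈w = crossing f L 0<fz fp<0 z≈p in
                contradiction (on-plane fw≡0 z≈w z≈p) p≉Q
        ...   | inj₂ (fz<0 , 0<fp) = let w , fw≡0 , p≈w = crossing f L 0<fp fz<0 (≈-sym z≈p) in
                contradiction (on-plane fw≡0 (≈-trans z≈p p≈w) z≈p) p≉Q

        move-uncut : ∀ {z p} → dot f z ≢ 0ℚ → L ⊢ z ≈ p → ¬ Any (L ⊢ p ≈_) Q →
          SameSign (dot f z) (dot f (move p))
        move-uncut {z} {p} fz≢0 z≈p p≉Q with any? (≈? L p) Q | move-offPlane (≈-generic (≈-sym z≈p))
        ... | yes p≈Q | _    = contradiction p≈Q p≉Q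
        ... | no  _   | fp≢0 = side fz≢0 fp≢0 z≈p p≉Q

        distinct-moved : AllPairs (λ z w → ¬ f ∷ L ⊢ z ≈ w) (List.map move P)
        distinct-moved = AllPairs.map⁺ (go (generic C) (distinct C))
          where
          go : ∀ {ps} → All (Generic L) ps → AllPairs (λ z w → ¬ L ⊢ z ≈ w) ps →
            AllPairs (λ z w → ¬ f ∷ L ⊢ move z ≈ move w) ps
          go [] [] = []
          go (gp ∷ g) (p≉ ∷ dist) =
            All.zipWith (λ { (gq , p≉q) (_ ∷ r) → p≉q
              (≈-trans (≈-trans (move-near gp) r) (≈-sym (move-near gq))) }) (g , p≉)
            ∷ go g dist

        distinct-minus : AllPairs (λ z w → ¬ f ∷ L ⊢ z ≈ w) (List.map minus Q)
        distinct-minus = AllPairs.map⁺ (go id H.distinct)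
          where
          go : ∀ {qs} → (∀ {q} → q ∈ qs → q ∈ Q) → AllPairs (λ z w → ¬ L ⊢ z ≈ w) qs →
            AllPairs (λ z w → ¬ f ∷ L ⊢ minus z ≈ minus w) qs
          go ⊆Q [] = []
          go ⊆Q (q≉ ∷ dist) =
            All.tabulate (λ r∈ → λ { (_ ∷ r) → All.lookup q≉ r∈
              (≈-trans (≈-trans (minus-near (⊆Q (here refl))) r)
                  (≈-sym (minus-near (⊆Q (there r∈))))) })
            ∷ go (⊆Q ∘ there) dist

        -- Equivalence with a point near q forces the chamber of p to be cut. Then `move p` lies on
        -- the side where f has the sign of f i, opposite to `minus q`.
        moved≉minus : ∀ {p q} → Generic L p → q ∈ Q → ¬ f ∷ L ⊢ move p ≈ minus q
        moved≉minus {p} {q} gp q∈Q (ss ∷ r) = ¬ss-neg (subst₂ SameSign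
          (move-cut (lose q∈Q (≈-trans (≈-trans (move-near gp) r) (≈-sym (minus-near q∈Q)))))
          (dot-minus q∈Q) ss)

        complete-cut : ∀ {z p} → Generic (f ∷ L) z → p ∈ P → L ⊢ z ≈ p →
          Any (f ∷ L ⊢ z ≈_) (List.map move P ++ List.map minus Q)
        complete-cut {z} {p} (fz≢0 ∷ gz) p∈P z≈p with any? (≈? L p) Q
        ... | no p≉Q = Any.++⁺ˡ (Any.map⁺ (lose p∈P
                (move-uncut fz≢0 z≈p p≉Q ∷ ≈-trans z≈p (move-near (≈-generic (≈-sym z≈p))))))
        ... | yes p≈Q with sameSign? (dot f z) (f i)
        ...   | yes ss = Any.++⁺ˡ (Any.map⁺ (lose p∈P
                (subst (SameSign (dot f z)) (sym (move-cut p≈Q)) ss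
                 ∷ ≈-trans z≈p (move-near (≈-generic (≈-sym z≈p))))))
        ...   | no ¬ss = let q , q∈Q , p≈q = find p≈Q in
                Any.++⁺ʳ (List.map move P) (Any.map⁺ (lose q∈Q
                  (subst (SameSign (dot f z)) (sym (dot-minus q∈Q)) (ss-neg-or fz≢0 fᵢ≢0 ¬ss)
                   ∷ ≈-trans (≈-trans z≈p p≈q) (minus-near q∈Q))))

      -- A chamber of L missed by the hyperplane survives, and one that is met splits in two. Those
      -- that are met correspond to the chambers of the restriction, so each q in Q accounts for one
      -- additional chamber.
      chambers-∷ : Chambers (f ∷ L) (a ℕ.+ b)
      chambers-∷ = record
        { reps     = List.map move P ++ List.map minus Q
        ; generic  = All.++⁺
            (All.map⁺ (All.map (λ gp → move-offPlane gp ∷ ≈-generic (≈-sym (move-near gp)))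
                (generic C)))
            (All.map⁺ (All.tabulate (λ q∈Q →
              subst (_≢ 0ℚ) (sym (dot-minus q∈Q)) -fᵢ≢0 ∷ ≈-generic (≈-sym (minus-near q∈Q)))))
        ; distinct = AllPairs.++⁺ distinct-moved distinct-minus
            (All.map⁺ (All.map (λ gp → All.map⁺ (All.tabulate (moved≉minus gp))) (generic C)))
        ; complete = λ { z (fz≢0 ∷ gz) → let p , p∈P , z≈p = find (complete C z gz) in
            complete-cut (fz≢0 ∷ gz) p∈P z≈p }
        ; bounded  = begin
            length (List.map move P ++ List.map minus Q)
              ≡⟨ List.length-++ (List.map move P) ⟩
            length (List.map move P) ℕ.+ length (List.map minus Q)
              ≡⟨ cong₂ ℕ._+_ (List.length-map move P) (List.length-map minus Q) ⟩
            length P ℕ.+ length Q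
              ≤⟨ ℕ.+-mono-≤ (bounded C) H.bounded ⟩
            a ℕ.+ b ∎
        }
        where open ℕ.≤-Reasoning

  -- The number of chambers of n central hyperplanes in general position in
  -- dimension d.
  maxChambers : ℕ → ℕ → ℕ
  maxChambers zero    d       = 1
  maxChambers (suc n) zero    = 0
  maxChambers (suc n) (suc d) = maxChambers n (suc d) ℕ.+ maxChambers n d

  chambers : ∀ {d} (L : List (Vector ℚ d)) → Chambers L (maxChambers (length L) d)
  chambers [] = record
    { reps     = (λ _ → 0ℚ) ∷ []
    ; generic  = [] ∷ []
    ; distinct = [] ∷ []
    ; complete = λ _ _ → here []
    ; bounded  = ℕ.≤-refl
    }
  chambers (f ∷ L) with zero-form? f
  -- A zero form leaves no generic point, hence no chamber; in dimension 0 every form is of this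
  -- kind.
  ... | inj₁ f≡0 = record
    { reps     = []
    ; generic  = []
    ; distinct = []
    ; complete = λ { z (fz≢0 ∷ _) → contradiction (dot-zeroˡ f≡0 z) fz≢0 }
    ; bounded  = ℕ.z≤n
    }
  chambers {suc d} (f ∷ L) | inj₂ (i , fᵢ≢0) =
    chambers-∷ (chambers L) (hyperplaneChambers L
        (subst (λ n → Chambers (List.map restrict L) (maxChambers n d))
      (List.length-map restrict L) (chambers (List.map restrict L))))
    where open Restriction f i fᵢ≢0

-- Numerical estimates: chamber numbers, partial sums of e, binomial coefficients

module Estimates where

  open import Data.Rational.Base hiding (1/_)
  open import Data.Rational.Properties
  open import Data.Integer.Base as ℤ using (ℤ)
  import Data.Integer.Properties as ℤ
  import Data.Integer.Tactic.RingSolver as ℤ-Ring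
  open import Data.Rational.Unnormalised.Base as ℚᵘ using (mkℚᵘ; *≡*)
  import Data.Rational.Unnormalised.Properties as ℚᵘ
  open import Data.Nat.Combinatorics using (_C_; nC1≡n; nCk+nC[k+1]≡[n+1]C[k+1])
  open import Algebra.Definitions.RawSemiring +-*-rawSemiring using (_^_)
  open import Defs using (1/_!; expSum)
  open Signs
  open Arrangements using (maxChambers)

  toℚᵘ-/ : ∀ i d .{{_ : ℕ.NonZero d}} → toℚᵘ (i / d) ℚᵘ.≃ (i ℚᵘ./ d)
  toℚᵘ-/ i (suc d) = toℚᵘ-fromℚᵘ (mkℚᵘ i d)

  opaque

    -- Opaque, so that the estimates rely on its semiring laws and not on the normalisation of
    -- fractions.
    ι : ℕ → ℚ
    ι n = ℤ.+ n / 1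

    ι-suc : ∀ n → ι (suc n) ≡ 1ℚ + ι n
    ι-suc n = toℚᵘ-injective
      (ℚᵘ.≃-trans (toℚᵘ-/ (ℤ.+ suc n) 1)
      (ℚᵘ.≃-trans (*≡* (lemma (ℤ.+ n)))
      (ℚᵘ.≃-sym (ℚᵘ.≃-trans (toℚᵘ-homo-+ 1ℚ (ι n))
          (ℚᵘ.+-cong (ℚᵘ.≃-refl {toℚᵘ 1ℚ}) (toℚᵘ-/ (ℤ.+ n) 1))))))
      where
      lemma : ∀ x → (ℤ.1ℤ ℤ.+ x) ℤ.* ℤ.+ 1 ≡ (ℤ.1ℤ ℤ.* ℤ.+ 1 ℤ.+ x ℤ.* ℤ.+ 1) ℤ.* ℤ.+ 1
      lemma = ℤ-Ring.solve-∀

    ι≡/1 : ∀ n → ι n ≡ ℤ.+ n / 1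
    ι≡/1 n = refl

    /-*-ι : ∀ a d .{{_ : ℕ.NonZero d}} → (ℤ.+ a / d) * ι d ≡ ι a
    /-*-ι a (suc d) = toℚᵘ-injective
      (ℚᵘ.≃-trans (toℚᵘ-homo-* (ℤ.+ a / suc d) (ι (suc d)))
      (ℚᵘ.≃-trans (ℚᵘ.*-cong (toℚᵘ-/ (ℤ.+ a) (suc d)) (toℚᵘ-/ (ℤ.+ suc d) 1))
      (ℚᵘ.≃-trans (*≡* (trans (lemma (ℤ.+ a) (ℤ.+ suc d))
          (cong (ℤ.+ a ℤ.*_) (sym (ℤ.pos-* (suc d) 1)))))
      (ℚᵘ.≃-sym (toℚᵘ-/ (ℤ.+ a) 1)))))
      where
      lemma : ∀ x y → (x ℤ.* y) ℤ.* ℤ.+ 1 ≡ x ℤ.* (y ℤ.* ℤ.+ 1)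
      lemma = ℤ-Ring.solve-∀

  ι-+ : ∀ m n → ι (m ℕ.+ n) ≡ ι m + ι n
  ι-+ zero    n = sym (trans (cong (_+ ι n) (ι≡/1 0)) (+-identityˡ (ι n)))
  ι-+ (suc m) n = trans (ι-suc (m ℕ.+ n)) (trans (cong (1ℚ +_) (ι-+ m n))
    (trans (sym (+-assoc 1ℚ (ι m) (ι n))) (cong (_+ ι n) (sym (ι-suc m)))))

  ι-* : ∀ m n → ι (m ℕ.* n) ≡ ι m * ι n
  ι-* zero    n = trans (ι≡/1 0) (sym (trans (cong (_* ι n) (ι≡/1 0)) (*-zeroˡ (ι n))))
  ι-* (suc m) n = begin
    ι (n ℕ.+ m ℕ.* n)   ≡⟨ ι-+ n (m ℕ.* n) ⟩
    ι n + ι (m ℕ.* n)   ≡⟨ cong (ι n +_) (ι-* m n) ⟩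
    ι n + ι m * ι n     ≡⟨ solve 2 (λ m n → n :+ m :* n := (con 1ℚ :+ m) :* n) refl (ι m) (ι n) ⟩
    (1ℚ + ι m) * ι n    ≡⟨ cong (_* ι n) (ι-suc m) ⟨
    ι (suc m) * ι n     ∎
    where open ≡-Reasoning

  0≤ι : ∀ n → 0ℚ ≤ ι n
  0≤ι zero    = ≤-reflexive (sym (ι≡/1 0))
  0≤ι (suc n) = subst (0ℚ ≤_) (sym (ι-suc n)) (+-mono-≤ (nonNegative⁻¹ 1ℚ) (0≤ι n))

  ι-mono : ∀ {m n} → m ℕ.≤ n → ι m ≤ ι n
  ι-mono {m} {n} m≤n = ≤-by (0≤ι (n ℕ.∸ m))
    (trans (cong ι (sym (ℕ.m+[n∸m]≡n m≤n))) (ι-+ m (n ℕ.∸ m)))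

  0<ι : ∀ n .{{_ : ℕ.NonZero n}} → 0ℚ < ι n
  0<ι (suc n) = subst (0ℚ <_) (sym (ι-suc n)) (+-mono-<-≤ (positive⁻¹ 1ℚ) (0≤ι n))

  ^-0≤ : ∀ {x} → 0ℚ ≤ x → ∀ n → 0ℚ ≤ x ^ n
  ^-0≤ 0≤x zero    = nonNegative⁻¹ 1ℚ
  ^-0≤ 0≤x (suc n) = 0≤p*q 0≤x (^-0≤ 0≤x n)

  ^-0< : ∀ {x} → 0ℚ < x → ∀ n → 0ℚ < x ^ n
  ^-0< 0<x zero    = positive⁻¹ 1ℚ
  ^-0< 0<x (suc n) = 0<p*q 0<x (^-0< 0<x n)

  ^-mono-≤ : ∀ {x y} → 0ℚ ≤ x → x ≤ y → ∀ n → x ^ n ≤ y ^ n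
  ^-mono-≤ 0≤x x≤y zero    = ≤-refl
  ^-mono-≤ 0≤x x≤y (suc n) = *-mono-≤ 0≤x x≤y (^-0≤ 0≤x n) (^-mono-≤ 0≤x x≤y n)

  ^-mono-< : ∀ {x y} → 0ℚ ≤ x → x < y → ∀ n → x ^ suc n < y ^ suc n
  ^-mono-< {x} {y} 0≤x x<y n = ≤-<-trans
    (*-monoˡ-≤-nonNeg x {{nonNegative 0≤x}} (^-mono-≤ 0≤x (<⇒≤ x<y) n))
    (*-monoˡ-<-pos (y ^ n) {{positive (^-0< (≤-<-trans 0≤x x<y) n)}} x<y)

  ^-zeroˡ : ∀ n → 1ℚ ^ n ≡ 1ℚ
  ^-zeroˡ zero    = refl
  ^-zeroˡ (suc n) = trans (*-identityˡ _) (^-zeroˡ n)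

  ^-≤1 : ∀ {x} → 0ℚ ≤ x → x ≤ 1ℚ → ∀ n → x ^ n ≤ 1ℚ
  ^-≤1 {x} 0≤x x≤1 n = subst (x ^ n ≤_) (^-zeroˡ n) (^-mono-≤ 0≤x x≤1 n)

  1≤^ : ∀ {x} → 1ℚ ≤ x → ∀ n → 1ℚ ≤ x ^ n
  1≤^ {x} 1≤x n = subst (_≤ x ^ n) (^-zeroˡ n) (^-mono-≤ (nonNegative⁻¹ 1ℚ) 1≤x n)

  ^-distrib-* : ∀ x y n → (x * y) ^ n ≡ x ^ n * y ^ n
  ^-distrib-* x y zero    = refl
  ^-distrib-* x y (suc n) = trans (cong (x * y *_) (^-distrib-* x y n))
    (solve 4 (λ x y a b → x :* y :* (a :* b) := x :* a :* (y :* b)) refl x y (x ^ n) (y ^ n))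

  ^-+ : ∀ x m n → x ^ (m ℕ.+ n) ≡ x ^ m * x ^ n
  ^-+ x zero    n = sym (*-identityˡ _)
  ^-+ x (suc m) n = trans (cong (x *_) (^-+ x m n)) (sym (*-assoc x _ _))

  ^-^ : ∀ x m n → x ^ (m ℕ.* n) ≡ (x ^ n) ^ m
  ^-^ x zero    n = refl
  ^-^ x (suc m) n = trans (^-+ x n (m ℕ.* n)) (cong (x ^ n *_) (^-^ x m n))

  bernoulli : ∀ {u} → 0ℚ ≤ u → ∀ k → 1ℚ + ι k * u ≤ (1ℚ + u) ^ k
  bernoulli {u} 0≤u zero = ≤-reflexive (trans (cong (λ z → 1ℚ + z * u) (ι≡/1 0))
    (trans (cong (1ℚ +_) (*-zeroˡ u)) (+-identityʳ 1ℚ)))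
  bernoulli {u} 0≤u (suc k) = begin
    1ℚ + ι (suc k) * u
      ≤⟨ ≤-by (0≤p*q (0≤p*q (0≤ι k) 0≤u) 0≤u) (trans
           (solve 2 (λ k u → (con 1ℚ :+ u) :* (con 1ℚ :+ k :* u)
              := con 1ℚ :+ (con 1ℚ :+ k) :* u :+ k :* u :* u) refl (ι k) u)
           (cong (λ z → 1ℚ + z * u + ι k * u * u) (sym (ι-suc k)))) ⟩
    (1ℚ + u) * (1ℚ + ι k * u)
      ≤⟨ *-monoˡ-≤-nonNeg (1ℚ + u) {{nonNegative (+-mono-≤ (nonNegative⁻¹ 1ℚ) 0≤u)}} (bernoulli 0≤u k) ⟩
    (1ℚ + u) ^ suc k ∎
    where open ≤-Reasoning

  suc-*-1/! : ∀ n → ι (suc n) * 1/ suc n ! ≡ 1/ n !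
  suc-*-1/! n = begin
    ι (suc n) * 1/ suc n !
      ≡⟨ *-identityʳ _ ⟨
    ι (suc n) * 1/ suc n ! * 1ℚ
      ≡⟨ cong (ι (suc n) * 1/ suc n ! *_) (inv n) ⟨
    ι (suc n) * 1/ suc n ! * (1/ n ! * ι (n !))
      ≡⟨ solve 4 (λ a b c d → a :* b :* (c :* d) := b :* (a :* d) :* c) refl
           (ι (suc n)) (1/ suc n !) (1/ n !) (ι (n !)) ⟩
    1/ suc n ! * (ι (suc n) * ι (n !)) * 1/ n !
      ≡⟨ cong (λ z → 1/ suc n ! * z * 1/ n !) (ι-* (suc n) (n !)) ⟨
    1/ suc n ! * ι (suc n !) * 1/ n !
      ≡⟨ cong (_* 1/ n !) (inv (suc n)) ⟩
    1ℚ * 1/ n !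
      ≡⟨ *-identityˡ _ ⟩
    1/ n ! ∎
    where
    open ≡-Reasoning
    inv : ∀ n → 1/ n ! * ι (n !) ≡ 1ℚ
    inv n = trans (/-*-ι 1 (n !) {{n ℕ.!≢0}}) (ι≡/1 1)

  0<1/! : ∀ n → 0ℚ < 1/ n !
  0<1/! n = positive⁻¹ _ {{normalize-pos 1 (n !) {{n ℕ.!≢0}}}}

  -- The Taylor polynomial of degree n of the exponential function at 0.
  expTrunc : ℚ → ℕ → ℚ
  expTrunc x zero    = 1ℚ
  expTrunc x (suc n) = expTrunc x n + x ^ suc n * 1/ suc n !

  expTrunc-1 : ∀ n → expTrunc 1ℚ n ≡ expSum n
  expTrunc-1 zero    = refl
  expTrunc-1 (suc n) = cong₂ _+_ (expTrunc-1 n)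
    (trans (cong (_* 1/ suc n !) (^-zeroˡ (suc n))) (*-identityˡ _))

  ^-tangent : ∀ {x u} → 0ℚ ≤ x → 0ℚ ≤ u → ∀ n →
    x ^ suc n + ι (suc n) * u * x ^ n ≤ (x + u) ^ suc n
  ^-tangent {x} {u} 0≤x 0≤u zero = ≤-reflexive
    (trans (cong (λ z → x * 1ℚ + z * u * 1ℚ) (ι≡/1 1))
      (solve 2 (λ x u → x :* con 1ℚ :+ con 1ℚ :* u :* con 1ℚ := (x :+ u) :* con 1ℚ) refl x u))
  ^-tangent {x} {u} 0≤x 0≤u (suc n) = begin
    x ^ suc (suc n) + ι (suc (suc n)) * u * x ^ suc n
      ≡⟨ cong (λ z → x ^ suc (suc n) + z * u * x ^ suc n) (ι-suc (suc n)) ⟩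
    x ^ suc (suc n) + (1ℚ + ι (suc n)) * u * x ^ suc n
      ≤⟨ ≤-by (0≤p*q (0≤p*q (0≤p*q (0≤ι (suc n)) 0≤u) (^-0≤ 0≤x n)) 0≤u)
           (solve 4 (λ x u i p → (x :+ u) :* (x :* p :+ i :* u :* p)
              := x :* (x :* p) :+ (con 1ℚ :+ i) :* u :* (x :* p) :+ i :* u :* p :* u)
              refl x u (ι (suc n)) (x ^ n)) ⟩
    (x + u) * (x ^ suc n + ι (suc n) * u * x ^ n)
      ≤⟨ *-monoˡ-≤-nonNeg (x + u) {{nonNegative (+-mono-≤ 0≤x 0≤u)}} (^-tangent 0≤x 0≤u n) ⟩
    (x + u) ^ suc (suc n) ∎
    where open ≤-Reasoning

  -- The derivative of the Taylor polynomial of degree n + 1 is the one of degree n, and the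
  -- polynomial is convex for nonnegative arguments, so it lies above its tangent at x. The terms
  -- are compared one by one with `^-tangent`.
  expTrunc-tangent : ∀ {x u} → 0ℚ ≤ x → 0ℚ ≤ u → ∀ n →
    expTrunc x (suc n) + u * expTrunc x n ≤ expTrunc (x + u) (suc n)
  expTrunc-tangent {x} {u} 0≤x 0≤u zero = ≤-reflexive
    (solve 2 (λ x u → (con 1ℚ :+ x :* con 1ℚ :* con 1ℚ) :+ u :* con 1ℚ
       := con 1ℚ :+ (x :+ u) :* con 1ℚ :* con 1ℚ) refl x u)
  expTrunc-tangent {x} {u} 0≤x 0≤u (suc n) = begin
    (E + p * c) + u * (E′ + q * 1/ suc n !)
      ≡⟨ cong (λ z → (E + p * c) + u * (E′ + q * z)) (suc-*-1/! (suc n)) ⟨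
    (E + p * c) + u * (E′ + q * (ι (suc (suc n)) * c))
      ≡⟨ solve 7 (λ E p c u E′ q i → (E :+ p :* c) :+ u :* (E′ :+ q :* (i :* c))
           := (E :+ u :* E′) :+ (p :+ i :* u :* q) :* c) refl E p c u E′ q (ι (suc (suc n))) ⟩
    (E + u * E′) + (p + ι (suc (suc n)) * u * q) * c
      ≤⟨ +-mono-≤ (expTrunc-tangent 0≤x 0≤u n)
           (*-monoʳ-≤-nonNeg c {{nonNegative (<⇒≤ (0<1/! (suc (suc n))))}}
               (^-tangent 0≤x 0≤u (suc n))) ⟩
    expTrunc (x + u) (suc n) + (x + u) ^ suc (suc n) * c ∎
    where
    open ≤-Reasoning
    E = expTrunc x (suc n)
    E′ = expTrunc x n
    p = x ^ suc (suc n)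
    q = x ^ suc n
    c = 1/ suc (suc n) !

  -- By the tangent inequality, one more factor 1 + u is paid for by raising the argument from n u
  -- to (n + 1) u. For n u = 1 the bound is a partial sum of e, which is rational and strictly below
  -- e.
  [1+u]^n≤expTrunc : ∀ {u} → 0ℚ ≤ u → ∀ n → (1ℚ + u) ^ n ≤ expTrunc (ι n * u) n
  [1+u]^n≤expTrunc {u} 0≤u zero = ≤-refl
  [1+u]^n≤expTrunc {u} 0≤u (suc n) = begin
    (1ℚ + u) * (1ℚ + u) ^ n
      ≤⟨ *-monoˡ-≤-nonNeg (1ℚ + u) {{nonNegative (+-mono-≤ (nonNegative⁻¹ 1ℚ) 0≤u)}}
           ([1+u]^n≤expTrunc 0≤u n) ⟩
    (1ℚ + u) * E
      ≤⟨ ≤-by (0≤p*q (^-0≤ 0≤x (suc n)) (<⇒≤ (0<1/! (suc n))))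
           (solve 3 (λ u E z → (E :+ z) :+ u :* E := (con 1ℚ :+ u) :* E :+ z) refl u E _) ⟩
    expTrunc (ι n * u) (suc n) + u * E
      ≤⟨ expTrunc-tangent 0≤x 0≤u n ⟩
    expTrunc (ι n * u + u) (suc n)
      ≡⟨ cong (λ z → expTrunc z (suc n)) (trans
           (solve 2 (λ n u → n :* u :+ u := (con 1ℚ :+ n) :* u) refl (ι n) u)
           (cong (_* u) (sym (ι-suc n)))) ⟩
    expTrunc (ι (suc n) * u) (suc n) ∎
    where
    open ≤-Reasoning
    E = expTrunc (ι n * u) n
    0≤x = 0≤p*q (0≤ι n) 0≤u

  -- The sum of binomial coefficients is bypassed: after multiplication by t ^ d, the recursion of
  -- `maxChambers` costs a factor 1 + t for each further hyperplane. The constant 2 counts the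
  -- chambers of a single hyperplane, where t ≤ 1 absorbs t ^ d.
  maxChambers-bound : ∀ {t} → 0ℚ ≤ t → t ≤ 1ℚ → ∀ n d →
    ι (maxChambers (suc n) (suc d)) * t ^ d ≤ ι 2 * (1ℚ + t) ^ n
  maxChambers-bound {t} 0≤t t≤1 zero d = *-monoˡ-≤-nonNeg (ι 2) {{nonNegative (0≤ι 2)}} (^-≤1 0≤t t≤1 d)
  maxChambers-bound {t} 0≤t t≤1 (suc n) zero = begin
    ι (maxChambers (suc n) 1 ℕ.+ 0) * 1ℚ
      ≡⟨ cong (λ k → ι k * 1ℚ) (ℕ.+-identityʳ (maxChambers (suc n) 1)) ⟩
    ι (maxChambers (suc n) 1) * 1ℚ
      ≤⟨ maxChambers-bound 0≤t t≤1 n zero ⟩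
    ι 2 * (1ℚ + t) ^ n
      ≤⟨ *-monoˡ-≤-nonNeg (ι 2) {{nonNegative (0≤ι 2)}}
          (≤-by (0≤p*q 0≤t (^-0≤ (+-mono-≤ (nonNegative⁻¹ 1ℚ) 0≤t) n))
           (solve 2 (λ t p → (con 1ℚ :+ t) :* p := p :+ t :* p) refl t ((1ℚ + t) ^ n))) ⟩
    ι 2 * (1ℚ + t) ^ suc n ∎
    where open ≤-Reasoning
  maxChambers-bound {t} 0≤t t≤1 (suc n) (suc d) = begin
    ι (M ℕ.+ M′) * t ^ suc d
      ≡⟨ cong (_* t ^ suc d) (ι-+ M M′) ⟩
    (ι M + ι M′) * t ^ suc d
      ≡⟨ solve 4 (λ M M′ t p → (M :+ M′) :* (t :* p) := M :* (t :* p) :+ t :* (M′ :* p))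
           refl (ι M) (ι M′) t (t ^ d) ⟩
    ι M * t ^ suc d + t * (ι M′ * t ^ d)
      ≤⟨ +-mono-≤ (maxChambers-bound 0≤t t≤1 n (suc d))
           (*-monoˡ-≤-nonNeg t {{nonNegative 0≤t}} (maxChambers-bound 0≤t t≤1 n d)) ⟩
    ι 2 * (1ℚ + t) ^ n + t * (ι 2 * (1ℚ + t) ^ n)
      ≡⟨ solve 3 (λ c t p → c :* p :+ t :* (c :* p) := c :* ((con 1ℚ :+ t) :* p)) refl (ι 2) t
          ((1ℚ + t) ^ n) ⟩
    ι 2 * (1ℚ + t) ^ suc n ∎
    where
    open ≤-Reasoning
    M = maxChambers (suc n) (suc (suc d))
    M′ = maxChambers (suc n) (suc d)

  -- The choice t = k / n optimises the bound above.
  maxChambers-exp : ∀ n k → k ℕ.≤ suc n → ∀ {q} → 0ℚ ≤ q → ι (suc n) ≤ q * ι k →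
    ι (maxChambers (suc (suc n)) (suc k)) ≤ ι 2 * (expSum (suc n) * q) ^ k
  maxChambers-exp n k k≤N {q} 0≤q N≤qk = begin
    M                                  ≡⟨ *-identityʳ M ⟨
    M * 1ℚ                             ≤⟨ *-monoˡ-≤-nonNeg M
        {{nonNegative (0≤ι (maxChambers (suc (suc n)) (suc k)))}} (1≤^ 1≤tq k) ⟩
    M * (t * q) ^ k                    ≡⟨ cong (M *_) (^-distrib-* t q k) ⟩
    M * (t ^ k * q ^ k)                ≡⟨ *-assoc M _ _ ⟨
    M * t ^ k * q ^ k                  ≤⟨ *-monoʳ-≤-nonNeg (q ^ k) {{q^k≥0}}
        (maxChambers-bound 0≤t t≤1 (suc n) k) ⟩
    ι 2 * (1ℚ + t) ^ suc n * q ^ k     ≤⟨ *-monoʳ-≤-nonNeg (q ^ k) {{q^k≥0}}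
        (*-monoˡ-≤-nonNeg (ι 2) {{nonNegative (0≤ι 2)}} exp) ⟩
    ι 2 * expSum (suc n) ^ k * q ^ k   ≡⟨ trans (cong (ι 2 *_) (^-distrib-* (expSum (suc n)) q k))
        (sym (*-assoc (ι 2) _ _)) ⟨
    ι 2 * (expSum (suc n) * q) ^ k     ∎
    where
    open ≤-Reasoning
    M = ι (maxChambers (suc (suc n)) (suc k))
    u = ℤ.+ 1 / suc n
    t = ι k * u
    q^k≥0 = nonNegative (^-0≤ 0≤q k)
    0<u : 0ℚ < u
    0<u = positive⁻¹ u {{normalize-pos 1 (suc n)}}
    0≤u = <⇒≤ 0<u
    Nu≡1 : ι (suc n) * u ≡ 1ℚ
    Nu≡1 = trans (*-comm (ι (suc n)) u) (trans (/-*-ι 1 (suc n)) (ι≡/1 1))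
    0≤t = 0≤p*q (0≤ι k) 0≤u
    t≤1 : t ≤ 1ℚ
    t≤1 = subst (t ≤_) Nu≡1 (*-monoʳ-≤-nonNeg u {{nonNegative 0≤u}} (ι-mono k≤N))
    1≤tq : 1ℚ ≤ t * q
    1≤tq = subst₂ _≤_ Nu≡1 (solve 3 (λ q k u → q :* k :* u := k :* u :* q) refl q (ι k) u)
      (*-monoʳ-≤-nonNeg u {{nonNegative 0≤u}} N≤qk)
    -- Since t = k u, Bernoulli's inequality bounds 1 + t by (1 + u) ^ k; exchanging the two
    -- exponents leaves (1 + u) ^ suc n with (n + 1) u = 1.
    exp : (1ℚ + t) ^ suc n ≤ expSum (suc n) ^ k
    exp = begin
      (1ℚ + t) ^ suc n             ≤⟨ ^-mono-≤ (+-mono-≤ (nonNegative⁻¹ 1ℚ) 0≤t) (bernoulli 0≤u k)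
          (suc n) ⟩
      ((1ℚ + u) ^ k) ^ suc n       ≡⟨ ^-^ (1ℚ + u) (suc n) k ⟨
      (1ℚ + u) ^ (suc n ℕ.* k)     ≡⟨ cong ((1ℚ + u) ^_) (ℕ.*-comm (suc n) k) ⟩
      (1ℚ + u) ^ (k ℕ.* suc n)     ≡⟨ ^-^ (1ℚ + u) k (suc n) ⟩
      ((1ℚ + u) ^ suc n) ^ k       ≤⟨ ^-mono-≤ (^-0≤ (+-mono-≤ (nonNegative⁻¹ 1ℚ) 0≤u) (suc n))
          ([1+u]^n≤expTrunc 0≤u (suc n)) k ⟩
      expTrunc (ι (suc n) * u) (suc n) ^ k ≡⟨ cong (λ z → expTrunc z (suc n) ^ k) Nu≡1 ⟩
      expTrunc 1ℚ (suc n) ^ k      ≡⟨ cong (_^ k) (expTrunc-1 (suc n)) ⟩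
      expSum (suc n) ^ k           ∎

  C-closed-2 : ∀ n → 2 ℕ.* ((2 ℕ.+ n) C 2) ≡ (2 ℕ.+ n) ℕ.* (1 ℕ.+ n)
  C-closed-2 zero = refl
  C-closed-2 (suc n) = begin
    2 ℕ.* ((3 ℕ.+ n) C 2)                       ≡⟨ cong (2 ℕ.*_) (nCk+nC[k+1]≡[n+1]C[k+1] (2 ℕ.+ n) 1) ⟨
    2 ℕ.* ((2 ℕ.+ n) C 1 ℕ.+ (2 ℕ.+ n) C 2)     ≡⟨ ℕ.*-distribˡ-+ 2 ((2 ℕ.+ n) C 1) ((2 ℕ.+ n) C 2) ⟩
    2 ℕ.* ((2 ℕ.+ n) C 1) ℕ.+ 2 ℕ.* ((2 ℕ.+ n) C 2)
      ≡⟨ cong₂ (λ a b → 2 ℕ.* a ℕ.+ b) (nC1≡n (2 ℕ.+ n)) (C-closed-2 n) ⟩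
    2 ℕ.* (2 ℕ.+ n) ℕ.+ (2 ℕ.+ n) ℕ.* (1 ℕ.+ n) ≡⟨ lemma n ⟩
    (3 ℕ.+ n) ℕ.* (2 ℕ.+ n) ∎
    where
    open ≡-Reasoning
    lemma : ∀ n → 2 ℕ.* (2 ℕ.+ n) ℕ.+ (2 ℕ.+ n) ℕ.* (1 ℕ.+ n) ≡ (3 ℕ.+ n) ℕ.* (2 ℕ.+ n)
    lemma = ℕ-Ring.solve-∀

  C-closed-3 : ∀ n → 6 ℕ.* ((3 ℕ.+ n) C 3) ≡ (3 ℕ.+ n) ℕ.* (2 ℕ.+ n) ℕ.* (1 ℕ.+ n)
  C-closed-3 zero = refl
  C-closed-3 (suc n) = begin
    6 ℕ.* ((4 ℕ.+ n) C 3)                       ≡⟨ cong (6 ℕ.*_) (nCk+nC[k+1]≡[n+1]C[k+1] (3 ℕ.+ n) 2) ⟨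
    6 ℕ.* ((3 ℕ.+ n) C 2 ℕ.+ (3 ℕ.+ n) C 3)     ≡⟨ lemma₁ ((3 ℕ.+ n) C 2) ((3 ℕ.+ n) C 3) ⟩
    3 ℕ.* (2 ℕ.* ((3 ℕ.+ n) C 2)) ℕ.+ 6 ℕ.* ((3 ℕ.+ n) C 3)
      ≡⟨ cong₂ (λ a b → 3 ℕ.* a ℕ.+ b) (C-closed-2 (suc n)) (C-closed-3 n) ⟩
    3 ℕ.* ((3 ℕ.+ n) ℕ.* (2 ℕ.+ n)) ℕ.+ (3 ℕ.+ n) ℕ.* (2 ℕ.+ n) ℕ.* (1 ℕ.+ n) ≡⟨ lemma₂ n ⟩
    (4 ℕ.+ n) ℕ.* (3 ℕ.+ n) ℕ.* (2 ℕ.+ n) ∎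
    where
    open ≡-Reasoning
    lemma₁ : ∀ a b → 6 ℕ.* (a ℕ.+ b) ≡ 3 ℕ.* (2 ℕ.* a) ℕ.+ 6 ℕ.* b
    lemma₁ = ℕ-Ring.solve-∀
    lemma₂ : ∀ n → 3 ℕ.* ((3 ℕ.+ n) ℕ.* (2 ℕ.+ n)) ℕ.+ (3 ℕ.+ n) ℕ.* (2 ℕ.+ n) ℕ.* (1 ℕ.+ n)
      ≡ (4 ℕ.+ n) ℕ.* (3 ℕ.+ n) ℕ.* (2 ℕ.+ n)
    lemma₂ = ℕ-Ring.solve-∀

  C-closed-4 : ∀ n → 24 ℕ.* ((4 ℕ.+ n) C 4) ≡ (4 ℕ.+ n) ℕ.* (3 ℕ.+ n) ℕ.* (2 ℕ.+ n) ℕ.* (1 ℕ.+ n)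
  C-closed-4 zero = refl
  C-closed-4 (suc n) = begin
    24 ℕ.* ((5 ℕ.+ n) C 4)                       ≡⟨ cong (24 ℕ.*_)
        (nCk+nC[k+1]≡[n+1]C[k+1] (4 ℕ.+ n) 3) ⟨
    24 ℕ.* ((4 ℕ.+ n) C 3 ℕ.+ (4 ℕ.+ n) C 4)     ≡⟨ lemma₁ ((4 ℕ.+ n) C 3) ((4 ℕ.+ n) C 4) ⟩
    4 ℕ.* (6 ℕ.* ((4 ℕ.+ n) C 3)) ℕ.+ 24 ℕ.* ((4 ℕ.+ n) C 4)
      ≡⟨ cong₂ (λ a b → 4 ℕ.* a ℕ.+ b) (C-closed-3 (suc n)) (C-closed-4 n) ⟩
    4 ℕ.* ((4 ℕ.+ n) ℕ.* (3 ℕ.+ n) ℕ.* (2 ℕ.+ n)) ℕ.+ (4 ℕ.+ n) ℕ.* (3 ℕ.+ n) ℕ.* (2 ℕ.+ n) ℕ.*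
        (1 ℕ.+ n)
      ≡⟨ lemma₂ n ⟩
    (5 ℕ.+ n) ℕ.* (4 ℕ.+ n) ℕ.* (3 ℕ.+ n) ℕ.* (2 ℕ.+ n) ∎
    where
    open ≡-Reasoning
    lemma₁ : ∀ a b → 24 ℕ.* (a ℕ.+ b) ≡ 4 ℕ.* (6 ℕ.* a) ℕ.+ 24 ℕ.* b
    lemma₁ = ℕ-Ring.solve-∀
    lemma₂ : ∀ n → 4 ℕ.* ((4 ℕ.+ n) ℕ.* (3 ℕ.+ n) ℕ.* (2 ℕ.+ n)) ℕ.+ (4 ℕ.+ n) ℕ.* (3 ℕ.+ n) ℕ.*
        (2 ℕ.+ n) ℕ.* (1 ℕ.+ n)
      ≡ (5 ℕ.+ n) ℕ.* (4 ℕ.+ n) ℕ.* (3 ℕ.+ n) ℕ.* (2 ℕ.+ n)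
    lemma₂ = ℕ-Ring.solve-∀

-- Rational configurations up to the order of their midpoints

module Points where

  open import Data.Rational.Base
  open import Data.Rational.Properties
  open import Data.Nat.Combinatorics using (_C_; nC1≡n; nCk+nC[k+1]≡[n+1]C[k+1])
  open Signs
  open Arrangements

  private variable
    m n : ℕ

  -- Splitting by whether the least index is zero follows Pascal's rule, which makes the lengths
  -- binomial coefficients.
  pairs : ∀ m → List (Fin m × Fin m)
  pairs zero    = []
  pairs (suc m) = List.map (λ j → zero , suc j) (allFin m)
               ++ List.map (λ (i , j) → suc i , suc j) (pairs m)

  triples : ∀ m → List (Fin m × Fin m × Fin m)
  triples zero    = []
  triples (suc m) = List.map (λ (i , j) → zero , suc i , suc j) (pairs m)
                 ++ List.map (λ (i , j , k) → suc i , suc j , suc k) (triples m)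

  quadruples : ∀ m → List (Fin m × Fin m × Fin m × Fin m)
  quadruples zero    = []
  quadruples (suc m) = List.map (λ (i , j , k) → zero , suc i , suc j , suc k) (triples m)
                    ++ List.map (λ (i , j , k , l) → suc i , suc j , suc k , suc l) (quadruples m)

  private
    length-step : ∀ {X Y Z : Set} {f : X → Z} {g : Y → Z} m k xs ys →
      length xs ≡ m C k → length ys ≡ m C suc k →
      length (List.map f xs ++ List.map g ys) ≡ suc m C suc k
    length-step {f = f} {g} m k xs ys p q = begin
      length (List.map f xs ++ List.map g ys) ≡⟨ List.length-++ (List.map f xs) ⟩
      length (List.map f xs) ℕ.+ length (List.map g ys)
        ≡⟨ cong₂ ℕ._+_ (trans (List.length-map f xs) p) (trans (List.length-map g ys) q) ⟩
      m C k ℕ.+ m C suc k                     ≡⟨ nCk+nC[k+1]≡[n+1]C[k+1] m k ⟩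
      suc m C suc k                           ∎
      where open ≡-Reasoning

  length-pairs : ∀ m → length (pairs m) ≡ m C 2
  length-pairs zero    = refl
  length-pairs (suc m) = length-step m 1 (allFin m) (pairs m)
    (trans (List.length-tabulate {n = m} id) (sym (nC1≡n m))) (length-pairs m)

  length-triples : ∀ m → length (triples m) ≡ m C 3
  length-triples zero    = refl
  length-triples (suc m) = length-step m 2 (pairs m) (triples m) (length-pairs m) (length-triples m)

  length-quadruples : ∀ m → length (quadruples m) ≡ m C 4
  length-quadruples zero    = refl
  length-quadruples (suc m) =
    length-step m 3 (triples m) (quadruples m) (length-triples m) (length-quadruples m)

  ∈-pairs : ∀ {i j : Fin m} → i Fin.< j → (i , j) ∈ pairs m
  ∈-pairs {i = zero}  {suc j} i<j = ∈-++⁺ˡ (∈-map⁺ _ (∈-allFin j))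
  ∈-pairs {suc m} {suc i} {suc j} i<j =
    ∈-++⁺ʳ (List.map _ (allFin m)) (∈-map⁺ _ (∈-pairs (ℕ.s<s⁻¹ i<j)))

  ∈-triples : ∀ {i j k : Fin m} → i Fin.< j → j Fin.< k → (i , j , k) ∈ triples m
  ∈-triples {i = zero}  {suc j} {suc k} i<j j<k = ∈-++⁺ˡ (∈-map⁺ _ (∈-pairs (ℕ.s<s⁻¹ j<k)))
  ∈-triples {suc m} {suc i} {suc j} {suc k} i<j j<k =
    ∈-++⁺ʳ (List.map _ (pairs m)) (∈-map⁺ _ (∈-triples (ℕ.s<s⁻¹ i<j) (ℕ.s<s⁻¹ j<k)))

  ∈-quadruples : ∀ {i j k l : Fin m} → i Fin.< j → j Fin.< k → k Fin.< l →
      (i , j , k , l) ∈ quadruples m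
  ∈-quadruples {i = zero} {suc j} {suc k} {suc l} i<j j<k k<l =
    ∈-++⁺ˡ (∈-map⁺ _ (∈-triples (ℕ.s<s⁻¹ j<k) (ℕ.s<s⁻¹ k<l)))
  ∈-quadruples {suc m} {suc i} {suc j} {suc k} {suc l} i<j j<k k<l =
    ∈-++⁺ʳ (List.map _ (triples m)) (∈-map⁺ _ (∈-quadruples (ℕ.s<s⁻¹ i<j) (ℕ.s<s⁻¹ j<k) (ℕ.s<s⁻¹ k<l)))

  pairs-< : ∀ m → All (λ (i , j) → i Fin.< j) (pairs m)
  pairs-< zero    = []
  pairs-< (suc m) = All.++⁺
    (All.map⁺ (All.universal (λ _ → ℕ.z<s) (allFin m)))
    (All.map⁺ (All.map ℕ.s<s (pairs-< m)))

  triples-< : ∀ m → All (λ (i , j , k) → i Fin.< j × j Fin.< k) (triples m)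
  triples-< zero    = []
  triples-< (suc m) = All.++⁺
    (All.map⁺ (All.map (λ j<k → ℕ.z<s , ℕ.s<s j<k) (pairs-< m)))
    (All.map⁺ (All.map (λ (p , q) → ℕ.s<s p , ℕ.s<s q) (triples-< m)))

  quadruples-< : ∀ m → All (λ (i , j , k , l) → i Fin.< j × j Fin.< k × k Fin.< l) (quadruples m)
  quadruples-< zero    = []
  quadruples-< (suc m) = All.++⁺
    (All.map⁺ (All.map (λ (p , q) → ℕ.z<s , ℕ.s<s p , ℕ.s<s q) (triples-< m)))
    (All.map⁺ (All.map (λ (p , q , r) → ℕ.s<s p , ℕ.s<s q , ℕ.s<s r) (quadruples-< m)))

  -- Midpoints sharing an index differ by a gap, so only quadruples of distinct
  -- indices are needed to compare all midpoints.

  gap : Vector ℚ m → Fin m → Fin m → ℚ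
  gap x i j = x j - x i

  quad : Vector ℚ m → Fin m → Fin m → Fin m → Fin m → ℚ
  quad x i j k l = (x i + x j) - (x k + x l)

  -- In `quads` the four indices are distinct and i is the least, so each unordered choice of two
  -- disjoint pairs is listed once.
  record Equiv {m} (x y : Vector ℚ m) : Set where
    constructor mkEquiv
    field
      gaps  : ∀ {i j} → i Fin.< j → SameSign (gap x i j) (gap y i j)
      quads : ∀ {i j k l} → i Fin.< j → k Fin.< l → i Fin.< k → j ≢ k → j ≢ l →
              SameSign (quad x i j k l) (quad y i j k l)

  open Equiv public

  Equiv-sym : ∀ {x y : Vector ℚ m} → Equiv x y → Equiv y x
  Equiv-sym e = mkEquiv (λ p → ss-sym (gaps e p)) (λ p q r s t → ss-sym (quads e p q r s t))

  Equiv-trans : ∀ {x y z : Vector ℚ m} → Equiv x y → Equiv y z → Equiv x z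
  Equiv-trans e f = mkEquiv (λ p → ss-trans (gaps e p) (gaps f p))
    (λ p q r s t → ss-trans (quads e p q r s t) (quads f p q r s t))

  module _ {x y : Vector ℚ m} (e : Equiv x y) where

    gaps-≢ : ∀ {i j} → i ≢ j → SameSign (gap x i j) (gap y i j)
    gaps-≢ {i} {j} i≢j with Fin.<-cmp i j
    ... | tri< i<j _ _ = gaps e i<j
    ... | tri≈ _ i≡j _ = contradiction i≡j i≢j
    ... | tri> _ _ j<i = subst₂ SameSign (flip (x i) (x j)) (flip (y i) (y j)) (ss-neg (gaps e j<i))
      where
      flip : ∀ a b → - (a - b) ≡ b - a
      flip = solve 2 (λ a b → :- (a :- b) := b :- a) refl

    private
      swapQ : ∀ {i j k l} → SameSign (quad x k l i j) (quad y k l i j) →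
        SameSign (quad x i j k l) (quad y i j k l)
      swapQ {i} {j} {k} {l} p = subst₂ SameSign
        (flip (x k) (x l) (x i) (x j)) (flip (y k) (y l) (y i) (y j)) (ss-neg p)
        where
        flip : ∀ a b c d → - ((a + b) - (c + d)) ≡ (c + d) - (a + b)
        flip = solve 4 (λ a b c d → :- ((a :+ b) :- (c :+ d)) := (c :+ d) :- (a :+ b)) refl

      swapˡ : ∀ {i j k l} → SameSign (quad x j i k l) (quad y j i k l) →
        SameSign (quad x i j k l) (quad y i j k l)
      swapˡ {i} {j} {k} {l} = subst₂ (λ a b → SameSign (a - (x k + x l)) (b - (y k + y l)))
        (+-comm (x j) (x i)) (+-comm (y j) (y i))

      swapʳ : ∀ {i j k l} → SameSign (quad x i j l k) (quad y i j l k) →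
        SameSign (quad x i j k l) (quad y i j k l)
      swapʳ {i} {j} {k} {l} = subst₂ (λ a b → SameSign ((x i + x j) - a) ((y i + y j) - b))
        (+-comm (x l) (x k)) (+-comm (y l) (y k))

      quads₁ : ∀ {i j k l} → i Fin.< j → k Fin.< l → i ≢ k → i ≢ l → j ≢ k → j ≢ l →
        SameSign (quad x i j k l) (quad y i j k l)
      quads₁ {i} {j} {k} {l} i<j k<l i≢k i≢l j≢k j≢l with Fin.<-cmp i k
      ... | tri< i<k _ _ = quads e i<j k<l i<k j≢k j≢l
      ... | tri≈ _ i≡k _ = contradiction i≡k i≢k
      ... | tri> _ _ k<i = swapQ (quads e k<l i<j k<i (≢-sym i≢l) (≢-sym j≢l))

      quads₂ : ∀ {i j k l} → i Fin.< j → i ≢ k → i ≢ l → j ≢ k → j ≢ l → k ≢ l →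
        SameSign (quad x i j k l) (quad y i j k l)
      quads₂ {i} {j} {k} {l} i<j i≢k i≢l j≢k j≢l k≢l with Fin.<-cmp k l
      ... | tri< k<l _ _ = quads₁ i<j k<l i≢k i≢l j≢k j≢l
      ... | tri≈ _ k≡l _ = contradiction k≡l k≢l
      ... | tri> _ _ l<k = swapʳ (quads₁ i<j l<k i≢l i≢k j≢l j≢k)

    quads-≢ : ∀ {i j k l} → i ≢ j → i ≢ k → i ≢ l → j ≢ k → j ≢ l → k ≢ l →
      SameSign (quad x i j k l) (quad y i j k l)
    quads-≢ {i} {j} i≢j i≢k i≢l j≢k j≢l k≢l with Fin.<-cmp i j
    ... | tri< i<j _ _ = quads₂ i<j i≢k i≢l j≢k j≢l k≢l
    ... | tri≈ _ i≡j _ = contradiction i≡j i≢j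
    ... | tri> _ _ j<i = swapˡ (quads₂ j<i j≢k j≢l i≢k i≢l k≢l)

    -- The map f need not preserve the order, which is why gaps and quads were first extended to
    -- arbitrary distinct indices. It serves for permutations, for the reversal of indices and for
    -- deleting the first point.
    Equiv-∘ : ∀ {n} (f : Fin n → Fin m) → (∀ {i j} → f i ≡ f j → i ≡ j) → Equiv (x ∘ f) (y ∘ f)
    Equiv-∘ f inj = mkEquiv (λ i<j → gaps-≢ (Fin.<⇒≢ i<j ∘ inj))
      (λ i<j k<l i<k j≢k j≢l → quads-≢ (Fin.<⇒≢ i<j ∘ inj) (Fin.<⇒≢ i<k ∘ inj)
        (Fin.<⇒≢ (Fin.<-trans i<k k<l) ∘ inj) (j≢k ∘ inj) (j≢l ∘ inj) (Fin.<⇒≢ k<l ∘ inj))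

  Equiv-shift : ∀ {x w : Vector ℚ m} c → (∀ i → w i ≡ x i - c) → Equiv x x → Equiv x w
  Equiv-shift {x = x} {w} c w≡ e = mkEquiv
    (λ {i} {j} p → subst (SameSign _) (sym (trans (cong₂ _-_ (w≡ j) (w≡ i))
      (solve 3 (λ a b c → (a :- c) :- (b :- c) := a :- b) refl (x j) (x i) c))) (gaps e p))
    (λ {i} {j} {k} {l} p q r s t → subst (SameSign _) (sym (trans
      (cong₂ _-_ (cong₂ _+_ (w≡ i) (w≡ j)) (cong₂ _+_ (w≡ k) (w≡ l)))
      (solve 5 (λ a b d f c → ((a :- c) :+ (b :- c)) :- ((d :- c) :+ (f :- c)) := (a :+ b) :- (d :+ f))
        refl (x i) (x j) (x k) (x l) c))) (quads e p q r s t))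

  -- Equiv as an arrangement.  Translating so that the first coordinate is 0
  -- leaves one dimension less.

  origin∷ : Vector ℚ n → Vector ℚ (suc n)
  origin∷ z = 0ℚ Vector.∷ z

  gapForm : Fin (suc n) → Fin (suc n) → Vector ℚ n
  gapForm i j a = 1ℚ * unit j (suc a) + - 1ℚ * unit i (suc a)

  quadForm : Fin (suc n) → Fin (suc n) → Fin (suc n) → Fin (suc n) → Vector ℚ n
  quadForm i j k l a = 1ℚ * gapForm k i a + 1ℚ * gapForm l j a

  private
    dot-unit-tail : ∀ (z : Vector ℚ n) i → dot (unit i ∘ suc) z ≡ origin∷ z i
    dot-unit-tail z i = begin
      dot (unit i ∘ suc) z                      ≡⟨ +-identityˡ _ ⟨
      0ℚ + dot (unit i ∘ suc) z                 ≡⟨ cong (_+ dot (unit i ∘ suc) z)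
          (*-zeroʳ (unit i zero)) ⟨
      unit i zero * 0ℚ + dot (unit i ∘ suc) z   ≡⟨ dot-∷ (unit i) (origin∷ z) ⟨
      dot (unit i) (origin∷ z)                  ≡⟨ dot-unitˡ (origin∷ z) i ⟩
      origin∷ z i                               ∎
      where open ≡-Reasoning

  dot-gapForm : ∀ i j (z : Vector ℚ n) → dot (gapForm i j) z ≡ gap (origin∷ z) i j
  dot-gapForm i j z = trans (dot-linearˡ 1ℚ (unit j ∘ suc) (- 1ℚ) (unit i ∘ suc) z)
    (trans (cong₂ (λ a b → 1ℚ * a + - 1ℚ * b) (dot-unit-tail z j) (dot-unit-tail z i))
      (solve 2 (λ a b → con 1ℚ :* a :+ (:- con 1ℚ) :* b := a :- b) refl (origin∷ z j) (origin∷ z i)))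

  dot-quadForm : ∀ i j k l (z : Vector ℚ n) → dot (quadForm i j k l) z ≡ quad (origin∷ z) i j k l
  dot-quadForm i j k l z = trans (dot-linearˡ 1ℚ (gapForm k i) 1ℚ (gapForm l j) z)
    (trans (cong₂ (λ a b → 1ℚ * a + 1ℚ * b) (dot-gapForm k i z) (dot-gapForm l j z))
      (solve 4 (λ a b c d → con 1ℚ :* (a :- c) :+ con 1ℚ :* (b :- d) := (a :+ b) :- (c :+ d)) refl
        (origin∷ z i) (origin∷ z j) (origin∷ z k) (origin∷ z l)))

  -- Four indices can be split into two pairs in three ways, hence three families of quads over the
  -- sorted quadruples.
  forms : ∀ n → List (Vector ℚ n)
  forms n = List.map (λ (i , j) → gapForm i j) (pairs (suc n))
    ++ List.map (λ (i , j , k , l) → quadForm i j k l) (quadruples (suc n))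
    ++ List.map (λ (i , j , k , l) → quadForm i k j l) (quadruples (suc n))
    ++ List.map (λ (i , j , k , l) → quadForm i l j k) (quadruples (suc n))

  length-forms : ∀ n → length (forms n) ≡ (suc n C 2) ℕ.+ 3 ℕ.* (suc n C 4)
  length-forms n = begin
    length (forms n)
      ≡⟨ trans (List.length-++ L₁) (cong (length L₁ ℕ.+_) (trans (List.length-++ L₂)
           (cong (length L₂ ℕ.+_) (List.length-++ L₃ {L₄})))) ⟩
    length L₁ ℕ.+ (length L₂ ℕ.+ (length L₃ ℕ.+ length L₄))
      ≡⟨ cong₂ ℕ._+_ (trans (List.length-map _ (pairs (suc n))) (length-pairs (suc n)))
           (cong₂ ℕ._+_ (len _) (cong₂ ℕ._+_ (len _) (len _))) ⟩
    (suc n C 2) ℕ.+ (c ℕ.+ (c ℕ.+ c))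
      ≡⟨ cong (λ z → (suc n C 2) ℕ.+ (c ℕ.+ (c ℕ.+ z))) (ℕ.+-identityʳ c) ⟨
    (suc n C 2) ℕ.+ 3 ℕ.* c ∎
    where
    open ≡-Reasoning
    c = suc n C 4
    L₁ = List.map (λ (i , j) → gapForm i j) (pairs (suc n))
    L₂ = List.map (λ (i , j , k , l) → quadForm i j k l) (quadruples (suc n))
    L₃ = List.map (λ (i , j , k , l) → quadForm i k j l) (quadruples (suc n))
    L₄ = List.map (λ (i , j , k , l) → quadForm i l j k) (quadruples (suc n))
    len : (f : Fin (suc n) × Fin (suc n) × Fin (suc n) × Fin (suc n) → Vector ℚ n) →
      length (List.map f (quadruples (suc n))) ≡ c
    len f = trans (List.length-map f (quadruples (suc n))) (length-quadruples (suc n))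

  ≈⇒Equiv : ∀ {z w : Vector ℚ n} → forms n ⊢ z ≈ w → Equiv (origin∷ z) (origin∷ w)
  ≈⇒Equiv {n} {z} {w} z≈w = mkEquiv
    (λ {i} {j} i<j → subst₂ SameSign (dot-gapForm i j z) (dot-gapForm i j w)
      (All.lookup z≈w (∈-++⁺ˡ (∈-map⁺ _ (∈-pairs i<j)))))
    qs
    where
    L₁ = List.map (λ (i , j) → gapForm i j) (pairs (suc n))
    L₂ = List.map (λ (i , j , k , l) → quadForm i j k l) (quadruples (suc n))
    L₃ = List.map (λ (i , j , k , l) → quadForm i k j l) (quadruples (suc n))
    via : ∀ {i j k l} → quadForm i j k l ∈ forms n →
        SameSign (quad (origin∷ z) i j k l) (quad (origin∷ w) i j k l)
    via {i} {j} {k} {l} f∈ = subst₂ SameSign (dot-quadForm i j k l z) (dot-quadForm i j k l w)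
        (All.lookup z≈w f∈)
    qs : ∀ {i j k l} → i Fin.< j → k Fin.< l → i Fin.< k → j ≢ k → j ≢ l →
      SameSign (quad (origin∷ z) i j k l) (quad (origin∷ w) i j k l)
    -- As i is least and k < l, the position of j decides which of the three splittings of the
    -- sorted quadruple applies.
    qs {i} {j} {k} {l} i<j k<l i<k j≢k j≢l with Fin.<-cmp j k | Fin.<-cmp j l
    ... | tri< j<k _ _ | _ = via {i} {j} {k} {l}
        (∈-++⁺ʳ L₁ (∈-++⁺ˡ (∈-map⁺ _ (∈-quadruples i<j j<k k<l))))
    ... | tri≈ _ j≡k _ | _ = contradiction j≡k j≢k
    ... | tri> _ _ k<j | tri< j<l _ _ = via {i} {j} {k} {l}
      (∈-++⁺ʳ L₁ (∈-++⁺ʳ L₂ (∈-++⁺ˡ (∈-map⁺ _ (∈-quadruples i<k k<j j<l)))))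
    ... | tri> _ _ k<j | tri≈ _ j≡l _ = contradiction j≡l j≢l
    ... | tri> _ _ k<j | tri> _ _ l<j = via {i} {j} {k} {l}
      (∈-++⁺ʳ L₁ (∈-++⁺ʳ L₂ (∈-++⁺ʳ L₃ (∈-map⁺ _ (∈-quadruples i<k k<l l<j)))))

  Equiv⇒≈ : ∀ {z w : Vector ℚ n} → Equiv (origin∷ z) (origin∷ w) → forms n ⊢ z ≈ w
  Equiv⇒≈ {n} {z} {w} e = All.++⁺
    (All.map⁺ (All.map (λ {(i , j)} i<j →
      subst₂ SameSign (sym (dot-gapForm i j z)) (sym (dot-gapForm i j w)) (gaps e i<j))
          (pairs-< (suc n))))
    (All.++⁺ (All.map⁺ (All.map (λ {(i , j , k , l)} (i<j , j<k , k<l) → via i j k l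
        (quads e i<j k<l (Fin.<-trans i<j j<k) (Fin.<⇒≢ j<k) (Fin.<⇒≢ (Fin.<-trans j<k k<l)))) all<))
    (All.++⁺ (All.map⁺ (All.map (λ {(i , j , k , l)} (i<j , j<k , k<l) → via i k j l
        (quads e (Fin.<-trans i<j j<k) (Fin.<-trans j<k k<l) i<j (≢-sym (Fin.<⇒≢ j<k))
            (Fin.<⇒≢ k<l))) all<))
    (All.map⁺ (All.map (λ {(i , j , k , l)} (i<j , j<k , k<l) → via i l j k
        (quads e (Fin.<-trans (Fin.<-trans i<j j<k) k<l) j<k i<j
          (≢-sym (Fin.<⇒≢ (Fin.<-trans j<k k<l))) (≢-sym (Fin.<⇒≢ k<l)))) all<))))
    where
    all< = quadruples-< (suc n)
    via : ∀ i j k l → SameSign (quad (origin∷ z) i j k l) (quad (origin∷ w) i j k l) →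
      SameSign (dot (quadForm i j k l) z) (dot (quadForm i j k l) w)
    via i j k l = subst₂ SameSign (sym (dot-quadForm i j k l z)) (sym (dot-quadForm i j k l w))

  opaque

    allReps : ∀ n → List (Vector ℚ (suc n))
    allReps n = List.map origin∷ (Chambers.reps (chambers (forms n)))

    length-allReps : ∀ n → length (allReps n) ℕ.≤ maxChambers (length (forms n)) n
    length-allReps n = subst (ℕ._≤ maxChambers (length (forms n)) n)
        (sym (List.length-map origin∷ (Chambers.reps (chambers (forms n)))))
      (Chambers.bounded (chambers (forms n)))

    allReps-generic : ∀ n → All (λ x → Equiv x x) (allReps n)
    allReps-generic n = All.map⁺ (All.map (λ g → ≈⇒Equiv (≈-refl g))
        (Chambers.generic (chambers (forms n))))

    allReps-distinct : ∀ n → AllPairs (λ x y → ¬ Equiv x y) (allReps n)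
    allReps-distinct n = AllPairs.map⁺ (AllPairs.map (λ z≉w e → z≉w (Equiv⇒≈ e))
        (Chambers.distinct (chambers (forms n))))

    allReps-complete : ∀ {x : Vector ℚ (suc n)} → Equiv x x → Any (Equiv x) (allReps n)
    allReps-complete {n} {x} e = Any.map⁺ (Any.map (λ z≈w → Equiv-trans x~z (≈⇒Equiv z≈w))
      (Chambers.complete (chambers (forms n)) z
          (≈-generic (Equiv⇒≈ (Equiv-trans (Equiv-sym x~z) x~z)))))
      where
      z : Vector ℚ n
      z i = x (suc i) - x zero
      x~z : Equiv x (origin∷ z)
      x~z = Equiv-shift (x zero) (λ { zero → sym (+-inverseʳ (x zero)) ; (suc i) → refl }) e

-- Ordered representatives and the action of the symmetric group

module Patterns where

  open import Data.Rational.Base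
  open import Data.Rational.Properties
  open Signs
  open Points

  private variable
    m n : ℕ

  module _ {A : Set} {R : A → A → Set} (R-sym : Symmetric R) (R-trans : Transitive R) where

    -- The position of an entry of ys related to f i is an injective function of i, because two
    -- elements related to the same entry are related to each other.
    pigeonhole-≤ : ∀ {N} (f : Fin N → A) ys → (∀ i → Any (R (f i)) ys) →
      (∀ {i j} → R (f i) (f j) → i ≡ j) → N ℕ.≤ length ys
    pigeonhole-≤ f ys covered inj = Fin.injective⇒≤ {f = λ i → index (covered i)} λ {i} {j} eq →
      inj (R-trans (Any.lookup-index (covered i))
        (subst (λ k → R (lookup ys k) (f j)) (sym eq) (R-sym (Any.lookup-index (covered j)))))

    lookup-injective : ∀ {xs} → AllPairs (λ x y → ¬ R x y) xs →
      ∀ {i j} → R (lookup xs i) (lookup xs j) → i ≡ j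
    lookup-injective (x≉ ∷ d) {zero}  {zero}  r = refl
    lookup-injective {x ∷ xs} (x≉ ∷ d) {zero}  {suc j} r =
      contradiction r (All.lookup x≉ (∈-lookup {xs = xs} j))
    lookup-injective {x ∷ xs} (x≉ ∷ d) {suc i} {zero}  r =
      contradiction (R-sym r) (All.lookup x≉ (∈-lookup {xs = xs} i))
    lookup-injective (x≉ ∷ d) {suc i} {suc j} r = cong suc (lookup-injective d r)

    distinct-≤ : ∀ {xs ys} → AllPairs (λ x y → ¬ R x y) xs →
      All (λ x → Any (R x) ys) xs → length xs ℕ.≤ length ys
    distinct-≤ {xs} {ys} d covered = pigeonhole-≤ (lookup xs) ys
      (λ i → All.lookup covered (∈-lookup {xs = xs} i)) (lookup-injective d)

  -- Permutations are coded by factorial digits: the leading digit is the image of zero, and the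
  -- remainder permutes the other elements.
  permutation : ∀ m → Fin (m !) → Permutation′ m
  permutation zero    _ = idₚ
  permutation (suc m) c =
    insert zero (proj₁ (remQuot {suc m} (m !) c)) (permutation m (proj₂ (remQuot {suc m} (m !) c)))

  remQuot-injective : ∀ k {i j : Fin (m ℕ.* k)} → proj₁ (remQuot {m} k i) ≡ proj₁ (remQuot {m} k j) →
    proj₂ (remQuot {m} k i) ≡ proj₂ (remQuot {m} k j) → i ≡ j
  remQuot-injective {m} k {i} {j} p q = trans (sym (Fin.combine-remQuot {m} k i))
    (trans (cong₂ combine p q) (Fin.combine-remQuot {m} k j))

  permutation-injective : ∀ m {c d} → (∀ i → permutation m c ⟨$⟩ʳ i ≡ permutation m d ⟨$⟩ʳ i) → c ≡ d
  permutation-injective zero    {zero} {zero} _ = refl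
  permutation-injective (suc m) {c} {d} eq = remQuot-injective {suc m} (m !) (eq zero)
    (permutation-injective m λ i → Fin.punchIn-injective a _ _ (begin
      punchIn a (π ⟨$⟩ʳ i)
        ≡⟨ insert-punchIn zero a π i ⟨
      permutation (suc m) c ⟨$⟩ʳ suc i
        ≡⟨ eq (suc i) ⟩
      permutation (suc m) d ⟨$⟩ʳ suc i
        ≡⟨ insert-punchIn zero b ρ i ⟩
      punchIn b (ρ ⟨$⟩ʳ i)
        ≡⟨ cong (λ z → punchIn z (ρ ⟨$⟩ʳ i)) (eq zero) ⟨
      punchIn a (ρ ⟨$⟩ʳ i) ∎))
    where
    open ≡-Reasoning
    a = proj₁ (remQuot {suc m} (m !) c)
    b = proj₁ (remQuot {suc m} (m !) d)
    π = permutation m (proj₂ (remQuot {suc m} (m !) c))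
    ρ = permutation m (proj₂ (remQuot {suc m} (m !) d))

  increasing⇒+≤ : ∀ (f : Fin (suc m) → ℕ) → (∀ {i j} → i Fin.< j → f i ℕ.< f j) →
    ∀ i → Fin.toℕ i ℕ.+ f zero ℕ.≤ f i
  increasing⇒+≤ f inc zero = ℕ.≤-refl
  increasing⇒+≤ {suc m} f inc (suc i) = begin
    suc (Fin.toℕ i ℕ.+ f zero) ≡⟨ ℕ.+-suc (Fin.toℕ i) (f zero) ⟨
    Fin.toℕ i ℕ.+ suc (f zero) ≤⟨ ℕ.+-monoʳ-≤ (Fin.toℕ i) (inc ℕ.z<s) ⟩
    Fin.toℕ i ℕ.+ f (suc zero) ≤⟨ increasing⇒+≤ (f ∘ suc) (inc ∘ ℕ.s<s) i ⟩
    f (suc i)                  ∎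
    where open ℕ.≤-Reasoning

  increasing⇒≤ : ∀ (f : Fin m → Fin m) → (∀ {i j} → i Fin.< j → f i Fin.< f j) → ∀ i → i Fin.≤ f i
  increasing⇒≤ {suc m} f inc i = ℕ.≤-trans (ℕ.m≤m+n (Fin.toℕ i) _) (increasing⇒+≤ (Fin.toℕ ∘ f) inc i)

  -- The composite of τ with the inverse of σ is an increasing self-map of a finite chain, so it
  -- lies above the identity. Applied in both directions this identifies σ and τ.
  same-order⇒≤ : ∀ (σ τ : Permutation′ m) →
    (∀ {i j} → (σ ⟨$⟩ʳ i) Fin.< (σ ⟨$⟩ʳ j) → (τ ⟨$⟩ʳ i) Fin.< (τ ⟨$⟩ʳ j)) →
    ∀ i → (σ ⟨$⟩ʳ i) Fin.≤ (τ ⟨$⟩ʳ i)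
  same-order⇒≤ σ τ ord i = subst (λ k → (σ ⟨$⟩ʳ i) Fin.≤ (τ ⟨$⟩ʳ k)) (inverseˡ σ)
    (increasing⇒≤ (λ k → τ ⟨$⟩ʳ (σ ⟨$⟩ˡ k))
      (λ {i} {j} i<j → ord (subst₂ Fin._<_ (sym (inverseʳ σ)) (sym (inverseʳ σ)) i<j)) (σ ⟨$⟩ʳ i))

  ⟨$⟩ʳ-injective : ∀ (σ : Permutation′ m) {i j} → σ ⟨$⟩ʳ i ≡ σ ⟨$⟩ʳ j → i ≡ j
  ⟨$⟩ʳ-injective σ eq = trans (sym (inverseˡ σ)) (trans (cong (σ ⟨$⟩ˡ_) eq) (inverseˡ σ))

  Increasingℚ : Vector ℚ m → Set
  Increasingℚ x = ∀ i j → i Fin.< j → x i < x j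

  increasingℚ? : (x : Vector ℚ m) → Dec (Increasingℚ x)
  increasingℚ? x = Fin.all? λ i → Fin.all? λ j → (i Fin.<? j) →-dec (x i <? x j)

  increasingℚ-cancel : ∀ {x : Vector ℚ m} → Increasingℚ x → ∀ {i j} → x i < x j → i Fin.< j
  increasingℚ-cancel inc {i} {j} xi<xj with Fin.<-cmp i j
  ... | tri< i<j _ _ = i<j
  ... | tri≈ _ refl _ = contradiction xi<xj (<-irrefl refl)
  ... | tri> _ _ j<i = contradiction xi<xj (<-asym (inc j i j<i))

  -- SameSign excludes 0, so Equiv x x says that x is generic.
  record OrderedGenericℚ (x : Vector ℚ m) : Set where
    constructor mkOG
    field
      incr : Increasingℚ x
      gen  : Equiv x x

  open OrderedGenericℚ public

  Equiv-increasing : ∀ {x y : Vector ℚ m} → Equiv x y → Increasingℚ x → Increasingℚ y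
  Equiv-increasing e inc i j i<j with gaps e i<j
  ... | inj₁ (_ , 0<) = 0<p-q⇒q<p 0<
  ... | inj₂ (<0 , _) = contradiction (inc i j i<j) (<-asym (p-q<0⇒p<q <0))

  increasing-gaps : ∀ {x y : Vector ℚ m} → Increasingℚ x → Increasingℚ y →
    ∀ {i j} → i Fin.< j → SameSign (gap x i j) (gap y i j)
  increasing-gaps inc inc′ i<j = inj₁ (p<q⇒0<q-p (inc _ _ i<j) , p<q⇒0<q-p (inc′ _ _ i<j))

  module _ {x y : Vector ℚ m} (ox : OrderedGenericℚ x) (oy : OrderedGenericℚ y)
           (σ τ : Permutation′ m) (e : Equiv (x ∘ (σ ⟨$⟩ʳ_)) (y ∘ (τ ⟨$⟩ʳ_))) where
    private
      order : ∀ {x y : Vector ℚ m} → Increasingℚ x → Increasingℚ y →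
        ∀ (σ τ : Permutation′ m) → Equiv (x ∘ (σ ⟨$⟩ʳ_)) (y ∘ (τ ⟨$⟩ʳ_)) →
        ∀ {i j} → (σ ⟨$⟩ʳ i) Fin.< (σ ⟨$⟩ʳ j) → (τ ⟨$⟩ʳ i) Fin.< (τ ⟨$⟩ʳ j)
      order incx incy σ τ e {i} {j} lt with gaps-≢ e {i} {j} (λ { refl → Fin.<-irrefl refl lt })
      ... | inj₁ (_ , 0<) = increasingℚ-cancel incy (0<p-q⇒q<p 0<)
      ... | inj₂ (<0 , _) = contradiction (incx _ _ lt) (<-asym (p-q<0⇒p<q <0))

    -- Freeness of the action: the gaps record the order of the permuted coordinates, and for
    -- increasing x that order determines σ.
    permuted-same-permutation : ∀ i → σ ⟨$⟩ʳ i ≡ τ ⟨$⟩ʳ i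
    permuted-same-permutation i = Fin.≤-antisym
      (same-order⇒≤ σ τ (order (incr ox) (incr oy) σ τ e) i)
      (same-order⇒≤ τ σ (order (incr oy) (incr ox) τ σ (Equiv-sym e)) i)

    permuted-Equiv : Equiv x y
    permuted-Equiv = mkEquiv (increasing-gaps (incr ox) (incr oy))
      (λ {i} {j} {k} {l} i<j k<l i<k j≢k j≢l → subst₂ SameSign
        (cong₂ _-_ (cong₂ _+_ (back i) (back j)) (cong₂ _+_ (back k) (back l)))
        (cong₂ _-_ (cong₂ _+_ (back′ i) (back′ j)) (cong₂ _+_ (back′ k) (back′ l)))
        (quads-≢ e {σ ⟨$⟩ˡ i} {σ ⟨$⟩ˡ j} {σ ⟨$⟩ˡ k} {σ ⟨$⟩ˡ l}
          (Fin.<⇒≢ i<j ∘ inj) (Fin.<⇒≢ i<k ∘ inj) (Fin.<⇒≢ (Fin.<-trans i<k k<l) ∘ inj)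
          (j≢k ∘ inj) (j≢l ∘ inj) (Fin.<⇒≢ k<l ∘ inj)))
      where
      back : ∀ i → x (σ ⟨$⟩ʳ (σ ⟨$⟩ˡ i)) ≡ x i
      back i = cong x (inverseʳ σ)
      back′ : ∀ i → y (τ ⟨$⟩ʳ (σ ⟨$⟩ˡ i)) ≡ y i
      back′ i = cong y (trans (sym (permuted-same-permutation (σ ⟨$⟩ˡ i))) (inverseʳ σ))
      inj : ∀ {i j} → σ ⟨$⟩ˡ i ≡ σ ⟨$⟩ˡ j → i ≡ j
      inj eq = trans (sym (inverseʳ σ)) (trans (cong (σ ⟨$⟩ʳ_) eq) (inverseʳ σ))

  opaque

    -- Transversal of the chambers in the cone of increasing vectors; its length turns out to be the
    -- number of ranking patterns of n + 1 points.
    reps : ∀ n → List (Vector ℚ (suc n))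
    reps n = List.filter increasingℚ? (allReps n)

    reps-OG : All OrderedGenericℚ (reps n)
    reps-OG {n} = All.zipWith (λ (p , q) → mkOG p q)
      (All.all-filter increasingℚ? (allReps n) , All.filter⁺ increasingℚ? (allReps-generic n))

    reps-distinct : AllPairs (λ x y → ¬ Equiv x y) (reps n)
    reps-distinct {n} = AllPairs.filter⁺ increasingℚ? (allReps-distinct n)

    reps-complete : ∀ {x : Vector ℚ (suc n)} → OrderedGenericℚ x → Any (Equiv x) (reps n)
    reps-complete (mkOG inc e) with find (allReps-complete e)
    ... | y , y∈ , x~y = lose (∈-filter⁺ increasingℚ? y∈ (Equiv-increasing x~y inc)) x~y

  distinct-≤-reps : ∀ {xs : List (Vector ℚ (suc n))} → AllPairs (λ x y → ¬ Equiv x y) xs →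
    All OrderedGenericℚ xs → length xs ℕ.≤ length (reps n)
  distinct-≤-reps d og = distinct-≤ Equiv-sym Equiv-trans d (All.map reps-complete og)

  private
    -- Pairs of a permutation and an ordered representative yield pairwise inequivalent generic
    -- points, since both components can be read off the class of the permuted point.
    permuted-≤ : ∀ {N} {σ : Fin N → Permutation′ m} →
        (∀ {c d} → (∀ i → σ c ⟨$⟩ʳ i ≡ σ d ⟨$⟩ʳ i) → c ≡ d) →
      ∀ {xs ys : List (Vector ℚ m)} → All OrderedGenericℚ xs → AllPairs (λ x y → ¬ Equiv x y) xs →
      (∀ {x} → Equiv x x → Any (Equiv x) ys) → N ℕ.* length xs ℕ.≤ length ys
    permuted-≤ {m} {N} {σ} σ-inj {xs} {ys} og d complete = pigeonhole-≤ Equiv-sym Equiv-trans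
      (λ i → lookup xs (code i) ∘ (τ i ⟨$⟩ʳ_)) ys
      (λ i → complete (Equiv-∘ (gen (og′ i)) (τ i ⟨$⟩ʳ_) (⟨$⟩ʳ-injective (τ i))))
      (λ {i} {j} e → remQuot-injective {N} r
        (σ-inj (permuted-same-permutation (og′ i) (og′ j) (τ i) (τ j) e))
        (lookup-injective Equiv-sym Equiv-trans d (permuted-Equiv (og′ i) (og′ j) (τ i) (τ j) e)))
      where
      r = length xs
      code : Fin (N ℕ.* r) → Fin r
      code i = proj₂ (remQuot {N} r i)
      τ : Fin (N ℕ.* r) → Permutation′ m
      τ i = σ (proj₁ (remQuot {N} r i))
      og′ : ∀ i → OrderedGenericℚ (lookup xs (code i))
      og′ i = All.lookup og (∈-lookup {xs = xs} (code i))

  !*reps≤allReps : ∀ n → suc n ! ℕ.* length (reps n) ℕ.≤ length (allReps n)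
  !*reps≤allReps n = permuted-≤ {σ = permutation (suc n)} (permutation-injective (suc n))
    reps-OG reps-distinct allReps-complete

-- Adding a point to the left of a configuration

module LeftExtensions where

  open import Data.Rational.Base
  open import Data.Rational.Properties
  open Signs
  open Arrangements
  open Points
  open Patterns

  private variable
    m n : ℕ

  -- When a coordinate t is added to the left of x, the order of the midpoints
  -- changes exactly when t passes some x i + x j - x k.

  Triple : ℕ → Set
  Triple m = Fin m × Fin m × Fin m

  Sorted : Triple m → Set
  Sorted (i , j , k) = i Fin.< j × j Fin.< k

  val : Vector ℚ m → Triple m → ℚ
  val x (i , j , k) = (x i + x j) - x k

  unit-≡ : ∀ (i : Fin m) → unit i i ≡ 1ℚ
  unit-≡ zero    = refl
  unit-≡ (suc i) = unit-≡ i

  unit-≢ : ∀ {i j : Fin m} → i ≢ j → unit i j ≡ 0ℚ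
  unit-≢ {i = zero}  {zero}  i≢j = contradiction refl i≢j
  unit-≢ {i = zero}  {suc j} i≢j = refl
  unit-≢ {i = suc i} {zero}  i≢j = refl
  unit-≢ {i = suc i} {suc j} i≢j = unit-≢ (i≢j ∘ cong suc)

  0≤unit : ∀ (i j : Fin m) → 0ℚ ≤ unit i j
  0≤unit i j with i Fin.≟ j
  ... | yes refl = subst (0ℚ ≤_) (sym (unit-≡ i)) (nonNegative⁻¹ 1ℚ)
  ... | no  i≢j  = subst (0ℚ ≤_) (sym (unit-≢ i≢j)) ≤-refl

  private
    val-by : ∀ {p q r p′ q′ r′ : ℚ} → p ≡ p′ → q ≡ q′ → r ≡ r′ → (p + q) - r ≡ (p′ + q′) - r′
    val-by refl refl refl = refl

  -- As a linear form, x i + x j - x k with i < j < k has coefficient -1 only at k and 1 exactly at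
  -- i and j. Its values at the unit vectors therefore recover k first, then i and j.
  val-injective : ∀ {S T : Triple m} → Sorted S → Sorted T →
      (∀ a → val (unit a) S ≡ val (unit a) T) → S ≡ T
  val-injective {m} {i , j , k} {i′ , j′ , k′} (i<j , j<k) (i′<j′ , j′<k′) eq =
    cong₂ _,_ (sym i′≡i) (cong₂ _,_ (sym j′≡j) (sym k′≡k))
    where
    i<k = Fin.<-trans i<j j<k
    k′≡k : k′ ≡ k
    k′≡k with k′ Fin.≟ k
    ... | yes p = p
    ... | no k′≢k = contradiction (begin-strict
      0ℚ                 ≤⟨ +-mono-≤ (0≤unit k i′) (0≤unit k j′) ⟩
      unit k i′ + unit k j′ ≡⟨ +-identityʳ _ ⟨
      unit k i′ + unit k j′ - 0ℚ ≡⟨ cong (λ u → unit k i′ + unit k j′ - u) (unit-≢ (≢-sym k′≢k)) ⟨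
      val (unit k) (i′ , j′ , k′) ≡⟨ eq k ⟨
      val (unit k) (i , j , k) ≡⟨ val-by (unit-≢ (≢-sym (Fin.<⇒≢ i<k)))
          (unit-≢ (≢-sym (Fin.<⇒≢ j<k))) (unit-≡ k) ⟩
      0ℚ + 0ℚ - 1ℚ       <⟨ negative⁻¹ (0ℚ + 0ℚ - 1ℚ) ⟩
      0ℚ ∎) (<-irrefl refl)
      where open ≤-Reasoning
    one-of : ∀ {a} → a ≢ k → val (unit a) (i , j , k) ≡ 1ℚ → i′ ≢ a → j′ ≢ a → 0ℚ ≡ 1ℚ
    one-of {a} a≢k val≡1 i′≢a j′≢a = trans
      (sym (val-by (unit-≢ (≢-sym i′≢a)) (unit-≢ (≢-sym j′≢a))
          (unit-≢ (λ a≡k′ → a≢k (trans a≡k′ k′≡k)))))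
      (trans (sym (eq a)) val≡1)
    at-i : val (unit i) (i , j , k) ≡ 1ℚ
    at-i = val-by (unit-≡ i) (unit-≢ (Fin.<⇒≢ i<j)) (unit-≢ (Fin.<⇒≢ i<k))
    at-j : val (unit j) (i , j , k) ≡ 1ℚ
    at-j = val-by (unit-≢ (≢-sym (Fin.<⇒≢ i<j))) (unit-≡ j) (unit-≢ (Fin.<⇒≢ j<k))
    i′≡i : i′ ≡ i
    i′≡i with i′ Fin.≟ i | j′ Fin.≟ i
    ... | yes p | _ = p
    ... | no i′≢i | no j′≢i = contradiction (one-of (Fin.<⇒≢ i<k) at-i i′≢i j′≢i) λ ()
    ... | no i′≢i | yes refl with i′ Fin.≟ j
    ...   | yes refl = contradiction i′<j′ (Fin.<-asym i<j)
    ...   | no i′≢j = contradiction (one-of (Fin.<⇒≢ j<k) at-j i′≢j (Fin.<⇒≢ i<j)) λ ()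
    j′≡j : j′ ≡ j
    j′≡j with j′ Fin.≟ j
    ... | yes p = p
    ... | no j′≢j = contradiction (one-of (Fin.<⇒≢ j<k) at-j
        (λ i′≡j → Fin.<⇒≢ i<j (trans (sym i′≡i) i′≡j)) j′≢j) λ ()

  -- A difference of two values is a sum of three gaps, hence invariant under translation and a form
  -- in the n centred coordinates.
  diffForm : Triple (suc n) → Triple (suc n) → Vector ℚ n
  diffForm (i , j , k) (i′ , j′ , k′) a =
    1ℚ * (1ℚ * gapForm k i a + 1ℚ * gapForm i′ j a) + 1ℚ * gapForm j′ k′ a

  dot-diffForm : ∀ S T (z : Vector ℚ n) → dot (diffForm S T) z ≡ val (origin∷ z) S - val (origin∷ z) T
  dot-diffForm (i , j , k) (i′ , j′ , k′) z = trans
    (dot-linearˡ 1ℚ (λ a → 1ℚ * gapForm k i a + 1ℚ * gapForm i′ j a) 1ℚ (gapForm j′ k′) z)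
    (trans (cong₂ (λ a b → 1ℚ * a + 1ℚ * b)
      (trans (dot-linearˡ 1ℚ (gapForm k i) 1ℚ (gapForm i′ j) z)
        (cong₂ (λ a b → 1ℚ * a + 1ℚ * b) (dot-gapForm k i z) (dot-gapForm i′ j z)))
      (dot-gapForm j′ k′ z))
    (solve 6 (λ i j k i′ j′ k′ → con 1ℚ :* (con 1ℚ :* (i :- k) :+ con 1ℚ :* (j :- i′)) :+ con 1ℚ
        :* (k′ :- j′)
       := ((i :+ j) :- k) :- ((i′ :+ j′) :- k′)) refl (x i) (x j) (x k) (x i′) (x j′) (x k′)))
    where x = origin∷ z

  val-shift : ∀ {x w : Vector ℚ m} c → (∀ i → w i ≡ x i - c) → ∀ T → val w T ≡ val x T - c
  val-shift {x = x} c w≡ (i , j , k) = trans (val-by (w≡ i) (w≡ j) (w≡ k))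
    (solve 4 (λ a b d c → ((a :- c) :+ (b :- c)) :- (d :- c) := ((a :+ b) :- d) :- c) refl (x i)
        (x j) (x k) c)

  centre : Vector ℚ (suc n) → Vector ℚ n
  centre x i = x (suc i) - x zero

  origin∷centre : ∀ (x : Vector ℚ (suc n)) i → origin∷ (centre x) i ≡ x i - x zero
  origin∷centre x zero    = sym (+-inverseʳ (x zero))
  origin∷centre x (suc i) = refl

  diffForm≢0 : ∀ {S T : Triple (suc n)} → Sorted S → Sorted T → S ≢ T → ∃[ a ] diffForm S T a ≢ 0ℚ
  diffForm≢0 {S = S} {T} sS sT S≢T with zero-form? (diffForm S T)
  ... | inj₂ ≢0 = ≢0
  ... | inj₁ ≡0 = contradiction (val-injective sS sT λ a → begin
    val (unit a) S
      ≡⟨ solve 3 (λ s t c → s := ((s :- c) :- (t :- c)) :+ t) refl (val (unit a) S)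
          (val (unit a) T) (unit a zero) ⟩
    ((val (unit a) S - unit a zero) - (val (unit a) T - unit a zero)) + val (unit a) T
      ≡⟨ cong (_+ val (unit a) T) (cong₂ _-_ (sh a S) (sh a T)) ⟨
    (val (origin∷ (centre (unit a))) S - val (origin∷ (centre (unit a))) T) + val (unit a) T
      ≡⟨ cong (_+ val (unit a) T) (dot-diffForm S T (centre (unit a))) ⟨
    dot (diffForm S T) (centre (unit a)) + val (unit a) T
      ≡⟨ cong (_+ val (unit a) T) (dot-zeroˡ ≡0 (centre (unit a))) ⟩
    0ℚ + val (unit a) T
      ≡⟨ +-identityˡ _ ⟩
    val (unit a) T ∎) S≢T
    where
    open ≡-Reasoning
    sh : ∀ a T → val (origin∷ (centre (unit a))) T ≡ val (unit a) T - unit a zero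
    sh a = val-shift {x = unit a} (unit a zero) (origin∷centre (unit a))

  -- A form g vanishing at w takes the value g i at K w + `unit i`, while a large K preserves the
  -- chamber of L and keeps the forms already treated nonzero.
  avoid : ∀ {d} (L : List (Vector ℚ d)) {z} → Generic L z → ∀ {G : List (Vector ℚ d)} →
    All (λ g → ∃[ i ] g i ≢ 0ℚ) G → ∃[ w ] (L ⊢ z ≈ w × Generic G w)
  avoid L {z} gen [] = z , ≈-refl gen , []
  avoid L gen {g ∷ G} ((i , gᵢ≢0) ∷ ≢0) with avoid L gen ≢0
  ... | w , z≈w , genG with dot g w ≟ 0ℚ
  ...   | no g≢0 = w , z≈w , g≢0 ∷ genG
  ...   | yes g≡0 with perturb L w (unit i) | perturb G w (unit i)
  ...     | K₁ , p₁ | K₂ , p₂ = (λ j → K * w j + 1ℚ * unit i j)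
    , ≈-trans z≈w (p₁ (≈-generic (≈-sym z≈w)) K (p≤p⊔q K₁ K₂))
    , subst (_≢ 0ℚ) (sym eq) gᵢ≢0
    ∷ ≈-generic (≈-sym (p₂ genG K (p≤q⊔p K₁ K₂)))
    where
    K = K₁ ⊔ K₂
    eq : dot g (λ j → K * w j + 1ℚ * unit i j) ≡ g i
    eq = trans (dot-linear g K w 1ℚ (unit i)) (trans
      (cong₂ (λ a b → K * a + 1ℚ * b) g≡0 (dot-unitʳ g i))
      (solve 2 (λ K a → K :* con 0ℚ :+ con 1ℚ :* a := a) refl K (g i)))

  record Separated (x : Vector ℚ m) : Set where
    constructor mkSeparated
    field separate : ∀ {S T} → Sorted S → Sorted T → S ≢ T → val x S ≢ val x T

  open Separated

  -- Two values may involve six different indices, so genericity, which only compares midpoints,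
  -- does not keep them apart. They are separated by moving x inside its chamber.
  separated-rep : ∀ {x : Vector ℚ (suc n)} → Equiv x x → ∃[ w ] (Equiv x w × Separated w)
  separated-rep {n} {x} e = origin∷ w , Equiv-trans x~z (≈⇒Equiv z≈w) , mkSeparated λ {S} {T} sS
      sT S≢T vS≡vT →
    All.lookup avoided (∈-concat⁺′ (∈-map⁺ (diffForm S) (∈-filter⁺ (λ U → ¬? (S ≟₃ U)) (∈T sT) S≢T))
                               (∈-map⁺ row (∈T sS)))
      (trans (dot-diffForm S T w) (trans (cong (_- val (origin∷ w) T) vS≡vT)
          (+-inverseʳ (val (origin∷ w) T))))
    where
    _≟₃_ : (S T : Triple (suc n)) → Dec (S ≡ T)
    _≟₃_ = ≡-dec Fin._≟_ (≡-dec Fin._≟_ Fin._≟_)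
    Ts = triples (suc n)
    row : Triple (suc n) → List (Vector ℚ n)
    row S = List.map (diffForm S) (List.filter (λ U → ¬? (S ≟₃ U)) Ts)
    ∈T : ∀ {S} → Sorted S → S ∈ Ts
    ∈T (p , q) = ∈-triples p q
    z = centre x
    x~z : Equiv x (origin∷ z)
    x~z = Equiv-shift (x zero) (origin∷centre x) e
    G≢0 : All (λ g → ∃[ i ] g i ≢ 0ℚ) (List.concat (List.map row Ts))
    G≢0 = All.concat⁺ (All.map⁺ (All.map (λ {S} sS → All.map⁺
        (All.zipWith (λ (S≢T , sT) → diffForm≢0 sS sT S≢T)
      (All.all-filter (λ U → ¬? (S ≟₃ U)) Ts , All.filter⁺ (λ U → ¬? (S ≟₃ U))
          (triples-< (suc n))))) (triples-< (suc n))))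
    av = avoid (forms n) (≈-generic (Equiv⇒≈ (Equiv-trans (Equiv-sym x~z) x~z))) G≢0
    w = proj₁ av
    z≈w = proj₁ (proj₂ av)
    avoided = proj₂ (proj₂ av)

  extend-OG : ∀ {x : Vector ℚ (suc n)} {t} → OrderedGenericℚ x → t < x zero →
    (∀ T → t ≢ val x T) → OrderedGenericℚ (t Vector.∷ x)
  extend-OG {n} {x} {t} (mkOG inc e) t<x₀ t∉ = mkOG inc′ (mkEquiv (increasing-gaps inc′ inc′) qs)
    where
    y = t Vector.∷ x
    inc′ : Increasingℚ y
    inc′ zero    (suc zero)    _   = t<x₀
    inc′ zero    (suc (suc j)) _   = <-trans t<x₀ (inc zero (suc j) ℕ.z<s)
    inc′ (suc i) (suc j)       i<j = inc i j (ℕ.s<s⁻¹ i<j)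
    qs : ∀ {i j k l} → i Fin.< j → k Fin.< l → i Fin.< k → j ≢ k → j ≢ l →
      SameSign (quad y i j k l) (quad y i j k l)
    qs {suc i} {suc j} {suc k} {suc l} i<j k<l i<k j≢k j≢l =
      quads e (ℕ.s<s⁻¹ i<j) (ℕ.s<s⁻¹ k<l) (ℕ.s<s⁻¹ i<k) (j≢k ∘ cong suc) (j≢l ∘ cong suc)
    qs {zero} {suc j} {suc k} {suc l} _ _ _ _ _ = ≢0⇒ss λ eq → t∉ (k , l , j) (begin
      t                                     ≡⟨ solve 4
          (λ t j k l → t := ((t :+ j) :- (k :+ l)) :+ ((k :+ l) :- j)) refl t (x j) (x k) (x l) ⟩
      quad y zero (suc j) (suc k) (suc l) + val x (k , l , j) ≡⟨ cong (_+ val x (k , l , j)) eq ⟩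
      0ℚ + val x (k , l , j)                ≡⟨ +-identityˡ _ ⟩
      val x (k , l , j)                     ∎)
      where open ≡-Reasoning

  -- The sign comparing the midpoint of the new point and x k with that of x i and x j changes when
  -- the new point passes the value of the triple.
  extend-separated : ∀ {x : Vector ℚ m} {s t} T → Sorted T → s < val x T → val x T < t →
    ¬ Equiv (s Vector.∷ x) (t Vector.∷ x)
  extend-separated {x = x} {s} {t} (i , j , k) (i<j , j<k) s<v v<t e
    with quads e {zero} {suc k} {suc i} {suc j} ℕ.z<s (ℕ.s<s i<j) ℕ.z<s
      (≢-sym (Fin.<⇒≢ (Fin.<-trans i<j j<k)) ∘ Fin.suc-injective)
          (≢-sym (Fin.<⇒≢ j<k) ∘ Fin.suc-injective)
  ... | inj₁ (0<q , _) = <-asym s<v (<-by 0<q (eq s (x i) (x j) (x k)))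
    where
    eq : ∀ s i j k → s ≡ ((i + j) - k) + ((s + k) - (i + j))
    eq = solve 4 (λ s i j k → s := ((i :+ j) :- k) :+ ((s :+ k) :- (i :+ j))) refl
  ... | inj₂ (_ , q<0) = <-asym v<t (<-by (neg⁺ q<0) (eq t (x i) (x j) (x k)))
    where
    eq : ∀ t i j k → (i + j) - k ≡ t + - ((t + k) - (i + j))
    eq = solve 4 (λ t i j k → (i :+ j) :- k := t :+ :- ((t :+ k) :- (i :+ j))) refl

  minPositive : ∀ ds → ∃[ ε ] (0ℚ < ε × All (λ d → 0ℚ < d → ε < d) ds)
  minPositive [] = 1ℚ , positive⁻¹ 1ℚ , []
  minPositive (d ∷ ds) with minPositive ds | 0ℚ <? d
  ... | ε , 0<ε , ε< | no ¬0<d = ε , 0<ε , (λ 0<d → contradiction 0<d ¬0<d) ∷ ε<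
  ... | ε , 0<ε , ε< | yes 0<d with <-cmp ε d
  ...   | tri< ε<d _ _ = ε , 0<ε , (λ _ → ε<d) ∷ ε<
  ...   | tri≈ _ refl _ = let δ , 0<δ , δ<d = <-dense 0<d in
            δ , 0<δ , (λ _ → δ<d) ∷ All.map (λ f 0<d′ → <-trans δ<d (f 0<d′)) ε<
  ...   | tri> _ _ d<ε = let δ , 0<δ , δ<d = <-dense 0<d in
            δ , 0<δ , (λ _ → δ<d) ∷ All.map (λ f 0<d′ → <-trans (<-trans δ<d d<ε) (f 0<d′)) ε<

  -- ε is chosen below every positive difference of listed numbers, so v - ε falls strictly between
  -- v and the preceding number.
  resolution : ∀ vs → ∃[ ε ] (0ℚ < ε × (∀ {u v} → u ∈ vs → v ∈ vs → u < v → u < v - ε))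
  resolution vs with minPositive (cartesianProductWith (λ u v → v - u) vs vs)
  ... | ε , 0<ε , ε< = ε , 0<ε , λ {u} {v} u∈ v∈ u<v →
    0<p-q⇒q<p (subst (0ℚ <_) (solve 3 (λ u v ε → (v :- u) :- ε := (v :- ε) :- u) refl u v ε)
      (p<q⇒0<q-p (All.lookup ε< (∈-cartesianProductWith⁺ (λ u v → v - u) u∈ v∈) (p<q⇒0<q-p u<v))))

  Critical : Vector ℚ (suc n) → Triple (suc n) → Set
  Critical x (i , j , k) = Sorted (i , j , k) × val x (i , j , k) < x zero

  -- Allows x to be replaced by a separated representative of its chamber. For i = 0 the bound
  -- follows from y j < y k alone; otherwise it is the sign of one quad.
  Critical-Equiv : ∀ {x y : Vector ℚ (suc n)} → Increasingℚ y → Equiv x y → ∀ {T} → Critical x T →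
      Critical y T
  Critical-Equiv {y = y} inc e {zero , j , k} (s@(i<j , j<k) , _) = s , <-by (p<q⇒0<q-p (inc j k j<k))
    (solve 3 (λ o j k → o := ((o :+ j) :- k) :+ (k :- j)) refl (y zero) (y j) (y k))
  Critical-Equiv {x = x} {y} inc e {suc i , j , k} (s@(i<j , j<k) , v<)
    with quads e {zero} {k} {suc i} {j} (ℕ.<-trans ℕ.z<s (ℕ.<-trans i<j j<k)) i<j ℕ.z<s
      (≢-sym (Fin.<⇒≢ (Fin.<-trans i<j j<k))) (≢-sym (Fin.<⇒≢ j<k))
  ... | inj₁ (_ , 0<q) = s , <-by 0<q
    (solve 4 (λ o i j k → o := ((i :+ j) :- k) :+ ((o :+ k) :- (i :+ j))) refl (y zero)
        (y (suc i)) (y j) (y k))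
  ... | inj₂ (q<0 , _) = contradiction v< (<-asym (<-by (neg⁺ q<0)
    (solve 4 (λ o i j k → (i :+ j) :- k := o :+ (:- ((o :+ k) :- (i :+ j)))) refl (x zero)
        (x (suc i)) (x j) (x k))))

  -- The field `restrict` says that deleting the new point gives back the class of x, which keeps
  -- extensions of inequivalent configurations apart.
  record Extensions (x : Vector ℚ (suc n)) (c : ℕ) : Set where
    field
      points   : List (Vector ℚ (suc (suc n)))
      count    : length points ≡ c
      isOG     : All OrderedGenericℚ points
      restrict : All (λ y → Equiv x (y ∘ suc)) points
      distinct : AllPairs (λ y z → ¬ Equiv y z) points

  private
    module Extend {w : Vector ℚ (suc n)} (ogw : OrderedGenericℚ w) (separated : Separated w)
      (vals : List ℚ) (val∈ : ∀ T → val w T ∈ vals) (x₀∈ : w zero ∈ vals)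
      {ε} (0<ε : 0ℚ < ε) (fine : ∀ {u v} → u ∈ vals → v ∈ vals → u < v → u < v - ε) where

      below : ∀ v → v - ε < v
      below v = <-by 0<ε (solve 2 (λ v ε → v := (v :- ε) :+ ε) refl v ε)

      insertBelow : ℚ → Vector ℚ (suc (suc n))
      insertBelow v = (v - ε) Vector.∷ w

      insertBelow-OG : ∀ {v} → v ∈ vals → v ≤ w zero → OrderedGenericℚ (insertBelow v)
      insertBelow-OG {v} v∈ v≤ = extend-OG ogw (<-≤-trans (below v) v≤)
        -- If v - ε were itself a value, it would be a listed number below v and thus strictly below
        -- v - ε.
        λ T v-ε≡ → <-irrefl (sym v-ε≡) (fine (val∈ T) v∈ (subst (_< v) v-ε≡ (below v)))

      separate-< : ∀ {v} → v ∈ vals → ∀ T → Sorted T → val w T < v →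
        ¬ Equiv (insertBelow (val w T)) (insertBelow v)
      separate-< v∈ T sT T<v = extend-separated T sT (below (val w T)) (fine (val∈ T) v∈ T<v)

      separate-≢ : ∀ S T → Sorted S → Sorted T → S ≢ T →
        ¬ Equiv (insertBelow (val w S)) (insertBelow (val w T))
      separate-≢ S T sS sT S≢T e with <-cmp (val w S) (val w T)
      ... | tri< S<T _ _ = separate-< (val∈ T) S sS S<T e
      ... | tri≈ _ S≡T _ = separate separated sS sT S≢T S≡T
      ... | tri> _ _ T<S = separate-< (val∈ S) T sT T<S (Equiv-sym e)

      distinct : ∀ {Ts} → All (Critical w) Ts → Unique Ts →
        AllPairs (λ S T → ¬ Equiv (insertBelow (val w S)) (insertBelow (val w T))) Ts
      distinct [] [] = []
      distinct {S ∷ _} (cS ∷ cs) (S∉ ∷ u) =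
        All.zipWith (λ {T} (cT , S≢T) → separate-≢ S T (proj₁ cS) (proj₁ cT) S≢T) (cs , S∉) ∷
            distinct cs u

      -- The new point goes just left of the first coordinate, above all critical values, or just
      -- below one of the critical values; the first placement accounts for the successor.
      result : ∀ {x Ts} → Equiv x w → Unique Ts → All (Critical w) Ts → Extensions x (suc (length Ts))
      result {Ts = Ts} x~w unique critical = record
        { points   = insertBelow (w zero) ∷ List.map (λ T → insertBelow (val w T)) Ts
        ; count    = cong suc (List.length-map (λ T → insertBelow (val w T)) Ts)
        ; isOG     = insertBelow-OG x₀∈ ≤-refl
                     ∷ All.map⁺ (All.map (λ {T} c → insertBelow-OG (val∈ T) (<⇒≤ (proj₂ c))) critical)
        ; restrict = x~w ∷ All.map⁺ (All.universal (λ _ → x~w) Ts)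
        ; distinct = All.map⁺ (All.map (λ {T} c e → separate-< x₀∈ T (proj₁ c) (proj₂ c)
            (Equiv-sym e)) critical)
                     ∷ AllPairs.map⁺ (distinct critical unique)
        }

  opaque

    -- All triples are taken, sorted or not: `extend-OG` asks the new point to avoid each of them,
    -- and the triples (i , i , i) contribute the coordinates.
    values : Vector ℚ m → List ℚ
    values {m} x = cartesianProductWith (λ a (b , c) → val x (a , b , c)) (allFin m)
      (cartesianProduct (allFin m) (allFin m))

    val∈values : ∀ (x : Vector ℚ m) T → val x T ∈ values x
    val∈values x (i , j , k) = ∈-cartesianProductWith⁺ (λ a (b , c) → val x (a , b , c)) (∈-allFin i)
      (∈-cartesianProduct⁺ (∈-allFin j) (∈-allFin k))

  coordinate∈values : ∀ (x : Vector ℚ m) i → x i ∈ values x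
  coordinate∈values x i = subst (_∈ values x)
    (solve 1 (λ a → (a :+ a) :- a := a) refl (x i)) (val∈values x (i , i , i))

  extensions : ∀ {x : Vector ℚ (suc n)} → OrderedGenericℚ x →
    ∀ {Ts} → Unique Ts → All (Critical x) Ts → Extensions x (suc (length Ts))
  extensions {n} {x} (mkOG inc e) {Ts} unique critical = go (separated-rep e)
    where
    go : ∃[ w ] (Equiv x w × Separated w) → Extensions x (suc (length Ts))
    go (w , x~w , sep) = go′ (resolution (values w))
      where
      incw = Equiv-increasing x~w inc
      go′ : ∃[ ε ] (0ℚ < ε × (∀ {u v} → u ∈ values w → v ∈ values w → u < v → u < v - ε)) →
        Extensions x (suc (length Ts))
      go′ (ε , 0<ε , fine) = Extend.result (mkOG incw (Equiv-trans (Equiv-sym x~w) x~w)) sep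
        (values w) (val∈values w) (coordinate∈values w zero) 0<ε fine x~w unique
        (All.map (λ {T} → Critical-Equiv incw x~w {T}) critical)

-- Reflection, the recurrence and the lower bound

module Recurrence where

  open import Data.Rational.Base
  open import Data.Rational.Properties
  open import Data.Nat.Combinatorics using (_C_)
  open import Data.Nat.ListAction using (sum)
  open Signs
  open Arrangements using (unit)
  open Estimates using (C-closed-2)
  open Points
  open Patterns
  open LeftExtensions

  private variable
    m n : ℕ

  opposite-< : ∀ {i j : Fin m} → i Fin.< j → opposite j Fin.< opposite i
  opposite-< {m} {i} {j} i<j = subst₂ ℕ._<_ (sym (Fin.opposite-prop j)) (sym (Fin.opposite-prop i))
    (ℕ.∸-monoʳ-< (ℕ.s<s i<j) (Fin.toℕ<n j))

  -- Negation reverses the order, and reversing the indices makes the coordinates increasing again.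
  mirror : Vector ℚ m → Vector ℚ m
  mirror x i = - x (opposite i)

  mirror-opposite : ∀ (x : Vector ℚ m) i → mirror x (opposite i) ≡ - x i
  mirror-opposite x i = cong (λ j → - x j) (Fin.opposite-involutive i)

  mirror-Equiv : ∀ {x y : Vector ℚ m} → Equiv x y → Equiv (mirror x) (mirror y)
  mirror-Equiv {x = x} {y} e = mkEquiv
    (λ {i} {j} p → subst₂ SameSign (neg² (x (opposite j)) (x (opposite i)))
        (neg² (y (opposite j)) (y (opposite i)))
      (ss-neg (gaps e′ p)))
    (λ {i} {j} {k} {l} p q r s t → subst₂ SameSign
      (neg⁴ (x (opposite i)) (x (opposite j)) (x (opposite k)) (x (opposite l)))
      (neg⁴ (y (opposite i)) (y (opposite j)) (y (opposite k)) (y (opposite l)))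
      (ss-neg (quads e′ p q r s t)))
    where
    e′ : Equiv (x ∘ opposite) (y ∘ opposite)
    e′ = Equiv-∘ e opposite (λ {i} {j} eq → trans (sym (Fin.opposite-involutive i))
      (trans (cong opposite eq) (Fin.opposite-involutive j)))
    neg² : ∀ a b → - (a - b) ≡ - a - - b
    neg² = solve 2 (λ a b → :- (a :- b) := :- a :- (:- b)) refl
    neg⁴ : ∀ a b c d → - ((a + b) - (c + d)) ≡ (- a + - b) - (- c + - d)
    neg⁴ = solve 4 (λ a b c d → :- ((a :+ b) :- (c :+ d)) := (:- a :+ :- b) :- (:- c :+ :- d)) refl

  mirror-OG : ∀ {x : Vector ℚ m} → OrderedGenericℚ x → OrderedGenericℚ (mirror x)
  mirror-OG (mkOG inc e) = mkOG
    (λ i j i<j → neg-antimono-< (inc (opposite j) (opposite i) (opposite-< i<j))) (mirror-Equiv e)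

  mirror-involutive : ∀ {x : Vector ℚ m} → Equiv x x → Equiv x (mirror (mirror x))
  mirror-involutive {x = x} = Equiv-shift 0ℚ λ i → trans
    (cong (λ j → - - x j) (Fin.opposite-involutive i))
    (solve 1 (λ a → :- (:- a) := a :- con 0ℚ) refl (x i))

  mirror-reflects : ∀ {x y : Vector ℚ m} → Equiv x x → Equiv y y → Equiv (mirror x) (mirror y) →
      Equiv x y
  mirror-reflects ex ey e = Equiv-trans (mirror-involutive ex)
    (Equiv-trans (mirror-Equiv e) (Equiv-sym (mirror-involutive ey)))

  pairs-unique : ∀ m → Unique (pairs m)
  pairs-unique zero    = []
  pairs-unique (suc m) = Unique.++⁺
    (Unique.map⁺ (Fin.suc-injective ∘ ,-injectiveʳ) (Unique.allFin⁺ m))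
    (Unique.map⁺ (λ eq → cong₂ _,_ (Fin.suc-injective (,-injectiveˡ eq))
        (Fin.suc-injective (,-injectiveʳ eq)))
      (pairs-unique m))
    disjoint
    where
    disjoint : ∀ {p} → ¬ (p ∈ List.map (λ j → zero , suc j) (allFin m)
      × p ∈ List.map (λ (i , j) → suc i , suc j) (pairs m))
    disjoint (p∈ , p∈′) with ∈-map⁻ _ p∈ | ∈-map⁻ _ p∈′
    ... | _ , _ , refl | _ , _ , ()

  -- These triples are critical for every increasing x, because x j < x k puts x 0 + x j - x k below
  -- x 0.
  outer : ∀ k → List (Triple (suc (suc k)))
  outer k = List.map (λ (i , j) → zero , suc i , suc j) (pairs (suc k))

  outer-critical : ∀ {k} {x : Vector ℚ (suc (suc k))} → Increasingℚ x → All (Critical x) (outer k)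
  outer-critical {k} {x} inc = All.map⁺ (All.map (λ {(i , j)} i<j →
    (ℕ.z<s , ℕ.s<s i<j) , <-by (p<q⇒0<q-p (inc (suc i) (suc j) (ℕ.s<s i<j)))
      (solve 3 (λ o j k → o := ((o :+ j) :- k) :+ (k :- j)) refl (x zero) (x (suc i)) (x (suc j))))
    (pairs-< (suc k)))

  inner : ∀ {k} → Fin k → Fin (suc (suc k))
  inner i = suc (inject₁ i)

  inner-injective : ∀ {k} {i j : Fin k} → inner i ≡ inner j → i ≡ j
  inner-injective = Fin.inject₁-injective ∘ Fin.suc-injective

  inner-< : ∀ {k} {i j : Fin k} → i Fin.< j → inner i Fin.< inner j
  inner-< {i = i} {j} i<j = ℕ.s<s (subst₂ ℕ._<_ (sym (Fin.toℕ-inject₁ i)) (sym (Fin.toℕ-inject₁ j)) i<j)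

  -- Written as `opposite zero` because `mirror` exchanges it with zero.
  lastFin : ∀ {k} → Fin (suc (suc k))
  lastFin = opposite zero

  module _ {k} (x : Vector ℚ (suc (suc k))) where

    -- For i < j this makes (`inner i` , `inner j` , `lastFin`) critical for x. The reverse
    -- inequality makes the reflected inner pair, completed by `lastFin`, critical for `mirror x`.
    Low : Fin k × Fin k → Set
    Low (i , j) = x (inner i) + x (inner j) < x zero + x lastFin

    low? : Decidable Low
    low? (i , j) = x (inner i) + x (inner j) <? x zero + x lastFin

    lowTriples : List (Triple (suc (suc k)))
    lowTriples = outer k ++ List.map (λ (i , j) → inner i , inner j , lastFin)
        (List.filter low? (pairs k))

    highTriples : List (Triple (suc (suc k)))
    highTriples = outer k ++ List.map (λ (i , j) → opposite (inner j) , opposite (inner i) , lastFin)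
      (List.filter (¬? ∘ low?) (pairs k))

  inner-<-last : ∀ {k} (i : Fin k) → inner i Fin.< lastFin
  inner-<-last {k} i = ℕ.s<s (subst₂ ℕ._<_ (sym (Fin.toℕ-inject₁ i)) (sym (Fin.toℕ-fromℕ k))
      (Fin.toℕ<n i))

  opposite-inner-<-last : ∀ {k} (i : Fin k) → opposite (inner i) Fin.< lastFin
  opposite-inner-<-last i = opposite-< {i = zero} {inner i} ℕ.z<s

  module _ {k} {x : Vector ℚ (suc (suc k))} (og : OrderedGenericℚ x) where

    lowTriples-critical : All (Critical x) (lowTriples x)
    lowTriples-critical = All.++⁺ (outer-critical (incr og)) (All.map⁺ (All.zipWith
      (λ {(i , j)} (low , i<j) → (inner-< i<j , inner-<-last j) ,
        <-by (p<q⇒0<q-p low) (solve 4 (λ o i j l → o := ((i :+ j) :- l) :+ ((o :+ l) :- (i :+ j))) refl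
          (x zero) (x (inner i)) (x (inner j)) (x lastFin)))
      (All.all-filter (low? x) (pairs k) , All.filter⁺ (low? x) (pairs-< k))))

    -- The four indices are distinct, so genericity rules out equality of the two sums.
    ¬low⇒high : ∀ {i j} → i Fin.< j → ¬ Low x (i , j) →
      x zero + x lastFin < x (inner i) + x (inner j)
    ¬low⇒high {i} {j} i<j ¬low
      with quads (gen og) {zero} {lastFin} {inner i} {inner j} ℕ.z<s (inner-< i<j) ℕ.z<s
        (≢-sym (Fin.<⇒≢ (inner-<-last i))) (≢-sym (Fin.<⇒≢ (inner-<-last j)))
    ... | inj₁ (0<q , _) = contradiction (0<p-q⇒q<p 0<q) ¬low
    ... | inj₂ (q<0 , _) = p-q<0⇒p<q q<0

    highTriples-critical : All (Critical (mirror x)) (highTriples x)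
    highTriples-critical = All.++⁺ (outer-critical (incr (mirror-OG og))) (All.map⁺ (All.zipWith
      (λ {(i , j)} (¬low , i<j) → (opposite-< (inner-< i<j) , opposite-inner-<-last i) ,
        subst (_< mirror x zero)
          (sym (cong₂ _-_ (cong₂ _+_ (mirror-opposite x (inner j)) (mirror-opposite x (inner i)))
                          (mirror-opposite x zero)))
          (<-by (p<q⇒0<q-p (¬low⇒high i<j ¬low))
            (solve 4 (λ o i j l → :- l := ((:- j :+ :- i) :- (:- o)) :+ ((i :+ j) :- (o :+ l))) refl
              (x zero) (x (inner i)) (x (inner j)) (x lastFin))))
      (All.all-filter (¬? ∘ low? x) (pairs k) , All.filter⁺ (¬? ∘ low? x) (pairs-< k))))

    private
      outer-disjoint : ∀ {f : Fin k × Fin k → Triple (suc (suc k))} {ps} →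
        (∀ p → proj₁ (f p) ≢ zero) → ∀ {T} → ¬ (T ∈ outer k × T ∈ List.map f ps)
      outer-disjoint f≢0 (T∈ , T∈′) with ∈-map⁻ _ T∈ | ∈-map⁻ _ T∈′
      ... | _ , _ , refl | p , _ , eq = f≢0 p (sym (cong proj₁ eq))

      outer-unique : Unique (outer k)
      outer-unique = Unique.map⁺
        (λ eq → cong₂ _,_ (Fin.suc-injective (cong (proj₁ ∘ proj₂) eq))
            (Fin.suc-injective (cong (proj₂ ∘ proj₂) eq)))
        (pairs-unique (suc k))

    lowTriples-unique : Unique (lowTriples x)
    lowTriples-unique = Unique.++⁺ outer-unique
      (Unique.map⁺ (λ eq → cong₂ _,_ (inner-injective (cong proj₁ eq))
          (inner-injective (cong (proj₁ ∘ proj₂) eq)))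
        (Unique.filter⁺ (low? x) (pairs-unique k)))
      (outer-disjoint (λ p ()))

    highTriples-unique : Unique (highTriples x)
    highTriples-unique = Unique.++⁺ outer-unique
      (Unique.map⁺ (λ eq → cong₂ _,_ (inner-injective (opp-inj (cong (proj₁ ∘ proj₂) eq)))
                                     (inner-injective (opp-inj (cong proj₁ eq))))
        (Unique.filter⁺ (¬? ∘ low? x) (pairs-unique k)))
      (outer-disjoint (λ (i , j) eq → Fin.<⇒≢ (subst (Fin._< opposite (inner j))
          (Fin.opposite-involutive zero)
        (opposite-< (inner-<-last j))) (sym eq)))
      where
      opp-inj : ∀ {i j : Fin (suc (suc k))} → opposite i ≡ opposite j → i ≡ j
      opp-inj {i} {j} eq = trans (sym (Fin.opposite-involutive i))
        (trans (cong opposite eq) (Fin.opposite-involutive j))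

  length-filter-¬ : ∀ {A : Set} {P : A → Set} (P? : Decidable P) xs →
    length (List.filter P? xs) ℕ.+ length (List.filter (¬? ∘ P?) xs) ≡ length xs
  length-filter-¬ P? [] = refl
  length-filter-¬ P? (x ∷ xs) with P? x
  ... | yes _ = cong suc (length-filter-¬ P? xs)
  ... | no  _ = trans (ℕ.+-suc _ _) (cong suc (length-filter-¬ P? xs))

  length-triples-sum : ∀ {k} (x : Vector ℚ (suc (suc k))) →
    suc (length (lowTriples x)) ℕ.+ suc (length (highTriples x)) ≡ 2 ℕ.+ 2 ℕ.* (suc k C 2) ℕ.+ (k C 2)
  length-triples-sum {k} x = begin
    suc (length (lowTriples x)) ℕ.+ suc (length (highTriples x))
      ≡⟨ cong₂ (λ a b → suc a ℕ.+ suc b) (len _ (List.filter (low? x) (pairs k)))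
           (len _ (List.filter (¬? ∘ low? x) (pairs k))) ⟩
    suc ((suc k C 2) ℕ.+ a) ℕ.+ suc ((suc k C 2) ℕ.+ b)
      ≡⟨ lemma (suc k C 2) a b ⟩
    2 ℕ.+ 2 ℕ.* (suc k C 2) ℕ.+ (a ℕ.+ b)
      ≡⟨ cong (2 ℕ.+ 2 ℕ.* (suc k C 2) ℕ.+_) (trans (length-filter-¬ (low? x) (pairs k))
          (length-pairs k)) ⟩
    2 ℕ.+ 2 ℕ.* (suc k C 2) ℕ.+ (k C 2) ∎
    where
    open ≡-Reasoning
    a = length (List.filter (low? x) (pairs k))
    b = length (List.filter (¬? ∘ low? x) (pairs k))
    lemma : ∀ c a b → suc (c ℕ.+ a) ℕ.+ suc (c ℕ.+ b) ≡ 2 ℕ.+ 2 ℕ.* c ℕ.+ (a ℕ.+ b)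
    lemma = ℕ-Ring.solve-∀
    len : (f : Fin k × Fin k → Triple (suc (suc k))) → ∀ ps →
      length (outer k ++ List.map f ps) ≡ (suc k C 2) ℕ.+ length ps
    len f ps = trans (List.length-++ (outer k)) (cong₂ ℕ._+_
      (trans (List.length-map _ (pairs (suc k))) (length-pairs (suc k))) (List.length-map f ps))

  module _ {A : Set} (point : A → Vector ℚ (suc n)) (c : A → ℕ) where

    -- Deleting the new first point recovers the class of the extended configuration, so the lists
    -- of extensions of inequivalent configurations can be concatenated without repetition.
    extendAll : ∀ {as} → All (λ a → Extensions (point a) (c a)) as →
      AllPairs (λ a b → ¬ Equiv (point a) (point b)) as →
      ∃[ ys ] (length ys ≡ sum (List.map c as) × All OrderedGenericℚ ys
        × All (λ y → Any (λ a → Equiv (point a) (y ∘ suc)) as) ys × AllPairs (λ y z → ¬ Equiv y z) ys)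
    extendAll [] [] = [] , refl , [] , [] , []
    extendAll {a ∷ as} (E ∷ Es) (a≉ ∷ d) with extendAll Es d
    ... | ys , len , og , res , dist = E.points ++ ys
      , trans (List.length-++ E.points) (cong₂ ℕ._+_ E.count len)
      , All.++⁺ E.isOG og
      , All.++⁺ (All.map here E.restrict) (All.map there res)
      , AllPairs.++⁺ E.distinct dist (All.map (λ {y} a~y → All.map
          (λ {z} r e → cross {y} {z} a~y r e) res) E.restrict)
      where
      module E = Extensions E
      cross : ∀ {y z} → Equiv (point a) (y ∘ suc) → Any (λ b → Equiv (point b) (z ∘ suc)) as →
          ¬ Equiv y z
      cross a~y r e with find r
      ... | b , b∈ , b~z = All.lookup a≉ b∈ (Equiv-trans (Equiv-trans a~y
        (Equiv-∘ e suc Fin.suc-injective)) (Equiv-sym b~z))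

    sum-≤-reps : ∀ {as} → All (λ a → Extensions (point a) (c a)) as →
      AllPairs (λ a b → ¬ Equiv (point a) (point b)) as → sum (List.map c as) ℕ.≤ length (reps (suc n))
    sum-≤-reps Es d with extendAll Es d
    ... | ys , len , og , _ , dist = subst (ℕ._≤ length (reps (suc n))) len (distinct-≤-reps dist og)

  sum-constant : ∀ {A : Set} (f g : A → ℕ) {c} → (∀ a → f a ℕ.+ g a ≡ c) → ∀ as →
    sum (List.map f as) ℕ.+ sum (List.map g as) ≡ length as ℕ.* c
  sum-constant f g f+g [] = refl
  sum-constant f g {c} f+g (a ∷ as) = begin
    (f a ℕ.+ F) ℕ.+ (g a ℕ.+ G) ≡⟨ lemma (f a) F (g a) G ⟩
    (f a ℕ.+ g a) ℕ.+ (F ℕ.+ G) ≡⟨ cong₂ ℕ._+_ (f+g a) (sum-constant f g f+g as) ⟩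
    c ℕ.+ length as ℕ.* c       ∎
    where
    open ≡-Reasoning
    F = sum (List.map f as)
    G = sum (List.map g as)
    lemma : ∀ a b c d → (a ℕ.+ b) ℕ.+ (c ℕ.+ d) ≡ (a ℕ.+ c) ℕ.+ (b ℕ.+ d)
    lemma = ℕ-Ring.solve-∀

  -- Extensions of x and of its mirror image are counted together: each pair of
  -- inner coordinates contributes to exactly one of them, according to how
  -- their sum compares with that of the two extreme coordinates.
  reps-recurrence : ∀ k → length (reps (suc k)) ℕ.* (2 ℕ.+ 2 ℕ.* (suc k C 2) ℕ.+ (k C 2))
    ℕ.≤ 2 ℕ.* length (reps (suc (suc k)))
  reps-recurrence k = begin
    length R ℕ.* (2 ℕ.+ 2 ℕ.* (suc k C 2) ℕ.+ (k C 2))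
      ≡⟨ sum-constant low high length-triples-sum R ⟨
    sum (List.map low R) ℕ.+ sum (List.map high R)
      ≤⟨ ℕ.+-mono-≤
          (sum-≤-reps id low
            (All.map (λ og → extensions og (lowTriples-unique og) (lowTriples-critical og)) reps-OG)
            reps-distinct)
          (sum-≤-reps mirror high
            (All.map (λ og → extensions (mirror-OG og) (highTriples-unique og)
                (highTriples-critical og)) reps-OG)
            (mirror-distinct reps-OG reps-distinct)) ⟩
    length (reps (suc (suc k))) ℕ.+ length (reps (suc (suc k)))
      ≡⟨ cong (length (reps (suc (suc k))) ℕ.+_) (ℕ.+-identityʳ _) ⟨
    2 ℕ.* length (reps (suc (suc k))) ∎
    where
    open ℕ.≤-Reasoning
    R = reps (suc k)
    low high : Vector ℚ (suc (suc k)) → ℕ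
    low x  = suc (length (lowTriples x))
    high x = suc (length (highTriples x))
    mirror-distinct : ∀ {xs : List (Vector ℚ (suc (suc k)))} → All OrderedGenericℚ xs →
      AllPairs (λ x y → ¬ Equiv x y) xs → AllPairs (λ x y → ¬ Equiv (mirror x) (mirror y)) xs
    mirror-distinct [] [] = []
    mirror-distinct (ox ∷ os) (x≉ ∷ d) =
      All.zipWith (λ (oy , x≉y) e → x≉y (mirror-reflects (gen ox) (gen oy) e)) (os , x≉)
      ∷ mirror-distinct os d

  1≤reps-1 : 1 ℕ.≤ length (reps 1)
  1≤reps-1 = distinct-≤-reps {xs = x ∷ []} ([] ∷ [])
      (mkOG inc (mkEquiv (increasing-gaps inc inc) qs) ∷ [])
    where
    x : Vector ℚ 2
    x = unit (suc zero)
    inc : Increasingℚ x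
    inc zero (suc zero) _ = positive⁻¹ 1ℚ
    inc (suc zero) (suc zero) (ℕ.s≤s ())
    qs : ∀ {i j k l} → i Fin.< j → k Fin.< l → i Fin.< k → j ≢ k → j ≢ l →
        SameSign (quad x i j k l) (quad x i j k l)
    qs {k = suc zero} {suc zero} _ (ℕ.s≤s ()) _ _ _

  -- Starting from two points, the recurrence has the factors 2 and 4 for k = 0 and k = 1; after
  -- halving they give at least one pattern for three points and two for four.
  2≤reps-3 : 2 ℕ.≤ length (reps 3)
  2≤reps-3 = ℕ.*-cancelˡ-≤ 2 (ℕ.≤-trans (ℕ.*-monoˡ-≤ 4 1≤reps-2) (reps-recurrence 1))
    where
    1≤reps-2 : 1 ℕ.≤ length (reps 2)
    1≤reps-2 = ℕ.*-cancelˡ-≤ 2 (ℕ.≤-trans (ℕ.*-monoˡ-≤ 2 1≤reps-1) (reps-recurrence 0))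

  -- For m = j + 4, the doubled factor 4 + 2 (m - 1) (m - 2) + (m - 2) (m - 3) of the recurrence
  -- exceeds 3 (m - 2)^2 by j + 6; this is where 3/4 comes from.
  reps-step : ∀ j → 3 ℕ.* ((2 ℕ.+ j) ℕ.* (2 ℕ.+ j)) ℕ.* length (reps (3 ℕ.+ j)) ℕ.≤ 4 ℕ.* length
      (reps (4 ℕ.+ j))
  reps-step j = begin
    3 ℕ.* ((2 ℕ.+ j) ℕ.* (2 ℕ.+ j)) ℕ.* r
      ≤⟨ ℕ.m≤m+n _ ((6 ℕ.+ j) ℕ.* r) ⟩
    3 ℕ.* ((2 ℕ.+ j) ℕ.* (2 ℕ.+ j)) ℕ.* r ℕ.+ (6 ℕ.+ j) ℕ.* r
      ≡⟨ lemma₁ j r ⟩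
    r ℕ.* (4 ℕ.+ 2 ℕ.* ((3 ℕ.+ j) ℕ.* (2 ℕ.+ j)) ℕ.+ (2 ℕ.+ j) ℕ.* (1 ℕ.+ j))
      ≡⟨ cong₂ (λ a b → r ℕ.* (4 ℕ.+ 2 ℕ.* a ℕ.+ b)) (C-closed-2 (suc j)) (C-closed-2 j) ⟨
    r ℕ.* (4 ℕ.+ 2 ℕ.* (2 ℕ.* ((3 ℕ.+ j) C 2)) ℕ.+ 2 ℕ.* ((2 ℕ.+ j) C 2))
      ≡⟨ lemma₂ r ((3 ℕ.+ j) C 2) ((2 ℕ.+ j) C 2) ⟩
    2 ℕ.* (r ℕ.* (2 ℕ.+ 2 ℕ.* ((3 ℕ.+ j) C 2) ℕ.+ ((2 ℕ.+ j) C 2)))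
      ≤⟨ ℕ.*-monoʳ-≤ 2 (reps-recurrence (2 ℕ.+ j)) ⟩
    2 ℕ.* (2 ℕ.* length (reps (4 ℕ.+ j)))
      ≡⟨ ℕ.*-assoc 2 2 (length (reps (4 ℕ.+ j))) ⟨
    4 ℕ.* length (reps (4 ℕ.+ j)) ∎
    where
    open ℕ.≤-Reasoning
    r = length (reps (3 ℕ.+ j))
    lemma₁ : ∀ j r → 3 ℕ.* ((2 ℕ.+ j) ℕ.* (2 ℕ.+ j)) ℕ.* r ℕ.+ (6 ℕ.+ j) ℕ.* r
      ≡ r ℕ.* (4 ℕ.+ 2 ℕ.* ((3 ℕ.+ j) ℕ.* (2 ℕ.+ j)) ℕ.+ (2 ℕ.+ j) ℕ.* (1 ℕ.+ j))
    lemma₁ = ℕ-Ring.solve-∀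
    lemma₂ : ∀ r a b → r ℕ.* (4 ℕ.+ 2 ℕ.* (2 ℕ.* a) ℕ.+ 2 ℕ.* b) ≡ 2 ℕ.* (r ℕ.* (2 ℕ.+ 2 ℕ.* a ℕ.+ b))
    lemma₂ = ℕ-Ring.solve-∀

  -- The powers of 4 are moved to the right to stay within ℕ. The squares (2 + j)^2 of the
  -- successive steps multiply to the squared factorial.
  reps-lower : ∀ j → 2 ℕ.* 3 ℕ.^ j ℕ.* (suc j !) ℕ.^ 2 ℕ.≤ 4 ℕ.^ j ℕ.* length (reps (3 ℕ.+ j))
  reps-lower zero = subst (2 ℕ.≤_) (sym (ℕ.+-identityʳ _)) 2≤reps-3
  reps-lower (suc j) = begin
    2 ℕ.* (3 ℕ.* 3 ℕ.^ j) ℕ.* ((2 ℕ.+ j) ℕ.* suc j !) ℕ.^ 2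
      ≡⟨ lemma₁ (3 ℕ.^ j) (2 ℕ.+ j) (suc j !) ⟩
    3 ℕ.* ((2 ℕ.+ j) ℕ.* (2 ℕ.+ j)) ℕ.* (2 ℕ.* 3 ℕ.^ j ℕ.* (suc j !) ℕ.^ 2)
      ≤⟨ ℕ.*-monoʳ-≤ (3 ℕ.* ((2 ℕ.+ j) ℕ.* (2 ℕ.+ j))) (reps-lower j) ⟩
    3 ℕ.* ((2 ℕ.+ j) ℕ.* (2 ℕ.+ j)) ℕ.* (4 ℕ.^ j ℕ.* length (reps (3 ℕ.+ j)))
      ≡⟨ lemma₂ (3 ℕ.* ((2 ℕ.+ j) ℕ.* (2 ℕ.+ j))) (4 ℕ.^ j) (length (reps (3 ℕ.+ j))) ⟩
    4 ℕ.^ j ℕ.* (3 ℕ.* ((2 ℕ.+ j) ℕ.* (2 ℕ.+ j)) ℕ.* length (reps (3 ℕ.+ j)))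
      ≤⟨ ℕ.*-monoʳ-≤ (4 ℕ.^ j) (reps-step j) ⟩
    4 ℕ.^ j ℕ.* (4 ℕ.* length (reps (4 ℕ.+ j)))
      ≡⟨ lemma₃ (4 ℕ.^ j) (length (reps (4 ℕ.+ j))) ⟩
    4 ℕ.^ suc j ℕ.* length (reps (4 ℕ.+ j)) ∎
    where
    open ℕ.≤-Reasoning
    lemma₁ : ∀ p a f → 2 ℕ.* (3 ℕ.* p) ℕ.* ((a ℕ.* f) ℕ.* ((a ℕ.* f) ℕ.* 1)) ≡ 3 ℕ.* (a ℕ.* a) ℕ.*
        (2 ℕ.* p ℕ.* (f ℕ.* (f ℕ.* 1)))
    lemma₁ = ℕ-Ring.solve-∀
    lemma₂ : ∀ a b c → a ℕ.* (b ℕ.* c) ≡ b ℕ.* (a ℕ.* c)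
    lemma₂ = ℕ-Ring.solve-∀
    lemma₃ : ∀ a b → a ℕ.* (4 ℕ.* b) ≡ (4 ℕ.* a) ℕ.* b
    lemma₃ = ℕ-Ring.solve-∀

-- Ranking patterns of real configurations and the order of midpoints

module Reals where

  open import Defs
  open Signs
  open Points
  open Patterns

  private variable
    m : ℕ

  Ev : (ℕ → Set) → Set
  Ev P = ∃[ N ] (∀ n → N ℕ.≤ n → P n)

  ev-map : ∀ {P Q : ℕ → Set} → (∀ {n} → P n → Q n) → Ev P → Ev Q
  ev-map f (N , p) = N , λ n N≤n → f (p n N≤n)

  ev-zip : ∀ {P Q R : ℕ → Set} → (∀ {n} → P n → Q n → R n) → Ev P → Ev Q → Ev R
  ev-zip f (M , p) (N , q) = M ℕ.⊔ N , λ n ≤n →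
    f (p n (ℕ.m⊔n≤o⇒m≤o M N ≤n)) (q n (ℕ.m⊔n≤o⇒n≤o M N ≤n))

  ev-always : ∀ {P : ℕ → Set} → (∀ n → P n) → Ev P
  ev-always p = 0 , λ n _ → p n

  ev-∀ : ∀ {m} {P : Fin m → ℕ → Set} → (∀ i → Ev (P i)) → Ev (λ n → ∀ i → P i n)
  ev-∀ {zero}  p = ev-always λ n ()
  ev-∀ {suc m} p = ev-zip (λ { p₀ p₊ zero → p₀ ; p₀ p₊ (suc i) → p₊ i }) (p zero) (ev-∀ (p ∘ suc))

  -- The threshold must be named before a proof of D is given, so D is decided first; if it fails,
  -- any threshold serves.
  ev-→ : ∀ {D : Set} {P : ℕ → Set} → Dec D → (D → Ev P) → Ev (λ n → D → P n)
  ev-→ (yes d) p = ev-map (λ pn _ → pn) (p d)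
  ev-→ (no ¬d) p = ev-always λ n d → contradiction d ¬d

  ev-All : ∀ {A : Set} {P : A → ℕ → Set} {as} → All (λ a → Ev (P a)) as →
      Ev (λ n → All (λ a → P a n) as)
  ev-All []       = ev-always λ n → []
  ev-All (p ∷ ps) = ev-zip _∷_ p (ev-All ps)

  -- Order on sequences.  The order on ℝ is this order on the underlying
  -- sequences; working with sequences keeps the Cauchy moduli out of the types.

  infix 4 _<ˢ_
  record _<ˢ_ (s t : ℕ → ℚ) : Set where
    constructor mk<
    field
      margin     : ℚ
      0<margin   : 0ℚ ℚ.< margin
      eventually : Ev (λ n → s n ℚ.+ margin ℚ.≤ t n)

  open _<ˢ_

  <⇒<ˢ : ∀ (x y : ℝ) → x < y → seq x <ˢ seq y
  <⇒<ˢ x y (ε , 0<ε , p) = mk< ε 0<ε p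

  <ˢ⇒< : ∀ (x y : ℝ) → seq x <ˢ seq y → x < y
  <ˢ⇒< x y (mk< ε 0<ε p) = ε , 0<ε , p

  <ˢ-trans : ∀ {s t u} → s <ˢ t → t <ˢ u → s <ˢ u
  <ˢ-trans {s} (mk< ε 0<ε p) (mk< δ 0<δ q) = mk< ε 0<ε (ev-zip
    (λ {n} s≤t t≤u → ℚ.≤-trans {s n ℚ.+ ε} s≤t (ℚ.≤-trans (≤-by (ℚ.<⇒≤ 0<δ) refl) t≤u)) p q)

  <ˢ-irrefl : ∀ {s} → ¬ s <ˢ s
  <ˢ-irrefl (mk< ε 0<ε (N , p)) = ℚ.<-irrefl refl (ℚ.<-≤-trans (<-by 0<ε refl) (p N ℕ.≤-refl))

  <ˢ-asym : ∀ {s t} → s <ˢ t → ¬ t <ˢ s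
  <ˢ-asym p q = <ˢ-irrefl (<ˢ-trans p q)

  <ˢ-const⁺ : ∀ {p q} → p ℚ.< q → (λ _ → p) <ˢ (λ _ → q)
  <ˢ-const⁺ {p} {q} p<q = mk< (q ℚ.- p) (p<q⇒0<q-p p<q) (ev-always λ n →
    ℚ.≤-reflexive (solve 2 (λ p q → p :+ (q :- p) := q) refl p q))

  <ˢ-const⁻ : ∀ {p q} → (λ _ → p) <ˢ (λ _ → q) → p ℚ.< q
  <ˢ-const⁻ (mk< ε 0<ε (N , p≤)) = ℚ.<-≤-trans (<-by 0<ε refl) (p≤ N ℕ.≤-refl)

  opaque

    meanˢ distˢ : (ℕ → ℚ) → (ℕ → ℚ) → ℕ → ℚ
    meanˢ s t n = ½ ℚ.* (s n ℚ.+ t n)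
    distˢ s t n = ℚ.∣ s n ℚ.- t n ∣

  private
    half : ℚ → ℚ
    half ε = ½ ℚ.* ε

    0<half : ∀ {ε} → 0ℚ ℚ.< ε → 0ℚ ℚ.< half ε
    0<half = 0<p*q (ℚ.positive⁻¹ ½)

    -- If υ were at or beyond β, then α ≤ β would make β the nearer point. Otherwise the hypothesis
    -- yields υ - α + ε ≤ β - υ, whose half is the conclusion.
    nearer-left : ∀ υ α β {ε} → 0ℚ ℚ.< ε → α ℚ.≤ β → ℚ.∣ υ ℚ.- α ∣ ℚ.+ ε ℚ.≤ ℚ.∣ υ ℚ.- β ∣ →
      υ ℚ.+ half ε ℚ.≤ ½ ℚ.* (α ℚ.+ β)
    nearer-left υ α β {ε} 0<ε α≤β h with ℚ.∣p∣≡p∨∣p∣≡-p (υ ℚ.- β)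
    ... | inj₁ eq = contradiction (ℚ.≤-<-trans α≤β (<-by (ℚ.+-mono-<-≤ 0<ε (p≤q⇒0≤q-p le))
            (solve 4 (λ υ α β ε → α := β :+ (ε :+ ((υ :- β) :- ((υ :- α) :+ ε)))) refl υ α β ε)))
                (ℚ.<-irrefl refl)
      where
      le : (υ ℚ.- α) ℚ.+ ε ℚ.≤ υ ℚ.- β
      le = ℚ.≤-trans (ℚ.+-monoˡ-≤ ε (p≤∣p∣ (υ ℚ.- α))) (subst (ℚ.∣ υ ℚ.- α ∣ ℚ.+ ε ℚ.≤_) eq h)
    ... | inj₂ eq = ≤-by (0≤p*q (ℚ.<⇒≤ (ℚ.positive⁻¹ ½)) (p≤q⇒0≤q-p le))
            (solve 4 (λ υ α β ε → con ½ :* (α :+ β) := (υ :+ con ½ :* ε) :+ con ½ :*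
                ((:- (υ :- β)) :- ((υ :- α) :+ ε)))
              refl υ α β ε)
      where
      le : (υ ℚ.- α) ℚ.+ ε ℚ.≤ ℚ.- (υ ℚ.- β)
      le = ℚ.≤-trans (ℚ.+-monoˡ-≤ ε (p≤∣p∣ (υ ℚ.- α))) (subst (ℚ.∣ υ ℚ.- α ∣ ℚ.+ ε ℚ.≤_) eq h)

    -- The reflection υ ↦ - υ exchanges the two points and reduces this to `nearer-left`.
    nearer-right : ∀ υ α β {ε} → 0ℚ ℚ.< ε → α ℚ.≤ β → ℚ.∣ υ ℚ.- β ∣ ℚ.+ ε ℚ.≤ ℚ.∣ υ ℚ.- α ∣ →
      ½ ℚ.* (α ℚ.+ β) ℚ.+ half ε ℚ.≤ υ
    nearer-right υ α β {ε} 0<ε α≤β h = ≤-by (p≤q⇒0≤q-p reflected)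
      (solve 4 (λ υ α β ε → υ := (con ½ :* (α :+ β) :+ con ½ :* ε) :+
          ((con ½ :* (:- β :+ :- α)) :- (:- υ :+ con ½ :* ε)))
        refl υ α β ε)
      where
      flip : ∀ a → ℚ.∣ υ ℚ.- a ∣ ≡ ℚ.∣ ℚ.- υ ℚ.- (ℚ.- a) ∣
      flip a = trans (sym (ℚ.∣-p∣≡∣p∣ (υ ℚ.- a))) (cong ℚ.∣_∣
        (solve 2 (λ υ a → :- (υ :- a) := :- υ :- (:- a)) refl υ a))
      reflected : ℚ.- υ ℚ.+ half ε ℚ.≤ ½ ℚ.* (ℚ.- β ℚ.+ ℚ.- α)
      reflected = nearer-left (ℚ.- υ) (ℚ.- β) (ℚ.- α) 0<ε (ℚ.neg-antimono-≤ α≤β)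
        (subst₂ (λ a b → a ℚ.+ ε ℚ.≤ b) (flip β) (flip α) h)

    -- The minimum covers two cases: right of α the distances differ by twice the distance to the
    -- midpoint, left of α by β - α.
    left-nearer : ∀ υ α β δ η → υ ℚ.+ δ ℚ.≤ ½ ℚ.* (α ℚ.+ β) → α ℚ.+ η ℚ.≤ β →
      ℚ.∣ υ ℚ.- α ∣ ℚ.+ (δ ℚ.+ δ) ℚ.⊓ η ℚ.≤ ℚ.∣ υ ℚ.- β ∣
    left-nearer υ α β δ η h₁ h₂ with ℚ.∣p∣≡p∨∣p∣≡-p (υ ℚ.- α)
    ... | inj₁ eq = ℚ.≤-trans (ℚ.+-mono-≤ (ℚ.≤-reflexive eq) (ℚ.p⊓q≤p (δ ℚ.+ δ) η)) (ℚ.≤-trans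
            (≤-by (ℚ.+-mono-≤ (p≤q⇒0≤q-p h₁) (p≤q⇒0≤q-p h₁))
              (solve 4 (λ υ α β δ → :- (υ :- β) := ((υ :- α) :+ (δ :+ δ))
                  :+ ((con ½ :* (α :+ β) :- (υ :+ δ)) :+ (con ½ :* (α :+ β) :- (υ :+ δ)))) refl υ
                      α β δ))
            (-p≤∣p∣ (υ ℚ.- β)))
    ... | inj₂ eq = ℚ.≤-trans (ℚ.+-mono-≤ (ℚ.≤-reflexive eq) (ℚ.p⊓q≤q (δ ℚ.+ δ) η)) (ℚ.≤-trans
            (≤-by (p≤q⇒0≤q-p h₂)
              (solve 4 (λ υ α β η → :- (υ :- β) := ((:- (υ :- α)) :+ η) :+ (β :- (α :+ η))) refl υ
                  α β η))
            (-p≤∣p∣ (υ ℚ.- β)))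

    right-nearer : ∀ υ α β δ η → ½ ℚ.* (α ℚ.+ β) ℚ.+ δ ℚ.≤ υ → α ℚ.+ η ℚ.≤ β →
      ℚ.∣ υ ℚ.- β ∣ ℚ.+ (δ ℚ.+ δ) ℚ.⊓ η ℚ.≤ ℚ.∣ υ ℚ.- α ∣
    right-nearer υ α β δ η h₁ h₂ = subst₂ (λ a b → a ℚ.+ (δ ℚ.+ δ) ℚ.⊓ η ℚ.≤ b) (flip β) (flip α)
      (left-nearer (ℚ.- υ) (ℚ.- β) (ℚ.- α) δ η
        (≤-by (p≤q⇒0≤q-p h₁) (solve 4 (λ υ α β δ → con ½ :* (:- β :+ :- α)
          := (:- υ :+ δ) :+ (υ :- (con ½ :* (α :+ β) :+ δ))) refl υ α β δ))
        (≤-by (p≤q⇒0≤q-p h₂) (solve 3 (λ α β η → :- α := (:- β :+ η) :+ (β :- (α :+ η))) refl α β η)))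
      where
      flip : ∀ a → ℚ.∣ ℚ.- υ ℚ.- (ℚ.- a) ∣ ≡ ℚ.∣ υ ℚ.- a ∣
      flip a = trans (cong ℚ.∣_∣ (solve 2 (λ υ a → :- υ :- (:- a) := :- (υ :- a)) refl υ a))
          (ℚ.∣-p∣≡∣p∣ (υ ℚ.- a))

    0<⊓ : ∀ {a b} → 0ℚ ℚ.< a → 0ℚ ℚ.< b → 0ℚ ℚ.< a ℚ.⊓ b
    0<⊓ {a} {b} 0<a 0<b with ℚ.≤-total a b
    ... | inj₁ a≤b = subst (0ℚ ℚ.<_) (sym (ℚ.p≤q⇒p⊓q≡p a≤b)) 0<a
    ... | inj₂ b≤a = subst (0ℚ ℚ.<_) (sym (ℚ.p≥q⇒p⊓q≡q b≤a)) 0<b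

  module _ {y a b : ℕ → ℚ} (a<b : a <ˢ b) where
    private
      a≤b : Ev (λ n → a n ℚ.≤ b n)
      a≤b = ev-map (ℚ.≤-trans (≤-by (ℚ.<⇒≤ (0<margin a<b)) refl)) (eventually a<b)

    opaque
      unfolding meanˢ distˢ

      nearer⇒<mean : distˢ y a <ˢ distˢ y b → y <ˢ meanˢ a b
      nearer⇒<mean (mk< ε 0<ε h) = mk< (half ε) (0<half 0<ε)
        (ev-zip (λ {n} → nearer-left (y n) (a n) (b n) 0<ε) a≤b h)

      nearer⇒mean< : distˢ y b <ˢ distˢ y a → meanˢ a b <ˢ y
      nearer⇒mean< (mk< ε 0<ε h) = mk< (half ε) (0<half 0<ε)
        (ev-zip (λ {n} → nearer-right (y n) (a n) (b n) 0<ε) a≤b h)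

      <mean⇒nearer : y <ˢ meanˢ a b → distˢ y a <ˢ distˢ y b
      <mean⇒nearer (mk< δ 0<δ h) = mk< ((δ ℚ.+ δ) ℚ.⊓ margin a<b) (0<⊓ (0<p+q 0<δ 0<δ) (0<margin a<b))
        (ev-zip (λ {n} → left-nearer (y n) (a n) (b n) δ (margin a<b)) h (eventually a<b))

      mean<⇒nearer : meanˢ a b <ˢ y → distˢ y b <ˢ distˢ y a
      mean<⇒nearer (mk< δ 0<δ h) = mk< ((δ ℚ.+ δ) ℚ.⊓ margin a<b) (0<⊓ (0<p+q 0<δ 0<δ) (0<margin a<b))
        (ev-zip (λ {n} → right-nearer (y n) (a n) (b n) δ (margin a<b)) h (eventually a<b))

  private
    uniform-< : ∀ {ps : List ((ℕ → ℚ) × (ℕ → ℚ))} → All (uncurry _<ˢ_) ps →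
      ∃[ ε ] (0ℚ ℚ.< ε × Ev (λ n → All (λ (a , b) → a n ℚ.+ ε ℚ.≤ b n) ps))
    uniform-< [] = 1ℚ , ℚ.positive⁻¹ 1ℚ , ev-always λ n → []
    uniform-< {(a , b) ∷ _} (mk< ε 0<ε p ∷ ps) with uniform-< ps
    ... | δ , 0<δ , q = ε ℚ.⊓ δ , 0<⊓ 0<ε 0<δ , ev-zip
      (λ {n} pn qn → ℚ.≤-trans (ℚ.+-monoʳ-≤ (a n) (ℚ.p⊓q≤p ε δ)) pn
        ∷ All.map (λ {(c , _)} → ℚ.≤-trans (ℚ.+-monoʳ-≤ (c n) (ℚ.p⊓q≤q ε δ))) qn) p q

    lower-bound : ∀ {A : Set} (g : A → ℚ) bs → ∃[ c ] All (λ b → c ℚ.≤ g b) bs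
    lower-bound g [] = 0ℚ , []
    lower-bound g (b ∷ bs) with lower-bound g bs
    ... | c , c≤ = g b ℚ.⊓ c , ℚ.p⊓q≤p (g b) c ∷ All.map (ℚ.≤-trans (ℚ.p⊓q≤q (g b) c)) c≤

    -- The last component expresses, as an induction principle, that M is c or one of the values f
    -- a.
    least-upper : ∀ {A : Set} (f : A → ℚ) c as → ∃[ M ] (All (λ a → f a ℚ.≤ M) as ×
      (∀ {P : ℚ → Set} → P c → All (λ a → P (f a)) as → P M))
    least-upper f c [] = c , [] , λ Pc _ → Pc
    least-upper f c (a ∷ as) with least-upper f c as
    ... | M , ≤M , ind with ℚ.≤-total (f a) M
    ...   | inj₁ fa≤M = M , fa≤M ∷ ≤M , λ { {P} Pc (_ ∷ Pas) → ind {P} Pc Pas }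
    ...   | inj₂ M≤fa = f a , ℚ.≤-refl ∷ All.map (λ v≤M → ℚ.≤-trans v≤M M≤fa) ≤M , λ { _ (Pa ∷ _) → Pa }

    -- M is the largest f a, raised if necessary to c - ε for a lower bound c of the values g b;
    -- this default also covers an empty list `as`.
    between-ℚ : ∀ {A B : Set} (f : A → ℚ) (g : B → ℚ) as bs ε →
        All (λ a → All (λ b → f a ℚ.+ ε ℚ.≤ g b) bs) as →
      ∃[ M ] (All (λ a → f a ℚ.≤ M) as × All (λ b → M ℚ.+ ε ℚ.≤ g b) bs)
    between-ℚ f g as bs ε h with lower-bound g bs
    ... | c , c≤ with least-upper f (c ℚ.- ε) as
    ...   | M , ≤M , ind = M , ≤M , ind {λ u → All (λ b → u ℚ.+ ε ℚ.≤ g b) bs}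
            (All.map (ℚ.≤-trans (ℚ.≤-reflexive (solve 2 (λ c ε → (c :- ε) :+ ε := c) refl c ε))) c≤) h

    close : ∀ {as : List (ℕ → ℚ)} → All IsCauchy as → ∀ {δ} → 0ℚ ℚ.< δ →
      Ev (λ N → All (λ a → ∀ n → N ℕ.≤ n → ℚ.∣ a n ℚ.- a N ∣ ℚ.< δ) as)
    close cs {δ} 0<δ = ev-All (All.map (λ {a} → one a) cs)
      where
      one : ∀ a → IsCauchy a → Ev (λ N → ∀ n → N ℕ.≤ n → ℚ.∣ a n ℚ.- a N ∣ ℚ.< δ)
      one a c with c δ 0<δ
      ... | N , p = N , λ M N≤M n M≤n → p n M (ℕ.≤-trans N≤M M≤n) N≤M

    close-below : ∀ u v M ε → ℚ.∣ u ℚ.- v ∣ ℚ.< half (half ε) → v ℚ.≤ M →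
        u ℚ.+ half (half ε) ℚ.≤ M ℚ.+ half ε
    close-below u v M ε h v≤M = ≤-by (ℚ.+-mono-≤
        (p≤q⇒0≤q-p (ℚ.≤-trans (p≤∣p∣ (u ℚ.- v)) (ℚ.<⇒≤ h))) (p≤q⇒0≤q-p v≤M))
      (solve 4 (λ u v M ε → M :+ con ½ :* ε := (u :+ con ½ :* (con ½ :* ε))
        :+ ((con ½ :* (con ½ :* ε) :- (u :- v)) :+ (M :- v))) refl u v M ε)

    close-above : ∀ u v M ε → ℚ.∣ u ℚ.- v ∣ ℚ.< half (half ε) → M ℚ.+ ε ℚ.≤ v →
        (M ℚ.+ half ε) ℚ.+ half (half ε) ℚ.≤ u
    close-above u v M ε h M≤v = ≤-by (ℚ.+-mono-≤
        (p≤q⇒0≤q-p (ℚ.≤-trans (-p≤∣p∣ (u ℚ.- v)) (ℚ.<⇒≤ h))) (p≤q⇒0≤q-p M≤v))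
      (solve 4 (λ u v M ε → u := ((M :+ con ½ :* ε) :+ con ½ :* (con ½ :* ε))
        :+ ((con ½ :* (con ½ :* ε) :- (:- (u :- v))) :+ (v :- (M :+ ε)))) refl u v M ε)

  private
    between-at : ∀ as bs {ε} → 0ℚ ℚ.< ε → ∀ N →
      All (λ (a , b) → a N ℚ.+ ε ℚ.≤ b N) (cartesianProduct as bs) →
      All (λ a → ∀ n → N ℕ.≤ n → ℚ.∣ a n ℚ.- a N ∣ ℚ.< half (half ε)) (as ++ bs) →
      ∃[ q ] (All (_<ˢ (λ _ → q)) as × All ((λ _ → q) <ˢ_) bs)
    between-at as bs {ε} 0<ε N gap closeN =
      M ℚ.+ half ε , All.tabulate below , All.tabulate above
      where
      sep = between-ℚ (λ a → a N) (λ b → b N) as bs ε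
        (All.tabulate λ {a} a∈ → All.tabulate λ {b} b∈ → All.lookup gap (∈-cartesianProduct⁺ a∈ b∈))
      M = proj₁ sep
      below : ∀ {a} → a ∈ as → a <ˢ (λ _ → M ℚ.+ half ε)
      below {a} a∈ = mk< (half (half ε)) (0<half (0<half 0<ε)) (N , λ n N≤n →
        close-below (a n) (a N) M ε (All.lookup closeN (∈-++⁺ˡ a∈) n N≤n)
            (All.lookup (proj₁ (proj₂ sep)) a∈))
      above : ∀ {b} → b ∈ bs → (λ _ → M ℚ.+ half ε) <ˢ b
      above {b} b∈ = mk< (half (half ε)) (0<half (0<half 0<ε)) (N , λ n N≤n →
        close-above (b n) (b N) M ε (All.lookup closeN (∈-++⁺ʳ as b∈) n N≤n)
            (All.lookup (proj₂ (proj₂ sep)) b∈))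

  -- At a late index N the left and right terms differ by at least a common ε, and no sequence moves
  -- by ε / 4 afterwards. Then q is placed ε / 2 above a bound of the left terms at N. Such a q is
  -- the rational ideal point of `Consistent⇒Ranked`.
  between : ∀ as bs → All IsCauchy as → All IsCauchy bs → (∀ {a b} → a ∈ as → b ∈ bs → a <ˢ b) →
    ∃[ q ] (All (_<ˢ (λ _ → q)) as × All ((λ _ → q) <ˢ_) bs)
  between as bs ca cb a<b with uniform-< {cartesianProduct as bs}
    (All.cartesianProduct⁺ (setoid _) (setoid _) as bs a<b)
  ... | ε , 0<ε , N₁ , gap with close (All.++⁺ ca cb) (0<half (0<half 0<ε))
  ...   | N₂ , closeN = between-at as bs 0<ε (N₁ ℕ.⊔ N₂)
            (gap (N₁ ℕ.⊔ N₂) (ℕ.m≤m⊔n N₁ N₂)) (closeN (N₁ ℕ.⊔ N₂) (ℕ.m≤n⊔m N₁ N₂))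

  -- A ranking sends ranks to points, so its inverse gives the rank of a point.
  pos : Permutation′ m → Fin m → Fin m
  pos σ i = σ ⟨$⟩ˡ i

  mean : Vector ℝ m → Fin m → Fin m → ℕ → ℚ
  mean x i j = meanˢ (seq (x i)) (seq (x j))

  Increasingˢ : Vector ℝ m → Set
  Increasingˢ x = ∀ i j → i Fin.< j → seq (x i) <ˢ seq (x j)

  -- Pairs put in the reverse order by a ranking have their midpoint to the left
  -- of the ideal point, the other pairs to the right.
  Consistent : Vector ℝ m → Permutation′ m → Set
  Consistent x σ = ∀ {i j k l} → i Fin.< j → k Fin.< l → pos σ j Fin.< pos σ i → pos σ k Fin.< pos σ l →
    mean x i j <ˢ mean x k l

  Ranked : Vector ℝ m → Permutation′ m → (ℕ → ℚ) → Set
  Ranked x σ y = ∀ k k′ → k Fin.< k′ → distˢ y (seq (x (σ ⟨$⟩ʳ k))) <ˢ distˢ y (seq (x (σ ⟨$⟩ʳ k′)))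

  opaque
    unfolding distˢ

    RP⇒Ranked : ∀ (x : Vector ℝ m) σ → RP x σ → ∃[ y ] Ranked x σ y
    RP⇒Ranked x σ (y , r) = seq y , λ k k′ k<k′ →
      <⇒<ˢ ∣ y - x (σ ⟨$⟩ʳ k) ∣ ∣ y - x (σ ⟨$⟩ʳ k′) ∣ (r k k′ k<k′)

    Ranked⇒RP : ∀ (x : Vector ℝ m) σ → ∃[ q ] Ranked x σ (λ _ → q) → RP x σ
    Ranked⇒RP x σ (q , r) = fromℚ q , λ k k′ k<k′ →
      <ˢ⇒< ∣ fromℚ q - x (σ ⟨$⟩ʳ k) ∣ ∣ fromℚ q - x (σ ⟨$⟩ʳ k′) ∣ (r k k′ k<k′)

  module _ (x : Vector ℝ m) (inc : Increasingˢ x) (σ : Permutation′ m) where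

    Ranked⇒Consistent : ∀ {y} → Ranked x σ y → Consistent x σ
    Ranked⇒Consistent {y} ranked {i} {j} {k} {l} i<j k<l j≺i k≺l = <ˢ-trans {mean x i j} {y}
        {mean x k l}
      (nearer⇒mean< {y} {seq (x i)} {seq (x j)} (inc i j i<j) (ranked-at {j} {i} j≺i))
      (nearer⇒<mean {y} {seq (x k)} {seq (x l)} (inc k l k<l) (ranked-at {k} {l} k≺l))
      where
      ranked-at : ∀ {a b} → pos σ a Fin.< pos σ b → distˢ y (seq (x a)) <ˢ distˢ y (seq (x b))
      ranked-at {a} {b} lt = subst₂ (λ a b → distˢ y (seq (x a)) <ˢ distˢ y (seq (x b)))
        (inverseʳ σ {a}) (inverseʳ σ {b}) (ranked (pos σ a) (pos σ b) lt)

    private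
      inverted? : Decidable (λ ((i , j) : Fin m × Fin m) → i Fin.< j × pos σ j Fin.< pos σ i)
      inverted? (i , j) = i Fin.<? j ×-dec pos σ j Fin.<? pos σ i

      kept? : Decidable (λ ((i , j) : Fin m × Fin m) → i Fin.< j × pos σ i Fin.< pos σ j)
      kept? (i , j) = i Fin.<? j ×-dec pos σ i Fin.<? pos σ j

      opaque
        inverted kept : List (Fin m × Fin m)
        inverted = List.filter inverted? (cartesianProduct (allFin m) (allFin m))
        kept     = List.filter kept? (cartesianProduct (allFin m) (allFin m))

        ∈-inverted⁺ : ∀ {i j} → i Fin.< j → pos σ j Fin.< pos σ i → (i , j) ∈ inverted
        ∈-inverted⁺ i<j j≺i = ∈-filter⁺ inverted? (∈-cartesianProduct⁺ (∈-allFin _) (∈-allFin _))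
            (i<j , j≺i)

        ∈-inverted⁻ : ∀ {i j} → (i , j) ∈ inverted → i Fin.< j × pos σ j Fin.< pos σ i
        ∈-inverted⁻ p∈ = proj₂ (∈-filter⁻ inverted? {xs = cartesianProduct (allFin m) (allFin m)} p∈)

        ∈-kept⁺ : ∀ {i j} → i Fin.< j → pos σ i Fin.< pos σ j → (i , j) ∈ kept
        ∈-kept⁺ i<j i≺j = ∈-filter⁺ kept? (∈-cartesianProduct⁺ (∈-allFin _) (∈-allFin _)) (i<j , i≺j)

        ∈-kept⁻ : ∀ {i j} → (i , j) ∈ kept → i Fin.< j × pos σ i Fin.< pos σ j
        ∈-kept⁻ p∈ = proj₂ (∈-filter⁻ kept? {xs = cartesianProduct (allFin m) (allFin m)} p∈)

      means : List (Fin m × Fin m) → List (ℕ → ℚ)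
      means = List.map (uncurry (mean x))

      opaque
        unfolding meanˢ

        means-cauchy : ∀ ps → All IsCauchy (means ps)
        means-cauchy ps = All.map⁺ (All.universal (λ (i , j) → cauchy (midpoint x i j)) ps)

      ranked : ∀ {y} → All (_<ˢ y) (means inverted) → All (y <ˢ_) (means kept) → Ranked x σ y
      ranked {y} <y y< k k′ k<k′ with Fin.<-cmp (σ ⟨$⟩ʳ k) (σ ⟨$⟩ʳ k′)
      ... | tri≈ _ eq _ = contradiction (trans (sym (inverseˡ σ))
          (trans (cong (pos σ) eq) (inverseˡ σ))) (Fin.<⇒≢ k<k′)
      ... | tri< i<j _ _ = <mean⇒nearer {y} {seq (x (σ ⟨$⟩ʳ k))} {seq (x (σ ⟨$⟩ʳ k′))} (inc _ _ i<j)
        (All.lookup y< (∈-map⁺ (uncurry (mean x))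
            (∈-kept⁺ i<j (subst₂ Fin._<_ (sym (inverseˡ σ)) (sym (inverseˡ σ)) k<k′))))
      ... | tri> _ _ j<i = mean<⇒nearer {y} {seq (x (σ ⟨$⟩ʳ k′))} {seq (x (σ ⟨$⟩ʳ k))} (inc _ _ j<i)
        (All.lookup <y (∈-map⁺ (uncurry (mean x))
            (∈-inverted⁺ j<i (subst₂ Fin._<_ (sym (inverseˡ σ)) (sym (inverseˡ σ)) k<k′))))

    -- Consistency puts every midpoint of an inverted pair left of every midpoint of a kept pair,
    -- and any number between these two finite families produces the ranking.
    Consistent⇒Ranked : Consistent x σ → ∃[ q ] Ranked x σ (λ _ → q)
    Consistent⇒Ranked cons = let q , <q , q< = between (means inverted) (means kept)
                                   (means-cauchy inverted) (means-cauchy kept) separated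
                             in q , ranked {λ _ → q} <q q<
      where
      separated : ∀ {a b} → a ∈ means inverted → b ∈ means kept → a <ˢ b
      separated a∈ b∈ with ∈-map⁻ (uncurry (mean x)) a∈ | ∈-map⁻ (uncurry (mean x)) b∈
      ... | (i , j) , p∈ , refl | (k , l) , q∈ , refl = let i<j , j≺i = ∈-inverted⁻ p∈ ; k<l , k≺l = ∈-kept⁻ q∈ in
        cons {i} {j} {k} {l} i<j k<l j≺i k≺l

  SameOrder : Vector ℝ m → Vector ℝ m → Set
  SameOrder x y = ∀ {i j k l} → i Fin.< j → k Fin.< l → mean x i j <ˢ mean x k l →
      mean y i j <ˢ mean y k l

  RP⇒Consistent : ∀ {x : Vector ℝ m} → Increasingˢ x → ∀ {σ} → RP x σ → Consistent x σ
  RP⇒Consistent {x = x} inc {σ} r = Ranked⇒Consistent x inc σ {proj₁ (RP⇒Ranked x σ r)}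
      (proj₂ (RP⇒Ranked x σ r))

  SameOrder⇒⊆ : ∀ {x y : Vector ℝ m} → Increasingˢ x → Increasingˢ y → SameOrder x y → ∀ {σ} →
      RP x σ → RP y σ
  SameOrder⇒⊆ {x = x} {y} incx incy ord {σ} r = Ranked⇒RP y σ (Consistent⇒Ranked y incy σ
    λ {i} {j} {k} {l} i<j k<l j≺i k≺l → ord i<j k<l (RP⇒Consistent {x = x} incx {σ} r i<j k<l j≺i k≺l))

  Genericˢ : Vector ℝ m → Set
  Genericˢ x = ∀ {i j k l} → i Fin.< j → k Fin.< l → (i , j) ≢ (k , l) →
    mean x i j <ˢ mean x k l ⊎ mean x k l <ˢ mean x i j

  -- Genericity makes the order of the midpoints of x total, and preserving a total strict order
  -- implies reflecting it.
  SameOrder-sym : ∀ {x y : Vector ℝ m} → Genericˢ x → SameOrder x y → SameOrder y x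
  SameOrder-sym {x = x} {y} genx ord {i} {j} {k} {l} i<j k<l y< with ≡-dec Fin._≟_ Fin._≟_ (i , j)
      (k , l)
  ... | yes refl = contradiction y< <ˢ-irrefl
  ... | no ij≢kl with genx {i} {j} {k} {l} i<j k<l ij≢kl
  ...   | inj₁ x< = x<
  ...   | inj₂ x> = contradiction (ord {k} {l} {i} {j} k<l i<j x>) (<ˢ-asym y<)

  module _ {x y : Vector ℚ m} (e : Equiv x y) where

    quads-pairs : ∀ {i j k l} → i Fin.< j → k Fin.< l → (i , j) ≢ (k , l) →
      SameSign (quad x i j k l) (quad y i j k l)
    quads-pairs {i} {j} {k} {l} i<j k<l ij≢kl with i Fin.≟ k | i Fin.≟ l | j Fin.≟ k | j Fin.≟ l
    ... | yes refl | _ | _ | _ = subst₂ SameSign (eq (x i) (x j) (x l)) (eq (y i) (y j) (y l))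
      (gaps-≢ e {l} {j} (λ { refl → ij≢kl refl }))
      where
      eq : ∀ i j l → j ℚ.- l ≡ (i ℚ.+ j) ℚ.- (i ℚ.+ l)
      eq = solve 3 (λ i j l → j :- l := (i :+ j) :- (i :+ l)) refl
    ... | no _ | yes refl | _ | _ = subst₂ SameSign (eq (x i) (x j) (x k)) (eq (y i) (y j) (y k))
      (gaps-≢ e {k} {j} (Fin.<⇒≢ (Fin.<-trans k<l i<j)))
      where
      eq : ∀ i j k → j ℚ.- k ≡ (i ℚ.+ j) ℚ.- (k ℚ.+ i)
      eq = solve 3 (λ i j k → j :- k := (i :+ j) :- (k :+ i)) refl
    ... | no _ | no i≢l | yes refl | _ = subst₂ SameSign (eq (x i) (x j) (x l)) (eq (y i) (y j) (y l))
      (gaps-≢ e {l} {i} (≢-sym i≢l))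
      where
      eq : ∀ i j l → i ℚ.- l ≡ (i ℚ.+ j) ℚ.- (j ℚ.+ l)
      eq = solve 3 (λ i j l → i :- l := (i :+ j) :- (j :+ l)) refl
    ... | no i≢k | no _ | no _ | yes refl = subst₂ SameSign (eq (x i) (x j) (x k))
        (eq (y i) (y j) (y k))
      (gaps-≢ e {k} {i} (≢-sym i≢k))
      where
      eq : ∀ i j k → i ℚ.- k ≡ (i ℚ.+ j) ℚ.- (k ℚ.+ j)
      eq = solve 3 (λ i j k → i :- k := (i :+ j) :- (k :+ j)) refl
    ... | no i≢k | no i≢l | no j≢k | no j≢l =
      quads-≢ e (Fin.<⇒≢ i<j) i≢k i≢l j≢k j≢l (Fin.<⇒≢ k<l)

  embed : Vector ℚ m → Vector ℝ m
  embed x i = fromℚ (x i)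

  opaque

    meanℚ : Vector ℚ m → Fin m → Fin m → ℚ
    meanℚ x i j = ½ ℚ.* (x i ℚ.+ x j)

  embed-increasing : ∀ {x : Vector ℚ m} → Increasingℚ x → Increasingˢ (embed x)
  embed-increasing {x = x} inc i j i<j = <ˢ-const⁺ {x i} {x j} (inc i j i<j)

  opaque
    unfolding meanˢ meanℚ

    mean-<⇒ : ∀ (x : Vector ℚ m) {i j k l} → meanℚ x i j ℚ.< meanℚ x k l →
        mean (embed x) i j <ˢ mean (embed x) k l
    mean-<⇒ x {i} {j} {k} {l} = <ˢ-const⁺ {meanℚ x i j} {meanℚ x k l}

    mean-<⇐ : ∀ (x : Vector ℚ m) {i j k l} → mean (embed x) i j <ˢ mean (embed x) k l →
        meanℚ x i j ℚ.< meanℚ x k l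
    mean-<⇐ x {i} {j} {k} {l} = <ˢ-const⁻ {meanℚ x i j} {meanℚ x k l}

    mean-quad : ∀ (x : Vector ℚ m) i j k l → meanℚ x i j ℚ.- meanℚ x k l ≡ ½ ℚ.* quad x i j k l
    mean-quad x i j k l = solve 4 (λ i j k l → con ½ :* (i :+ j) :- con ½ :* (k :+ l)
      := con ½ :* ((i :+ j) :- (k :+ l))) refl (x i) (x j) (x k) (x l)

  mean-ss : ∀ (x y : Vector ℚ m) i j k l → SameSign (quad x i j k l) (quad y i j k l) →
    SameSign (meanℚ x i j ℚ.- meanℚ x k l) (meanℚ y i j ℚ.- meanℚ y k l)
  mean-ss x y i j k l ss = subst₂ SameSign (sym (mean-quad x i j k l)) (sym (mean-quad y i j k l))
    (ss-scale {½} {quad x i j k l} {quad y i j k l} (λ ()) ss)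

  mean-ss⁻ : ∀ (x y : Vector ℚ m) i j k l → SameSign (meanℚ x i j ℚ.- meanℚ x k l)
      (meanℚ y i j ℚ.- meanℚ y k l) →
    SameSign (quad x i j k l) (quad y i j k l)
  mean-ss⁻ x y i j k l ss = ss-cancel {½} {quad x i j k l} {quad y i j k l} (λ ())
    (subst₂ SameSign (mean-quad x i j k l) (mean-quad y i j k l) ss)

  mean-cmp : ∀ (x : Vector ℚ m) i j k l → SameSign (quad x i j k l) (quad x i j k l) →
    meanℚ x i j ℚ.< meanℚ x k l ⊎ meanℚ x k l ℚ.< meanℚ x i j
  mean-cmp x i j k l ss with mean-ss x x i j k l ss
  ... | inj₁ (0< , _) = inj₂ (0<p-q⇒q<p 0<)
  ... | inj₂ (<0 , _) = inj₁ (p-q<0⇒p<q <0)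

  embed-generic : ∀ {x : Vector ℚ m} → Equiv x x → Genericˢ (embed x)
  embed-generic {x = x} e {i} {j} {k} {l} i<j k<l ij≢kl
    with mean-cmp x i j k l (quads-pairs e i<j k<l ij≢kl)
  ... | inj₁ < = inj₁ (mean-<⇒ x {i} {j} {k} {l} <)
  ... | inj₂ > = inj₂ (mean-<⇒ x {k} {l} {i} {j} >)

  opaque
    unfolding meanˢ

    Genericˢ⇒Generic : ∀ {x : Vector ℝ m} → Genericˢ x → Generic x
    Genericˢ⇒Generic {x = x} genx i j k l i<j k<l ij≢kl =
      [ inj₁ ∘ <ˢ⇒< (midpoint x i j) (midpoint x k l) , inj₂ ∘ <ˢ⇒< (midpoint x k l) (midpoint x i j) ]′
        (genx {i} {j} {k} {l} i<j k<l ij≢kl)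

    Generic⇒Genericˢ : ∀ {x : Vector ℝ m} → Generic x → Genericˢ x
    Generic⇒Genericˢ {x = x} genx {i} {j} {k} {l} i<j k<l ij≢kl =
      [ inj₁ ∘ <⇒<ˢ (midpoint x i j) (midpoint x k l) , inj₂ ∘ <⇒<ˢ (midpoint x k l) (midpoint x i j) ]′
        (genx i j k l i<j k<l ij≢kl)

  embedOG : ∀ {x : Vector ℚ m} → OrderedGenericℚ x → OrderedGeneric m
  embedOG {x = x} og = record
    { point      = embed x
    ; generic    = Genericˢ⇒Generic {x = embed x} λ {i} {j} {k} {l} →
        embed-generic (gen og) {i} {j} {k} {l}
    ; increasing = λ i j i<j → <ˢ⇒< (embed x i) (embed x j) (embed-increasing (incr og) i j i<j)
    }

  Equiv⇒SameOrder : ∀ {x y : Vector ℚ m} → Equiv x y → SameOrder (embed x) (embed y)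
  Equiv⇒SameOrder {x = x} {y} e {i} {j} {k} {l} i<j k<l x< with ≡-dec Fin._≟_ Fin._≟_ (i , j) (k , l)
  ... | yes refl = contradiction x< <ˢ-irrefl
  ... | no ij≢kl with mean-ss x y i j k l (quads-pairs e i<j k<l ij≢kl)
  ...   | inj₁ (0< , _) = contradiction (mean-<⇐ x {i} {j} {k} {l} x<) (ℚ.<-asym (0<p-q⇒q<p 0<))
  ...   | inj₂ (_ , <0) = mean-<⇒ y {i} {j} {k} {l} (p-q<0⇒p<q <0)

  SameOrder⇒Equiv : ∀ {x y : Vector ℚ m} → OrderedGenericℚ x → OrderedGenericℚ y →
    SameOrder (embed x) (embed y) → Equiv x y
  SameOrder⇒Equiv {x = x} {y} ox oy ord = mkEquiv (increasing-gaps (incr ox) (incr oy)) qs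
    where
    qs : ∀ {i j k l} → i Fin.< j → k Fin.< l → i Fin.< k → j ≢ k → j ≢ l →
      SameSign (quad x i j k l) (quad y i j k l)
    qs {i} {j} {k} {l} i<j k<l i<k j≢k j≢l
      with mean-cmp x i j k l (quads (gen ox) i<j k<l i<k j≢k j≢l)
    ... | inj₁ x< = mean-ss⁻ x y i j k l
      (inj₂ (p<q⇒p-q<0 x< , p<q⇒p-q<0 (mean-<⇐ y {i} {j} {k} {l}
          (ord {i} {j} {k} {l} i<j k<l (mean-<⇒ x {i} {j} {k} {l} x<)))))
    ... | inj₂ x> = mean-ss⁻ x y i j k l
      (inj₁ (p<q⇒0<q-p x> , p<q⇒0<q-p (mean-<⇐ y {k} {l} {i} {j}
          (ord {k} {l} {i} {j} k<l i<j (mean-<⇒ x {k} {l} {i} {j} x>)))))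

-- Rational realisation and the bijection with ranking patterns

module Realisation where

  open import Defs
  open Signs
  open Points
  open Patterns
  open LeftExtensions using (resolution)
  open Reals

  private variable
    m n : ℕ

  argmin : (key : Fin (suc m) → ℚ) → ∃[ i ] (∀ j → key i ℚ.≤ key j)
  argmin {zero} key = zero , λ { zero → ℚ.≤-refl }
  argmin {suc m} key with argmin (key ∘ suc)
  ... | i , min with ℚ.≤-total (key zero) (key (suc i))
  ...   | inj₁ ≤i = zero , λ { zero → ℚ.≤-refl ; (suc j) → ℚ.≤-trans ≤i (min j) }
  ...   | inj₂ i≤ = suc i , λ { zero → i≤ ; (suc j) → min j }

  Sorts : (Fin m → ℚ) → Permutation′ m → Set
  Sorts key σ = Increasingℚ (λ i → key (σ ⟨$⟩ʳ i))

  -- Selection sort: a least key receives rank zero, and injectivity of the keys makes the order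
  -- strict.
  sort : (key : Fin m → ℚ) → (∀ {i j} → key i ≡ key j → i ≡ j) → ∃[ σ ] Sorts key σ
  sort {zero}  key inj = idₚ , λ ()
  sort {suc m} key inj with argmin key
  ... | i , min with sort (key ∘ punchIn i) (Fin.punchIn-injective i _ _ ∘ inj)
  ...   | σ , inc = insert zero i σ , sorted
    where
    rest : ∀ k → insert zero i σ ⟨$⟩ʳ suc k ≡ punchIn i (σ ⟨$⟩ʳ k)
    rest = insert-punchIn zero i σ
    sorted : Sorts key (insert zero i σ)
    sorted zero (suc b) _ with ℚ.<-cmp (key i) (key (insert zero i σ ⟨$⟩ʳ suc b))
    ... | tri< < _ _ = <
    ... | tri≈ _ eq _ = contradiction (inj (trans eq (cong key (rest b))))
        (≢-sym (Fin.punchInᵢ≢i i (σ ⟨$⟩ʳ b)))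
    ... | tri> _ _ > = contradiction (min _) (λ ≤ → ℚ.<-irrefl refl (ℚ.<-≤-trans > ≤))
    sorted (suc a) (suc b) a<b = subst₂ (λ u v → key u ℚ.< key v) (sym (rest a)) (sym (rest b))
        (inc a b (ℕ.s<s⁻¹ a<b))

  opaque

    meanValues : Vector ℚ m → List ℚ
    meanValues {m} x = cartesianProductWith (meanℚ x) (allFin m) (allFin m)

    mean∈meanValues : ∀ (x : Vector ℚ m) i j → meanℚ x i j ∈ meanValues x
    mean∈meanValues x i j = ∈-cartesianProductWith⁺ (meanℚ x) (∈-allFin i) (∈-allFin j)

  between-avoiding : ∀ (vs : List ℚ) {u v} → u ∈ vs → v ∈ vs → u ℚ.< v →
    ∃[ q ] (u ℚ.< q × q ℚ.< v × (∀ {w} → w ∈ vs → q ≢ w))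
  between-avoiding vs {u} {v} u∈ v∈ u<v = go (resolution vs)
    where
    go : ∃[ ε ] (0ℚ ℚ.< ε × (∀ {u v} → u ∈ vs → v ∈ vs → u ℚ.< v → u ℚ.< v ℚ.- ε)) →
      ∃[ q ] (u ℚ.< q × q ℚ.< v × (∀ {w} → w ∈ vs → q ≢ w))
    go (ε , 0<ε , fine) = v ℚ.- ε , fine u∈ v∈ u<v , q<v , avoids
      where
      q<v : v ℚ.- ε ℚ.< v
      q<v = <-by 0<ε (solve 2 (λ v ε → v := (v :- ε) :+ ε) refl v ε)
      avoids : ∀ {w} → w ∈ vs → v ℚ.- ε ≢ w
      avoids {w} w∈ q≡w = ℚ.<-irrefl (sym q≡w) (fine w∈ v∈ (subst (ℚ._< v) q≡w q<v))

  between-means : ∀ (x : Vector ℚ m) {i j k l} → meanℚ x i j ℚ.< meanℚ x k l →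
    ∃[ q ] (meanℚ x i j ℚ.< q × q ℚ.< meanℚ x k l × (∀ {w} → w ∈ meanValues x → q ≢ w))
  between-means x {i} {j} {k} {l} = between-avoiding (meanValues x) (mean∈meanValues x i j)
      (mean∈meanValues x k l)

  opaque
    unfolding distˢ meanˢ meanℚ

    dist-< : ∀ {x : Vector ℚ m} {q i j} → Increasingℚ x → i Fin.< j → q ℚ.< meanℚ x i j →
      ℚ.∣ q ℚ.- x i ∣ ℚ.< ℚ.∣ q ℚ.- x j ∣
    dist-< {x = x} {q} {i} {j} inc i<j q< = <ˢ-const⁻ {ℚ.∣ q ℚ.- x i ∣} {ℚ.∣ q ℚ.- x j ∣}
      (<mean⇒nearer {λ _ → q} {λ _ → x i} {λ _ → x j} (<ˢ-const⁺ (inc i j i<j))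
          (<ˢ-const⁺ {q} {meanℚ x i j} q<))

    dist-> : ∀ {x : Vector ℚ m} {q i j} → Increasingℚ x → i Fin.< j → meanℚ x i j ℚ.< q →
      ℚ.∣ q ℚ.- x j ∣ ℚ.< ℚ.∣ q ℚ.- x i ∣
    dist-> {x = x} {q} {i} {j} inc i<j q> = <ˢ-const⁻ {ℚ.∣ q ℚ.- x j ∣} {ℚ.∣ q ℚ.- x i ∣}
      (mean<⇒nearer {λ _ → q} {λ _ → x i} {λ _ → x j} (<ˢ-const⁺ (inc i j i<j))
          (<ˢ-const⁺ {meanℚ x i j} {q} q>))

    ranked-const : ∀ {x : Vector ℚ m} {q σ} → Sorts (λ i → ℚ.∣ q ℚ.- x i ∣) σ →
        Ranked (embed x) σ (λ _ → q)
    ranked-const {x = x} {q} {σ} inc k k′ k<k′ =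
      <ˢ-const⁺ {ℚ.∣ q ℚ.- x (σ ⟨$⟩ʳ k) ∣} {ℚ.∣ q ℚ.- x (σ ⟨$⟩ʳ k′) ∣} (inc k k′ k<k′)

  module _ {x : Vector ℚ m} (inc : Increasingℚ x) {q} (q≢ : ∀ {w} → w ∈ meanValues x → q ≢ w) where

    private
      key : Fin m → ℚ
      key i = ℚ.∣ q ℚ.- x i ∣

      key-apart : ∀ {i j} → i Fin.< j → key i ≢ key j
      key-apart {i} {j} i<j with ℚ.<-cmp q (meanℚ x i j)
      ... | tri< q< _ _ = ℚ.<⇒≢ (dist-< {x = x} inc i<j q<)
      ... | tri≈ _ q≡ _ = contradiction q≡ (q≢ (mean∈meanValues x i j))
      ... | tri> _ _ q> = ≢-sym (ℚ.<⇒≢ (dist-> {x = x} inc i<j q>))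

      key-injective : ∀ {i j} → key i ≡ key j → i ≡ j
      key-injective {i} {j} eq with Fin.<-cmp i j
      ... | tri< i<j _ _ = contradiction eq (key-apart i<j)
      ... | tri≈ _ i≡j _ = i≡j
      ... | tri> _ _ j<i = contradiction (sym eq) (key-apart j<i)

    -- A point that is no midpoint is equidistant from no two coordinates, so its distances can be
    -- sorted strictly.
    ranking : ∃[ σ ] Sorts (λ i → ℚ.∣ q ℚ.- x i ∣) σ
    ranking = sort key key-injective

  -- An ideal point q between the two midpoints, chosen off all midpoints of x, has a ranking that
  -- inverts (i , j) and keeps (k , l). This ranking belongs to the pattern of y too, where
  -- consistency orders the two midpoints in the same way.
  RP-⊆⇒SameOrder : ∀ {x y : Vector ℚ m} → Increasingℚ x → Increasingℚ y →
    (∀ {σ} → RP (embed x) σ → RP (embed y) σ) → SameOrder (embed x) (embed y)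
  RP-⊆⇒SameOrder {m} {x} {y} incx incy sub {i} {j} {k} {l} i<j k<l x< = go
      (between-means x (mean-<⇐ x {i} {j} {k} {l} x<))
    where
    go : ∃[ q ] (meanℚ x i j ℚ.< q × q ℚ.< meanℚ x k l × (∀ {w} → w ∈ meanValues x → q ≢ w)) →
        mean (embed y) i j <ˢ mean (embed y) k l
    go (q , <q , q< , q≢) = go′ (ranking incx q≢)
      where
      go′ : ∃[ σ ] Sorts (λ i → ℚ.∣ q ℚ.- x i ∣) σ → mean (embed y) i j <ˢ mean (embed y) k l
      go′ (σ , inc) = RP⇒Consistent {x = embed y} (embed-increasing incy) {σ}
        (sub {σ} (Ranked⇒RP (embed x) σ (q , ranked-const {x = x} {q} {σ} inc)))
        {i} {j} {k} {l} i<j k<l (at (dist-> {x = x} incx i<j <q)) (at (dist-< {x = x} incx k<l q<))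
        where
        at : ∀ {a b} → ℚ.∣ q ℚ.- x a ∣ ℚ.< ℚ.∣ q ℚ.- x b ∣ → pos σ a Fin.< pos σ b
        at {a} {b} lt = increasingℚ-cancel {x = λ i → ℚ.∣ q ℚ.- x (σ ⟨$⟩ʳ i) ∣} inc
          (subst₂ (λ u v → ℚ.∣ q ℚ.- x u ∣ ℚ.< ℚ.∣ q ℚ.- x v ∣) (sym (inverseʳ σ {a}))
              (sym (inverseʳ σ {b})) lt)

  <ˢ⇒ev : ∀ {s t} → s <ˢ t → Ev (λ n → s n ℚ.< t n)
  <ˢ⇒ev {s} (mk< ε 0<ε (N , p)) = N , λ n N≤n → ℚ.<-≤-trans (<-by {a = s n} 0<ε refl) (p n N≤n)

  module _ (p : OrderedGeneric m) where
    private
      x = point p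

    point-increasing : Increasingˢ x
    point-increasing i j i<j = <⇒<ˢ (x i) (x j) (increasing p i j i<j)

    point-generic : Genericˢ x
    point-generic {i} {j} {k} {l} = Generic⇒Genericˢ {x = x} (generic p) {i} {j} {k} {l}

    private
      -- The comparison of the real midpoints is stored with that of their n-th terms, so that the
      -- two are known to agree.
      Approx : ℕ → Fin m → Fin m → Fin m → Fin m → Set
      Approx n i j k l = (mean x i j <ˢ mean x k l × mean x i j n ℚ.< mean x k l n)
                       ⊎ (mean x k l <ˢ mean x i j × mean x k l n ℚ.< mean x i j n)

      approx-at : ∀ {i j k l} → i Fin.< j → k Fin.< l → (i , j) ≢ (k , l) → Ev (λ n → Approx n i j k l)
      approx-at {i} {j} {k} {l} i<j k<l ij≢kl with point-generic {i} {j} {k} {l} i<j k<l ij≢kl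
      ... | inj₁ lt = let N , f = <ˢ⇒ev lt in N , λ n N≤n → inj₁ (lt , f n N≤n)
      ... | inj₂ gt = let N , f = <ˢ⇒ev gt in N , λ n N≤n → inj₂ (gt , f n N≤n)

      Approximation : ℕ → Set
      Approximation n = (∀ i j → i Fin.< j → seq (x i) n ℚ.< seq (x j) n)
        × (∀ i j k l → i Fin.< j → k Fin.< l → (i , j) ≢ (k , l) → Approx n i j k l)

      approximation : Ev Approximation
      approximation = ev-zip _,_
        (ev-∀ λ i → ev-∀ λ j → ev-→ (i Fin.<? j) λ i<j → <ˢ⇒ev (point-increasing i j i<j))
        (ev-∀ λ i → ev-∀ λ j → ev-∀ λ k → ev-∀ λ l →
          ev-→ (i Fin.<? j) λ i<j → ev-→ (k Fin.<? l) λ k<l → ev-→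
              (¬? (≡-dec Fin._≟_ Fin._≟_ (i , j) (k , l))) λ ij≢kl →
            approx-at {i} {j} {k} {l} i<j k<l ij≢kl)

      module At (n : ℕ) (a : Approximation n) where
        y : Vector ℚ m
        y i = seq (x i) n

        opaque
          unfolding meanˢ meanℚ

          mean-at : ∀ i j → mean x i j n ≡ meanℚ y i j
          mean-at i j = refl

        y-generic : ∀ {i j k l} → i Fin.< j → k Fin.< l → (i , j) ≢ (k , l) → meanℚ y i j ≢ meanℚ y k l
        y-generic {i} {j} {k} {l} i<j k<l ij≢kl eq with proj₂ a i j k l i<j k<l ij≢kl
        ... | inj₁ (_ , <) = ℚ.<-irrefl eq (subst₂ ℚ._<_ (mean-at i j) (mean-at k l) <)
        ... | inj₂ (_ , >) = ℚ.<-irrefl (sym eq) (subst₂ ℚ._<_ (mean-at k l) (mean-at i j) >)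

        y-OG : OrderedGenericℚ y
        y-OG = mkOG (proj₁ a) (mkEquiv (increasing-gaps (proj₁ a) (proj₁ a))
          (λ {i} {j} {k} {l} i<j k<l i<k j≢k j≢l → ≢0⇒ss λ q≡0 →
            y-generic i<j k<l (λ { refl → Fin.<-irrefl refl i<k }) (mean-≡ y i j k l q≡0)))
          where
          mean-≡ : ∀ (y : Vector ℚ m) i j k l → quad y i j k l ≡ 0ℚ → meanℚ y i j ≡ meanℚ y k l
          mean-≡ y i j k l q≡0 = begin
            meanℚ y i j
              ≡⟨ solve 2 (λ a b → a := (a :- b) :+ b) refl (meanℚ y i j) (meanℚ y k l) ⟩
            (meanℚ y i j ℚ.- meanℚ y k l) ℚ.+ meanℚ y k l
              ≡⟨ cong (ℚ._+ meanℚ y k l) (trans (mean-quad y i j k l)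
                  (trans (cong (½ ℚ.*_) q≡0) (ℚ.*-zeroʳ ½))) ⟩
            0ℚ ℚ.+ meanℚ y k l
              ≡⟨ ℚ.+-identityˡ _ ⟩
            meanℚ y k l ∎
            where open ≡-Reasoning

        same-order : SameOrder x (embed y)
        same-order {i} {j} {k} {l} i<j k<l x< with ≡-dec Fin._≟_ Fin._≟_ (i , j) (k , l)
        ... | yes refl = contradiction x< <ˢ-irrefl
        ... | no ij≢kl with proj₂ a i j k l i<j k<l ij≢kl
        ...   | inj₁ (_ , <) = mean-<⇒ y {i} {j} {k} {l} (subst₂ ℚ._<_ (mean-at i j) (mean-at k l) <)
        ...   | inj₂ (x> , _) = contradiction x< (<ˢ-asym x>)

    -- Finitely many strict inequalities hold for the n-th terms from some index on; at that index
    -- the terms form a rational configuration with the midpoint order of the reals.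
    rational-point : ∃[ y ] (OrderedGenericℚ y × SameOrder x (embed y))
    rational-point = let N , f = approximation ; a = f N ℕ.≤-refl in At.y N a , At.y-OG N a , At.same-order N a

  SameOrder⇒≐ : ∀ {x y : Vector ℝ m} → Increasingˢ x → Genericˢ x → Increasingˢ y →
      SameOrder x y → RP x ≐ RP y
  SameOrder⇒≐ {x = x} {y} incx genx incy ord =
    (λ {σ} → SameOrder⇒⊆ {x = x} {y} incx incy ord {σ}) ,
    (λ {σ} → SameOrder⇒⊆ {x = y} {x} incy incx (SameOrder-sym {x = x} {y} genx ord) {σ})

  Equiv⇒≐ : ∀ {x y : Vector ℚ m} → OrderedGenericℚ x → OrderedGenericℚ y → Equiv x y →
      RP (embed x) ≐ RP (embed y)
  Equiv⇒≐ {x = x} {y} ox oy e = SameOrder⇒≐ {x = embed x} {embed y} (embed-increasing (incr ox))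
    (embed-generic (gen ox)) (embed-increasing (incr oy)) (Equiv⇒SameOrder {x = x} {y} e)

  ≐⇒Equiv : ∀ {x y : Vector ℚ m} → OrderedGenericℚ x → OrderedGenericℚ y →
      RP (embed x) ≐ RP (embed y) → Equiv x y
  ≐⇒Equiv {x = x} {y} ox oy (sub , _) = SameOrder⇒Equiv {x = x} {y} ox oy
    (RP-⊆⇒SameOrder {x = x} {y} (incr ox) (incr oy) (λ {σ} → sub {σ}))

  module _ (n : ℕ) where
    private
      rep : Fin (length (reps n)) → Vector ℚ (suc n)
      rep = lookup (reps n)

      rep-OG : ∀ i → OrderedGenericℚ (rep i)
      rep-OG i = All.lookup reps-OG (∈-lookup {xs = reps n} i)

      rep-injective : ∀ {i j} → RP (embed (rep i)) ≐ RP (embed (rep j)) → i ≡ j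
      rep-injective {i} {j} eq = lookup-injective Equiv-sym Equiv-trans reps-distinct
        (≐⇒Equiv {x = rep i} {rep j} (rep-OG i) (rep-OG j) eq)

      rep-surjective : ∀ p → ∃[ i ] (RP (embed (rep i)) ≐ RP (point p))
      rep-surjective p = index found , ≐-trans {j = RP (embed y)}
        (Equiv⇒≐ {x = rep (index found)} {y} (rep-OG (index found)) oy
            (Equiv-sym (Any.lookup-index found)))
        (≐-sym {x = RP (point p)} (SameOrder⇒≐ {x = point p} {embed y} (point-increasing p)
            (λ {i} {j} {k} {l} → point-generic p {i} {j} {k} {l})
          (embed-increasing (incr oy)) ord))
        where
        y = proj₁ (rational-point p)
        oy = proj₁ (proj₂ (rational-point p))
        ord = proj₂ (proj₂ (rational-point p))
        found = reps-complete oy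

    numberOfRankingPatterns : IsNumberOfRankingPatterns (suc n) (length (reps n))
    numberOfRankingPatterns = record
      { to        = λ i → embedOG (rep-OG i)
      ; cong      = λ { refl → ≐-refl }
      ; bijective = (λ {i} {j} eq → rep-injective {i} {j} eq)
                  , λ p → proj₁ (rep-surjective p) , λ { refl → proj₂ (rep-surjective p) }
      }

-- Assembly of the two bounds

open import Defs
open import Data.Integer.Base using (+_)
open import Data.Nat.Combinatorics using (_C_)
open import Algebra.Definitions.RawSemiring +-*-rawSemiring using () renaming (_^_ to _^ℚ_)
open Signs
open Arrangements using (maxChambers)
open Estimates
open Points using (forms; length-forms; allReps; length-allReps)
open Patterns
open Recurrence
open Realisation

-- With m = 4 + j, the two sides differ by exactly 2 (m - 4) m (m - 1), which is nonnegative from m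
-- = 4 on.
length-forms-bound : ∀ j → 8 ℕ.* length (forms (3 ℕ.+ j)) ℕ.≤ (2 ℕ.+ j) ℕ.*
    ((4 ℕ.+ j) ℕ.* (3 ℕ.+ j) ℕ.^ 2)
length-forms-bound j = begin
  8 ℕ.* length (forms (3 ℕ.+ j))
    ≡⟨ cong (8 ℕ.*_) (length-forms (3 ℕ.+ j)) ⟩
  8 ℕ.* (((4 ℕ.+ j) C 2) ℕ.+ 3 ℕ.* ((4 ℕ.+ j) C 4))
    ≡⟨ lemma₁ ((4 ℕ.+ j) C 2) ((4 ℕ.+ j) C 4) ⟩
  4 ℕ.* (2 ℕ.* ((4 ℕ.+ j) C 2)) ℕ.+ 24 ℕ.* ((4 ℕ.+ j) C 4)
    ≡⟨ cong₂ (λ a b → 4 ℕ.* a ℕ.+ b) (C-closed-2 (2 ℕ.+ j)) (C-closed-4 j) ⟩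
  4 ℕ.* ((4 ℕ.+ j) ℕ.* (3 ℕ.+ j)) ℕ.+ (4 ℕ.+ j) ℕ.* (3 ℕ.+ j) ℕ.* (2 ℕ.+ j) ℕ.* (1 ℕ.+ j)
    ≤⟨ ℕ.m≤m+n _ (2 ℕ.* j ℕ.* ((4 ℕ.+ j) ℕ.* (3 ℕ.+ j))) ⟩
  4 ℕ.* ((4 ℕ.+ j) ℕ.* (3 ℕ.+ j)) ℕ.+ (4 ℕ.+ j) ℕ.* (3 ℕ.+ j) ℕ.* (2 ℕ.+ j) ℕ.* (1 ℕ.+ j)
    ℕ.+ 2 ℕ.* j ℕ.* ((4 ℕ.+ j) ℕ.* (3 ℕ.+ j))
    ≡⟨ lemma₂ j ⟩
  (2 ℕ.+ j) ℕ.* ((4 ℕ.+ j) ℕ.* (3 ℕ.+ j) ℕ.^ 2) ∎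
  where
  open ℕ.≤-Reasoning
  lemma₁ : ∀ a b → 8 ℕ.* (a ℕ.+ 3 ℕ.* b) ≡ 4 ℕ.* (2 ℕ.* a) ℕ.+ 24 ℕ.* b
  lemma₁ = ℕ-Ring.solve-∀
  lemma₂ : ∀ j → 4 ℕ.* ((4 ℕ.+ j) ℕ.* (3 ℕ.+ j)) ℕ.+ (4 ℕ.+ j) ℕ.* (3 ℕ.+ j) ℕ.* (2 ℕ.+ j) ℕ.* (1 ℕ.+ j)
    ℕ.+ 2 ℕ.* j ℕ.* ((4 ℕ.+ j) ℕ.* (3 ℕ.+ j)) ≡ (2 ℕ.+ j) ℕ.*
        ((4 ℕ.+ j) ℕ.* ((3 ℕ.+ j) ℕ.* ((3 ℕ.+ j) ℕ.* 1)))
  lemma₂ = ℕ-Ring.solve-∀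

-- Having at least as many hyperplanes as dimensions is what makes the chosen t at most 1.
length-forms-≥ : ∀ j → 3 ℕ.+ j ℕ.≤ length (forms (3 ℕ.+ j))
length-forms-≥ j = subst (3 ℕ.+ j ℕ.≤_) (sym (length-forms (3 ℕ.+ j)))
    (ℕ.≤-trans (ℕ.*-cancelˡ-≤ {3 ℕ.+ j} {(4 ℕ.+ j) C 2} 2 (begin
  2 ℕ.* (3 ℕ.+ j)               ≤⟨ ℕ.*-monoˡ-≤ (3 ℕ.+ j) (ℕ.m≤m+n 2 (2 ℕ.+ j)) ⟩
  (4 ℕ.+ j) ℕ.* (3 ℕ.+ j)       ≡⟨ C-closed-2 (2 ℕ.+ j) ⟨
  2 ℕ.* ((4 ℕ.+ j) C 2)         ∎)) (ℕ.m≤m+n ((4 ℕ.+ j) C 2) (3 ℕ.* ((4 ℕ.+ j) C 4))))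
  where open ℕ.≤-Reasoning

seq-^ : ∀ x k n → seq (x ^ k) n ≡ seq x n ^ℚ k
seq-^ x zero    n = refl
seq-^ x (suc k) n = cong (seq x n ℚ.*_) (seq-^ x k n)

expSum-< : ∀ n → expSum n ℚ.< expSum (suc n)
expSum-< n = <-by (0<1/! (suc n)) refl

expSum-mono : ∀ {m n} → m ℕ.≤′ n → expSum m ℚ.≤ expSum n
expSum-mono ℕ.≤′-refl = ℚ.≤-refl
expSum-mono {n = suc n} (ℕ.≤′-step m≤n) = ℚ.≤-trans (expSum-mono m≤n) (ℚ.<⇒≤ (expSum-< n))

0≤expSum : ∀ n → 0ℚ ℚ.≤ expSum n
0≤expSum n = ℚ.≤-trans (ℚ.<⇒≤ (0<1/! 0)) (expSum-mono (ℕ.≤⇒≤′ (ℕ.z≤n {n})))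

-- The margin B - A compares two consecutive partial sums of e. Their strict inequality survives the
-- power because the exponent is positive, and all later terms stay above B.
<-e-power : ∀ {r c q} k n → 0ℚ ℚ.< c → 0ℚ ℚ.< q → r ℚ.≤ c ℚ.* (expSum n ℚ.* q) ^ℚ suc k →
  fromℚ r < fromℚ c * (e * fromℚ q) ^ suc k
<-e-power {r} {c} {q} k n 0<c 0<q r≤ = B ℚ.- A , p<q⇒0<q-p A<B , suc n , λ i n<i → begin
  r ℚ.+ (B ℚ.- A)                                ≤⟨ ℚ.+-monoˡ-≤ (B ℚ.- A) r≤ ⟩
  A ℚ.+ (B ℚ.- A)                                ≡⟨ solve 2 (λ a b → a :+ (b :- a) := b) refl A B ⟩
  B                                              ≤⟨ mono (expSum-mono (ℕ.≤⇒≤′ n<i)) ⟩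
  c ℚ.* (expSum i ℚ.* q) ^ℚ suc k                ≡⟨ cong (c ℚ.*_) (seq-^ (e * fromℚ q) (suc k) i) ⟨
  c ℚ.* seq ((e * fromℚ q) ^ suc k) i            ∎
  where
  open ℚ.≤-Reasoning
  A = c ℚ.* (expSum n ℚ.* q) ^ℚ suc k
  B = c ℚ.* (expSum (suc n) ℚ.* q) ^ℚ suc k
  A<B : A ℚ.< B
  A<B = ℚ.*-monoʳ-<-pos c {{ℚ.positive 0<c}} (^-mono-< (0≤p*q (0≤expSum n) (ℚ.<⇒≤ 0<q))
    (ℚ.*-monoˡ-<-pos q {{ℚ.positive 0<q}} (expSum-< n)) k)
  mono : ∀ {a} → expSum (suc n) ℚ.≤ a → B ℚ.≤ c ℚ.* (a ℚ.* q) ^ℚ suc k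
  mono ≤a = ℚ.*-monoˡ-≤-nonNeg c {{ℚ.nonNegative (ℚ.<⇒≤ 0<c)}}
    (^-mono-≤ (0≤p*q (0≤expSum (suc n)) (ℚ.<⇒≤ 0<q))
      (ℚ.*-monoʳ-≤-nonNeg q {{ℚ.nonNegative (ℚ.<⇒≤ 0<q)}} ≤a) (suc k))

maxChambers⇒upper : ∀ r f k s n .{{_ : ℕ.NonZero f}} → f ℕ.* r ℕ.≤ maxChambers (suc (suc n)) (suc k) →
  k ℕ.≤ suc n → 8 ℕ.* suc (suc n) ℕ.≤ k ℕ.* s →
  ι r ℚ.≤ (+ 2 / f) ℚ.* (expSum (suc n) ℚ.* (+ s / 8)) ^ℚ k
maxChambers⇒upper r f k s n count k≤ 8F≤ = ℚ.*-cancelʳ-≤-pos (ι f) {{ℚ.positive (0<ι f)}} (begin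
  ι r ℚ.* ι f                           ≡⟨ trans (ℚ.*-comm (ι r) (ι f)) (sym (ι-* f r)) ⟩
  ι (f ℕ.* r)                           ≤⟨ ι-mono count ⟩
  ι (maxChambers (suc (suc n)) (suc k)) ≤⟨ maxChambers-exp n k k≤ 0≤q q-large ⟩
  ι 2 ℚ.* X                             ≡⟨ cong (ℚ._* X) (/-*-ι 2 f) ⟨
  (c ℚ.* ι f) ℚ.* X                     ≡⟨ solve 3 (λ c f x → (c :* f) :* x := (c :* x) :* f) refl
      c (ι f) X ⟩
  (c ℚ.* X) ℚ.* ι f                     ∎)
  where
  open ℚ.≤-Reasoning
  q = + s / 8
  c = + 2 / f
  X = (expSum (suc n) ℚ.* q) ^ℚ k
  0≤q : 0ℚ ℚ.≤ q
  0≤q = ℚ.nonNegative⁻¹ q {{ℚ.normalize-nonNeg s 8}}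
  -- `maxChambers-exp` compares one less than the number of hyperplanes with q k, while the
  -- hypothesis bounds the whole number; the difference is discarded.
  q-large : ι (suc n) ℚ.≤ q ℚ.* ι k
  q-large = ℚ.*-cancelʳ-≤-pos (ι 8) {{ℚ.positive (0<ι 8)}} (begin
    ι (suc n) ℚ.* ι 8         ≡⟨ ι-* (suc n) 8 ⟨
    ι (suc n ℕ.* 8)           ≤⟨ ι-mono (ℕ.≤-trans (ℕ.*-monoˡ-≤ 8 (ℕ.n≤1+n (suc n)))
                                   (ℕ.≤-trans (ℕ.≤-reflexive (ℕ.*-comm (suc (suc n)) 8)) 8F≤)) ⟩
    ι (k ℕ.* s)               ≡⟨ ι-* k s ⟩
    ι k ℚ.* ι s               ≡⟨ cong (ι k ℚ.*_) (/-*-ι s 8) ⟨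
    ι k ℚ.* (q ℚ.* ι 8)       ≡⟨ solve 3 (λ k q t → k :* (q :* t) := (q :* k) :* t) refl (ι k) q (ι 8) ⟩
    (q ℚ.* ι k) ℚ.* ι 8       ∎)

maxChambers⇒< : ∀ r f k s F .{{_ : ℕ.NonZero f}} .{{_ : ℕ.NonZero k}} .{{_ : ℕ.NonZero s}} →
  f ℕ.* r ℕ.≤ maxChambers F (suc k) → suc k ℕ.≤ F → 8 ℕ.* F ℕ.≤ k ℕ.* s →
  fromℕ r < fromℚ (+ 2 / f) * (e * fromℚ (+ s / 8)) ^ k
maxChambers⇒< r f (suc k) s (suc (suc n)) count (ℕ.s≤s k≤) 8F≤ = <-e-power k (suc n)
  (ℚ.positive⁻¹ (+ 2 / f) {{ℚ.normalize-pos 2 f}}) (ℚ.positive⁻¹ (+ s / 8) {{ℚ.normalize-pos s 8}})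
  (subst (ℚ._≤ (+ 2 / f) ℚ.* (expSum (suc n) ℚ.* (+ s / 8)) ^ℚ suc k) (ι≡/1 r)
    (maxChambers⇒upper r f (suc k) s n count k≤ 8F≤))

[3/4]^j*4^j : ∀ j → (+ 3 / 4) ^ℚ j ℚ.* ι (4 ℕ.^ j) ≡ ι (3 ℕ.^ j)
[3/4]^j*4^j zero    = ℚ.*-identityˡ (ι 1)
[3/4]^j*4^j (suc j) = begin
  ((+ 3 / 4) ℚ.* P) ℚ.* ι (4 ℕ.* 4 ℕ.^ j)         ≡⟨ cong (((+ 3 / 4) ℚ.* P) ℚ.*_) (ι-* 4 (4 ℕ.^ j)) ⟩
  ((+ 3 / 4) ℚ.* P) ℚ.* (ι 4 ℚ.* ι (4 ℕ.^ j))     ≡⟨ solve 4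
      (λ a p b f → (a :* p) :* (b :* f) := (a :* b) :* (p :* f)) refl (+ 3 / 4) P (ι 4)
      (ι (4 ℕ.^ j)) ⟩
  ((+ 3 / 4) ℚ.* ι 4) ℚ.* (P ℚ.* ι (4 ℕ.^ j))     ≡⟨ cong₂ ℚ._*_ (/-*-ι 3 4) ([3/4]^j*4^j j) ⟩
  ι 3 ℚ.* ι (3 ℕ.^ j)                             ≡⟨ ι-* 3 (3 ℕ.^ j) ⟨
  ι (3 ℕ.* 3 ℕ.^ j)                               ∎
  where
  open ≡-Reasoning
  P = (+ 3 / 4) ^ℚ j

lower-bound : ∀ j → ι 2 ℚ.* (+ 3 / 4) ^ℚ j ℚ.* ι ((suc j !) ℕ.^ 2) ℚ.≤ ι (length (reps (3 ℕ.+ j)))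
lower-bound j = ℚ.*-cancelʳ-≤-pos (ι f) {{ℚ.positive (0<ι f {{ℕ.m^n≢0 4 j}})}} (begin
  (ι 2 ℚ.* P ℚ.* ι s) ℚ.* ι f      ≡⟨ solve 4 (λ a p s f → (a :* p :* s) :* f := a :* (p :* f) :*
      s) refl (ι 2) P (ι s) (ι f) ⟩
  ι 2 ℚ.* (P ℚ.* ι f) ℚ.* ι s      ≡⟨ cong (λ z → ι 2 ℚ.* z ℚ.* ι s) ([3/4]^j*4^j j) ⟩
  ι 2 ℚ.* ι (3 ℕ.^ j) ℚ.* ι s      ≡⟨ cong (ℚ._* ι s) (ι-* 2 (3 ℕ.^ j)) ⟨
  ι (2 ℕ.* 3 ℕ.^ j) ℚ.* ι s        ≡⟨ ι-* (2 ℕ.* 3 ℕ.^ j) s ⟨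
  ι (2 ℕ.* 3 ℕ.^ j ℕ.* s)          ≤⟨ ι-mono (reps-lower j) ⟩
  ι (f ℕ.* r)                      ≡⟨ trans (ι-* f r) (ℚ.*-comm (ι f) (ι r)) ⟩
  ι r ℚ.* ι f                      ∎)
  where
  open ℚ.≤-Reasoning
  P = (+ 3 / 4) ^ℚ j
  f = 4 ℕ.^ j
  s = (suc j !) ℕ.^ 2
  r = length (reps (3 ℕ.+ j))

opaque
  unfolding ι

  ι-≤⇒/1-≤ : ∀ a P s r → ι a ℚ.* P ℚ.* ι s ℚ.≤ ι r → (+ a / 1) ℚ.* P ℚ.* (+ s / 1) ℚ.≤ (+ r / 1)
  ι-≤⇒/1-≤ a P s r h = h

4+ : ∀ {m} → 4 ℕ.≤ m → ∃[ j ] m ≡ 4 ℕ.+ j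
4+ 4≤m = _ , sym (ℕ.m+[n∸m]≡n 4≤m)

isNumber : ∀ {m} → 4 ℕ.≤ m → IsNumberOfRankingPatterns m (length (reps (m ∸ 1)))
isNumber {suc n} _ = numberOfRankingPatterns n

lower : ∀ {m} → 4 ℕ.≤ m →
  ι 2 ℚ.* (+ 3 / 4) ^ℚ (m ∸ 4) ℚ.* ι (((m ∸ 3) !) ℕ.^ 2) ℚ.≤ ι (length (reps (m ∸ 1)))
lower 4≤m with 4+ 4≤m
... | j , refl = lower-bound j

-- Matching m with 4 + j is confined to the proof, so that the statement can keep the truncated
-- subtractions of the theorem; the dimension is written as a successor to fit `maxChambers⇒<`.
upper-count : ∀ {m} → 4 ℕ.≤ m →
    m ! ℕ.* length (reps (m ∸ 1)) ℕ.≤ maxChambers (length (forms (m ∸ 1))) (suc (m ∸ 2))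
  × suc (m ∸ 2) ℕ.≤ length (forms (m ∸ 1))
  × 8 ℕ.* length (forms (m ∸ 1)) ℕ.≤ (m ∸ 2) ℕ.* (m ℕ.* (m ∸ 1) ℕ.^ 2)
  × ℕ.NonZero (m ∸ 2) × ℕ.NonZero (m ℕ.* (m ∸ 1) ℕ.^ 2)
upper-count 4≤m with 4+ 4≤m
... | j , refl = ℕ.≤-trans (!*reps≤allReps (3 ℕ.+ j)) (length-allReps (3 ℕ.+ j))
  , length-forms-≥ j , length-forms-bound j , _
  , ℕ.m*n≢0 (4 ℕ.+ j) ((3 ℕ.+ j) ℕ.^ 2) {{_}} {{ℕ.m^n≢0 (3 ℕ.+ j) 2}}

theorem3p4 : ∀ m → 4 ℕ.≤ m →
    ∃[ r ] ( IsNumberOfRankingPatterns m r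
    × (+ 2 / 1) ℚ.* ((+ 3 / 4) ^ℚ (m ∸ 4)) ℚ.* (+ (((m ∸ 3) !) ℕ.^ 2) / 1) ℚ.≤ (+ r / 1)
    × fromℕ r < fromℚ ((+ 2 / (m !)) {{m !≢0}}) * ((e * fromℚ (+ (m ℕ.* (m ∸ 1) ℕ.^ 2) / 8)) ^ (m ∸ 2)) )
theorem3p4 m 4≤m = let count , k≤ , F≤ , k≢0 , s≢0 = upper-count 4≤m in
  length (reps (m ∸ 1)) , isNumber 4≤m ,
  ι-≤⇒/1-≤ 2 ((+ 3 / 4) ^ℚ (m ∸ 4)) (((m ∸ 3) !) ℕ.^ 2) (length (reps (m ∸ 1))) (lower 4≤m) ,
  maxChambers⇒< (length (reps (m ∸ 1))) (m !) (m ∸ 2) (m ℕ.* (m ∸ 1) ℕ.^ 2) (length (forms (m ∸ 1)))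
    {{m !≢0}} {{k≢0}} {{s≢0}} count k≤ F≤
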